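{- For $q$ with $0<|q|<1$ and $\zeta$ with $|q|<|\zeta|<1$, define $$\bar P_\omega(\zeta;q):=\frac{(q;q)_\infty}{(\zeta;q)_\infty(\zeta^{ -1}q;q)_\infty(-q;q^2)_\infty}\sum_{n\ge1}\frac{(\zeta;q)_n(\zeta^{ -1}q;q)_n(-q;q^2)_n}{(q;q)_{2n}}q^n.$$ Then $$\bar P_\omega(\zeta;q)=\frac{1}{(\zeta;q)_\infty(\zeta^{ -1}q;q)_\infty(q;q)_\infty}\sum_{j\ge1}\sum_{n\ge0}\frac{(-1)^{j+1}i^n(1-\zeta^j)\big(1-(\zeta^{ -1}q)^j\big)q^{\frac{j(j+1)}{2}+n(j+\frac12)}}{1+iq^{j+n+\frac12}}.$$
   Context: $(a;q)_n=\prod_{j=0}^{n-1}(1-aq^j)$ for $n\in\mathbb N_0\cup\{\infty\}$. Here $q=e^{2\pi i\tau}$ with $\tau\in\mathbb H$ and $q^{r}:=e^{2\pi i r\tau}$ for rational $r$. Note $\bar P_\omega(1;q)$ (taken as a limit $\zeta\to1$) equals the overpartition generating function $\bar P_\omega(q)=\sum_{n\ge1}\frac{(-q^{n+1};q)_n(-q^{2n+2};q^2)_\infty}{(1-q^n)(q^{n+1};q)_n(q^{2n+2};q^2)_\infty}q^n$. -}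

module Defs where

open import Algebra.Bundles using (RawRing)
import Algebra.Definitions.RawSemiring as RawSemiringDefinitions
open import Data.Fin.Base using (toℕ)
open import Data.Nat.Base as ℕ using (ℕ; suc)
import Data.Nat.Properties as ℕ
open import Data.Product.Base using (_,_; _×_; ∃-syntax; Σ-syntax)
open import Data.Rational.Base as ℚ using (ℚ; 0ℚ; 1ℚ)
import Data.Rational.Properties as ℚ
open import Data.Sum.Base using (inj₁; inj₂)
open import Data.Rational.Solver using (module +-*-Solver)
open import Function.Base using (_∘_)
open import Level using (0ℓ)
open import Relation.Binary.PropositionalEquality.Core
  using (_≡_; refl; sym; trans; cong; cong₂; subst; subst₂)

∣p-p∣≡0 : ∀ p → ℚ.∣ p ℚ.- p ∣ ≡ 0ℚ
∣p-p∣≡0 p = cong ℚ.∣_∣ (ℚ.+-inverseʳ p)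

split : ∀ K ε → 0ℚ ℚ.< K → 0ℚ ℚ.< ε → ∃[ δ ] (0ℚ ℚ.< δ × K ℚ.* δ ≡ ε)
split K ε 0<K 0<ε = K⁻¹ ℚ.* ε , 0<δ , eq
  where
  instance
    K-pos = ℚ.positive 0<K
    ε-pos = ℚ.positive 0<ε
    K-nonZero = ℚ.>-nonZero 0<K
  K⁻¹ = ℚ.1/ K
  instance
    K⁻¹-pos = ℚ.1/pos⇒pos K
  0<δ : 0ℚ ℚ.< K⁻¹ ℚ.* ε
  0<δ = ℚ.positive⁻¹ (K⁻¹ ℚ.* ε) ⦃ ℚ.pos*pos⇒pos K⁻¹ ε ⦄
  eq : K ℚ.* (K⁻¹ ℚ.* ε) ≡ ε
  eq = trans (sym (ℚ.*-assoc K K⁻¹ ε))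
         (trans (cong (ℚ._* ε) (ℚ.*-inverseʳ K)) (ℚ.*-identityˡ ε))

*-bound : ∀ {a b c d} → ℚ.∣ a ∣ ℚ.≤ c → ℚ.∣ b ∣ ℚ.< d → 0ℚ ℚ.< c →
          ℚ.∣ a ℚ.* b ∣ ℚ.< c ℚ.* d
*-bound {a} {b} {c} {d} a≤c b<d 0<c = begin-strict
  ℚ.∣ a ℚ.* b ∣          ≡⟨ ℚ.∣p*q∣≡∣p∣*∣q∣ a b ⟩
  ℚ.∣ a ∣ ℚ.* ℚ.∣ b ∣    ≤⟨ ℚ.*-monoʳ-≤-nonNeg ℚ.∣ b ∣ ⦃ ℚ.nonNegative (ℚ.0≤∣p∣ b) ⦄ a≤c ⟩
  c ℚ.* ℚ.∣ b ∣          <⟨ ℚ.*-monoʳ-<-pos c ⦃ ℚ.positive 0<c ⦄ b<d ⟩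
  c ℚ.* d                ∎
  where open ℚ.≤-Reasoning

triangle : ∀ a b {c d} → ℚ.∣ a ∣ ℚ.< c → ℚ.∣ b ∣ ℚ.< d → ℚ.∣ a ℚ.+ b ∣ ℚ.< c ℚ.+ d
triangle a b a<c b<d = ℚ.≤-<-trans (ℚ.∣p+q∣≤∣p∣+∣q∣ a b) (ℚ.+-mono-< a<c b<d)

∣p∣²-nonNeg : ∀ p → 0ℚ ℚ.≤ ℚ.∣ p ∣ ℚ.* ℚ.∣ p ∣
∣p∣²-nonNeg p = ℚ.nonNegative⁻¹ (ℚ.∣ p ∣ ℚ.* ℚ.∣ p ∣)
  ⦃ ℚ.nonNeg*nonNeg⇒nonNeg ℚ.∣ p ∣ ⦃ nn ⦄ ℚ.∣ p ∣ ⦃ nn ⦄ ⦄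
  where nn = ℚ.nonNegative (ℚ.0≤∣p∣ p)

square-nonNeg : ∀ p → 0ℚ ℚ.≤ p ℚ.* p
square-nonNeg p with ℚ.∣p∣≡p∨∣p∣≡-p p
... | inj₁ eq = subst (0ℚ ℚ.≤_) (cong₂ ℚ._*_ eq eq) (∣p∣²-nonNeg p)
... | inj₂ eq = subst (0ℚ ℚ.≤_)
  (trans (cong₂ ℚ._*_ eq eq) (solve 1 (λ x → :- x :* :- x := x :* x) refl p))
  (∣p∣²-nonNeg p)
  where open +-*-Solver

IsCauchy : (ℕ → ℚ) → Set
IsCauchy x = ∀ ε → 0ℚ ℚ.< ε →
  ∃[ N ] (∀ m n → N ℕ.≤ m → N ℕ.≤ n → ℚ.∣ x m ℚ.- x n ∣ ℚ.< ε)

record ℝ : Set where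
  constructor mkℝ
  field
    seq    : ℕ → ℚ
    cauchy : IsCauchy seq

open ℝ public

infix 4 _≈ᵣ_ _<ᵣ_

_≈ᵣ_ : ℝ → ℝ → Set
x ≈ᵣ y = ∀ ε → 0ℚ ℚ.< ε → ∃[ N ] (∀ n → N ℕ.≤ n → ℚ.∣ seq x n ℚ.- seq y n ∣ ℚ.< ε)

_<ᵣ_ : ℝ → ℝ → Set
x <ᵣ y = ∃[ ε ] (0ℚ ℚ.< ε × ∃[ N ] (∀ n → N ℕ.≤ n → seq x n ℚ.+ ε ℚ.≤ seq y n))

fromℚ : ℚ → ℝ
fromℚ p = mkℝ (λ _ → p) λ ε 0<ε →
  0 , λ _ _ _ _ → subst (ℚ._< ε) (sym (∣p-p∣≡0 p)) 0<ε

0ᵣ 1ᵣ : ℝ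
0ᵣ = fromℚ 0ℚ
1ᵣ = fromℚ 1ℚ

abstract

  eventually-bounded : ∀ x → IsCauchy x →
    ∃[ B ] (0ℚ ℚ.< B × ∃[ N ] (∀ n → N ℕ.≤ n → ℚ.∣ x n ∣ ℚ.≤ B))
  eventually-bounded x cx with cx 1ℚ (ℚ.positive⁻¹ 1ℚ)
  ... | N , close = B , 0<B , N , bound
    where
    B : ℚ
    B = 1ℚ ℚ.+ ℚ.∣ x N ∣
    0<B : 0ℚ ℚ.< B
    0<B = ℚ.+-mono-<-≤ (ℚ.positive⁻¹ 1ℚ) (ℚ.0≤∣p∣ (x N))
    open +-*-Solver
    bound : ∀ n → N ℕ.≤ n → ℚ.∣ x n ∣ ℚ.≤ B
    bound n N≤n = begin
      ℚ.∣ x n ∣                             ≡⟨ cong ℚ.∣_∣ (solve 2 (λ a b → a := (a :- b) :+ b) refl (x n) (x N)) ⟩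
      ℚ.∣ (x n ℚ.- x N) ℚ.+ x N ∣           ≤⟨ ℚ.∣p+q∣≤∣p∣+∣q∣ (x n ℚ.- x N) (x N) ⟩
      ℚ.∣ x n ℚ.- x N ∣ ℚ.+ ℚ.∣ x N ∣       ≤⟨ ℚ.+-monoˡ-≤ ℚ.∣ x N ∣ (ℚ.<⇒≤ (close n N N≤n ℕ.≤-refl)) ⟩
      B                                     ∎
      where open ℚ.≤-Reasoning

  +-cauchy : ∀ x y → IsCauchy x → IsCauchy y → IsCauchy (λ n → x n ℚ.+ y n)
  +-cauchy x y cx cy ε 0<ε with split (1ℚ ℚ.+ 1ℚ) ε (ℚ.positive⁻¹ (1ℚ ℚ.+ 1ℚ)) 0<ε
  ... | δ , 0<δ , 2δ≡ε with cx δ 0<δ | cy δ 0<δ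
  ... | M , close-x | N , close-y = M ℕ.⊔ N , λ m n l l′ →
    subst₂ ℚ._<_
      (cong ℚ.∣_∣ (solve 4 (λ a b c d → (a :- b) :+ (c :- d) := (a :+ c) :- (b :+ d)) refl
                    (x m) (x n) (y m) (y n)))
      δ+δ≡ε
      (triangle (x m ℚ.- x n) (y m ℚ.- y n)
        (close-x m n (ℕ.m⊔n≤o⇒m≤o M N l) (ℕ.m⊔n≤o⇒m≤o M N l′))
        (close-y m n (ℕ.m⊔n≤o⇒n≤o M N l) (ℕ.m⊔n≤o⇒n≤o M N l′)))
    where
    open +-*-Solver
    δ+δ≡ε : δ ℚ.+ δ ≡ ε
    δ+δ≡ε = trans (solve 1 (λ a → a :+ a := (con 1ℚ :+ con 1ℚ) :* a) refl δ) 2δ≡ε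

  neg-cauchy : ∀ x → IsCauchy x → IsCauchy (λ n → ℚ.- x n)
  neg-cauchy x cx ε 0<ε with cx ε 0<ε
  ... | N , close = N , λ m n l l′ →
    subst (λ p → ℚ.∣ p ∣ ℚ.< ε)
      (solve 2 (λ a b → b :- a := :- a :- :- b) refl (x m) (x n))
      (close n m l′ l)
    where open +-*-Solver

  product-difference : ∀ a b c d → a ℚ.* (c ℚ.- d) ℚ.+ d ℚ.* (a ℚ.- b) ≡ a ℚ.* c ℚ.- b ℚ.* d
  product-difference = solve 4
    (λ a b c d → a :* (c :- d) :+ d :* (a :- b) := a :* c :- b :* d) refl
    where open +-*-Solver

  product-close : ∀ a b c d {A B δ ε} → 0ℚ ℚ.< A → 0ℚ ℚ.< B → (A ℚ.+ B) ℚ.* δ ≡ ε →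
    ℚ.∣ a ∣ ℚ.≤ A → ℚ.∣ d ∣ ℚ.≤ B → ℚ.∣ a ℚ.- b ∣ ℚ.< δ → ℚ.∣ c ℚ.- d ∣ ℚ.< δ →
    ℚ.∣ a ℚ.* c ℚ.- b ℚ.* d ∣ ℚ.< ε
  product-close a b c d {A} {B} {δ} {ε} 0<A 0<B Kδ≡ε a≤A d≤B a-b<δ c-d<δ = begin-strict
    ℚ.∣ a ℚ.* c ℚ.- b ℚ.* d ∣                      ≡⟨ cong ℚ.∣_∣ (sym (product-difference a b c d)) ⟩
    ℚ.∣ a ℚ.* (c ℚ.- d) ℚ.+ d ℚ.* (a ℚ.- b) ∣      <⟨ triangle (a ℚ.* (c ℚ.- d)) (d ℚ.* (a ℚ.- b))
                                                         (*-bound {a} {c ℚ.- d} {A} {δ} a≤A c-d<δ 0<A)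
                                                         (*-bound {d} {a ℚ.- b} {B} {δ} d≤B a-b<δ 0<B) ⟩
    A ℚ.* δ ℚ.+ B ℚ.* δ                            ≡⟨ sym (ℚ.*-distribʳ-+ δ A B) ⟩
    (A ℚ.+ B) ℚ.* δ                                ≡⟨ Kδ≡ε ⟩
    ε                                              ∎
    where open ℚ.≤-Reasoning

  *-cauchy : ∀ x y → IsCauchy x → IsCauchy y → IsCauchy (λ n → x n ℚ.* y n)
  *-cauchy x y cx cy ε 0<ε =
    let A , 0<A , P , x≤A = eventually-bounded x cx
        B , 0<B , Q , y≤B = eventually-bounded y cy
        δ , 0<δ , Kδ≡ε    = split (A ℚ.+ B) ε (ℚ.+-mono-< 0<A 0<B) 0<ε
        M , close-x       = cx δ 0<δ
        N , close-y       = cy δ 0<δ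
        PQ = P ℕ.⊔ Q
        MN = M ℕ.⊔ N
        P≤ : ∀ {k} → PQ ℕ.⊔ MN ℕ.≤ k → P ℕ.≤ k
        P≤ l = ℕ.m⊔n≤o⇒m≤o P Q (ℕ.m⊔n≤o⇒m≤o PQ MN l)
        Q≤ : ∀ {k} → PQ ℕ.⊔ MN ℕ.≤ k → Q ℕ.≤ k
        Q≤ l = ℕ.m⊔n≤o⇒n≤o P Q (ℕ.m⊔n≤o⇒m≤o PQ MN l)
        M≤ : ∀ {k} → PQ ℕ.⊔ MN ℕ.≤ k → M ℕ.≤ k
        M≤ l = ℕ.m⊔n≤o⇒m≤o M N (ℕ.m⊔n≤o⇒n≤o PQ MN l)
        N≤ : ∀ {k} → PQ ℕ.⊔ MN ℕ.≤ k → N ℕ.≤ k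
        N≤ l = ℕ.m⊔n≤o⇒n≤o M N (ℕ.m⊔n≤o⇒n≤o PQ MN l)
    in PQ ℕ.⊔ MN , λ m n l l′ →
      product-close (x m) (x n) (y m) (y n) {A} {B} {δ} {ε} 0<A 0<B Kδ≡ε
        (x≤A m (P≤ l)) (y≤B n (Q≤ l′)) (close-x m n (M≤ l) (M≤ l′)) (close-y m n (N≤ l) (N≤ l′))

  reciprocal-difference : ∀ a b v w → a ℚ.* v ≡ 1ℚ → b ℚ.* w ≡ 1ℚ →
    v ℚ.* (w ℚ.* (b ℚ.- a)) ≡ v ℚ.- w
  reciprocal-difference a b v w av≡1 bw≡1 =
    trans (solve 4 (λ a b v w → v :* (w :* (b :- a)) := v :* (b :* w) :- w :* (a :* v)) refl a b v w)
      (trans (cong₂ (λ s t → v ℚ.* s ℚ.- w ℚ.* t) bw≡1 av≡1)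
        (cong₂ ℚ._-_ (ℚ.*-identityʳ v) (ℚ.*-identityʳ w)))
    where open +-*-Solver

  reciprocal-bound : ∀ η H a v → 0ℚ ℚ.< η → η ℚ.* H ≡ 1ℚ → η ℚ.≤ a → a ℚ.* v ≡ 1ℚ →
    0ℚ ℚ.< v → ℚ.∣ v ∣ ℚ.≤ H
  reciprocal-bound η H a v 0<η ηH≡1 η≤a av≡1 0<v =
    subst (ℚ._≤ H) (sym (ℚ.0≤p⇒∣p∣≡p (ℚ.<⇒≤ 0<v)))
      (ℚ.*-cancelˡ-≤-pos η ⦃ ℚ.positive 0<η ⦄
        (subst (η ℚ.* v ℚ.≤_) (trans av≡1 (sym ηH≡1))
          (ℚ.*-monoʳ-≤-nonNeg v ⦃ ℚ.nonNegative (ℚ.<⇒≤ 0<v) ⦄ η≤a)))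

  reciprocal-close : ∀ a b v w {H δ ε} → 0ℚ ℚ.< H → (H ℚ.* H) ℚ.* δ ≡ ε →
    a ℚ.* v ≡ 1ℚ → b ℚ.* w ≡ 1ℚ → ℚ.∣ v ∣ ℚ.≤ H → ℚ.∣ w ∣ ℚ.≤ H → ℚ.∣ b ℚ.- a ∣ ℚ.< δ →
    ℚ.∣ v ℚ.- w ∣ ℚ.< ε
  reciprocal-close a b v w {H} {δ} {ε} 0<H HHδ≡ε av≡1 bw≡1 v≤H w≤H b-a<δ = begin-strict
    ℚ.∣ v ℚ.- w ∣                    ≡⟨ cong ℚ.∣_∣ (sym (reciprocal-difference a b v w av≡1 bw≡1)) ⟩
    ℚ.∣ v ℚ.* (w ℚ.* (b ℚ.- a)) ∣    <⟨ *-bound {v} {w ℚ.* (b ℚ.- a)} {H} {H ℚ.* δ} v≤H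
                                          (*-bound {w} {b ℚ.- a} {H} {δ} w≤H b-a<δ 0<H) 0<H ⟩
    H ℚ.* (H ℚ.* δ)                  ≡⟨ sym (ℚ.*-assoc H H δ) ⟩
    (H ℚ.* H) ℚ.* δ                  ≡⟨ HHδ≡ε ⟩
    ε                                ∎
    where open ℚ.≤-Reasoning

  recip-cauchy : ∀ x → IsCauchy x → ∀ η → 0ℚ ℚ.< η → (∀ n → η ℚ.≤ x n) →
    (u : ℕ → ℚ) → (∀ n → x n ℚ.* u n ≡ 1ℚ) → (∀ n → 0ℚ ℚ.< u n) → IsCauchy u
  recip-cauchy x cx η 0<η η≤x u xu≡1 0<u ε 0<ε =
    let H , 0<H , ηH≡1    = split η 1ℚ 0<η (ℚ.positive⁻¹ 1ℚ)
        H-pos : ℚ.Positive H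
        H-pos = ℚ.positive 0<H
        0<HH : 0ℚ ℚ.< H ℚ.* H
        0<HH = ℚ.positive⁻¹ (H ℚ.* H) ⦃ ℚ.pos*pos⇒pos H ⦃ H-pos ⦄ H ⦃ H-pos ⦄ ⦄
        δ , 0<δ , HHδ≡ε   = split (H ℚ.* H) ε 0<HH 0<ε
        N , close         = cx δ 0<δ
        u≤H : ∀ n → ℚ.∣ u n ∣ ℚ.≤ H
        u≤H n = reciprocal-bound η H (x n) (u n) 0<η ηH≡1 (η≤x n) (xu≡1 n) (0<u n)
    in N , λ m n l l′ →
      reciprocal-close (x m) (x n) (u m) (u n) {H} {δ} {ε} 0<H HHδ≡ε
        (xu≡1 m) (xu≡1 n) (u≤H m) (u≤H n) (close n m l′ l)

  shift-cauchy : ∀ k x → IsCauchy x → IsCauchy (λ n → x (k ℕ.+ n))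
  shift-cauchy k x cx ε 0<ε with cx ε 0<ε
  ... | N , close = N , λ m n l l′ →
    close (k ℕ.+ m) (k ℕ.+ n) (ℕ.m≤n⇒m≤o+n k l) (ℕ.m≤n⇒m≤o+n k l′)

infix  8 -ᵣ_
infixl 7 _*ᵣ_
infixl 6 _+ᵣ_

_+ᵣ_ _*ᵣ_ : ℝ → ℝ → ℝ
x +ᵣ y = mkℝ (λ n → seq x n ℚ.+ seq y n) (+-cauchy (seq x) (seq y) (cauchy x) (cauchy y))
x *ᵣ y = mkℝ (λ n → seq x n ℚ.* seq y n) (*-cauchy (seq x) (seq y) (cauchy x) (cauchy y))

-ᵣ_ : ℝ → ℝ
-ᵣ x = mkℝ (λ n → ℚ.- seq x n) (neg-cauchy (seq x) (cauchy x))

-- The sequence is shifted past the index from which its terms are known to be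
-- bounded below by a positive rational; this does not change its limit.
recip : (x : ℝ) → 0ᵣ <ᵣ x → ℝ
recip x (η , 0<η , N , 0+η≤x) =
  mkℝ u (recip-cauchy (λ n → seq x (N ℕ.+ n)) (shift-cauchy N (seq x) (cauchy x))
          η 0<η η≤x u xu≡1 0<u)
  where
  η≤x : ∀ n → η ℚ.≤ seq x (N ℕ.+ n)
  η≤x n = subst (ℚ._≤ seq x (N ℕ.+ n)) (ℚ.+-identityˡ η) (0+η≤x (N ℕ.+ n) (ℕ.m≤m+n N n))
  0<x : ∀ n → 0ℚ ℚ.< seq x (N ℕ.+ n)
  0<x n = ℚ.<-≤-trans 0<η (η≤x n)
  u : ℕ → ℚ
  u n = (ℚ.1/ seq x (N ℕ.+ n)) ⦃ ℚ.>-nonZero (0<x n) ⦄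
  xu≡1 : ∀ n → seq x (N ℕ.+ n) ℚ.* u n ≡ 1ℚ
  xu≡1 n = ℚ.*-inverseʳ (seq x (N ℕ.+ n)) ⦃ ℚ.>-nonZero (0<x n) ⦄
  0<u : ∀ n → 0ℚ ℚ.< u n
  0<u n = ℚ.positive⁻¹ (u n) ⦃ ℚ.1/pos⇒pos (seq x (N ℕ.+ n)) ⦃ ℚ.positive (0<x n) ⦄ ⦄

infixl 6 _+i_

record ℂ : Set where
  constructor _+i_
  field
    re im : ℝ

open ℂ public

infix  4 _≈_
infix  8 -_
infixl 7 _*_ _/_[_]
infixl 6 _+_ _-_

_≈_ : ℂ → ℂ → Set
z ≈ w = re z ≈ᵣ re w × im z ≈ᵣ im w

_+_ _*_ : ℂ → ℂ → ℂ
z + w = (re z +ᵣ re w) +i (im z +ᵣ im w)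
z * w = (re z *ᵣ re w +ᵣ -ᵣ (im z *ᵣ im w)) +i (re z *ᵣ im w +ᵣ im z *ᵣ re w)

-_ : ℂ → ℂ
- z = (-ᵣ re z) +i (-ᵣ im z)

_-_ : ℂ → ℂ → ℂ
z - w = z + - w

0# 1# i : ℂ
0# = 0ᵣ +i 0ᵣ
1# = 1ᵣ +i 0ᵣ
i  = 0ᵣ +i 1ᵣ

ℂ-rawRing : RawRing 0ℓ 0ℓ
ℂ-rawRing = record
  { Carrier = ℂ ; _≈_ = _≈_ ; _+_ = _+_ ; _*_ = _*_ ; -_ = -_ ; 0# = 0# ; 1# = 1# }

open RawSemiringDefinitions (RawRing.rawSemiring ℂ-rawRing) public
  using (_^_; sum; product)

∣_∣² : ℂ → ℝ
∣ z ∣² = re z *ᵣ re z +ᵣ im z *ᵣ im z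

-- Absolute values are compared through their squares.
∣_∣<∣_∣ : ℂ → ℂ → Set
∣ z ∣<∣ w ∣ = ∣ z ∣² <ᵣ ∣ w ∣²

NonZero : ℂ → Set
NonZero z = 0ᵣ <ᵣ ∣ z ∣²

larger-nonZero : ∀ {z w} → ∣ z ∣<∣ w ∣ → NonZero w
larger-nonZero {z} {w} (ε , 0<ε , N , z+ε≤w) = ε , 0<ε , N , λ n N≤n →
  ℚ.≤-trans
    (ℚ.+-monoˡ-≤ ε (ℚ.+-mono-≤ (square-nonNeg (seq (re z) n)) (square-nonNeg (seq (im z) n))))
    (z+ε≤w n N≤n)

inv : (z : ℂ) → NonZero z → ℂ
inv z z≉0 = (re z *ᵣ r) +i (-ᵣ im z *ᵣ r)
  where r = recip ∣ z ∣² z≉0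

_/_[_] : ℂ → (w : ℂ) → NonZero w → ℂ
z / w [ w≉0 ] = z * inv w w≉0

infix 4 _⟶_

_⟶_ : (ℕ → ℂ) → ℂ → Set
f ⟶ L = ∀ ε → 0ℚ ℚ.< ε → ∃[ N ] (∀ n → N ℕ.≤ n → ∣ f n - L ∣² <ᵣ fromℚ (ε ℚ.* ε))

-- ∑_{n ≥ 0} f n = s
HasSum : (ℕ → ℂ) → ℂ → Set
HasSum f s = (λ n → sum {n} (f ∘ toℕ)) ⟶ s

-- (a ; q)_n
⟨_﹔_⟩_ : ℂ → ℂ → ℕ → ℂ
⟨ a ﹔ q ⟩ n = product {n} (λ j → 1# - a * q ^ toℕ j)

-- (a ; q)_∞ = p
⟨_﹔_⟩∞≔_ : ℂ → ℂ → ℂ → Set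
⟨ a ﹔ q ⟩∞≔ p = (λ n → ⟨ a ﹔ q ⟩ n) ⟶ p

-- The two sides of the identity. Each predicate says that every infinite
-- product and series in the expression converges, that no denominator
-- vanishes, and that the value of the expression is v.

P̄ω : (ζ : ℂ) → NonZero ζ → (q v : ℂ) → Set
P̄ω ζ ζ≉0 q v =
  Σ[ [q]∞ ∈ ℂ ] Σ[ [ζ]∞ ∈ ℂ ] Σ[ [ζ⁻¹q]∞ ∈ ℂ ] Σ[ [-q]∞ ∈ ℂ ]
  ( ⟨ q ﹔ q ⟩∞≔ [q]∞
  × ⟨ ζ ﹔ q ⟩∞≔ [ζ]∞
  × ⟨ inv ζ ζ≉0 * q ﹔ q ⟩∞≔ [ζ⁻¹q]∞
  × ⟨ - q ﹔ q ^ 2 ⟩∞≔ [-q]∞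
  × Σ[ prefactor≉0 ∈ NonZero ([ζ]∞ * [ζ⁻¹q]∞ * [-q]∞) ]
    Σ[ [q]₂ₙ≉0 ∈ (∀ k → NonZero (⟨ q ﹔ q ⟩ (2 ℕ.* suc k))) ]
    Σ[ series ∈ ℂ ]
    ( HasSum (λ k → let n = suc k in
        (⟨ ζ ﹔ q ⟩ n * ⟨ inv ζ ζ≉0 * q ﹔ q ⟩ n * ⟨ - q ﹔ q ^ 2 ⟩ n)
          / (⟨ q ﹔ q ⟩ (2 ℕ.* n)) [ [q]₂ₙ≉0 k ] * q ^ n) series
    × v ≈ [q]∞ / ([ζ]∞ * [ζ⁻¹q]∞ * [-q]∞) [ prefactor≉0 ] * series))

-- In the double series t is q^{1/2} = e^{πiτ}, where q = e^{2πiτ}, and q^{k/2}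
-- is t ^ k. As τ runs over the upper half-plane, (t , q) runs over all pairs
-- with t² = q and 0 < |q| < 1.

numerator : (ζ : ℂ) → NonZero ζ → (q t : ℂ) → ℕ → ℕ → ℂ
numerator ζ ζ≉0 q t j n =
  (- 1#) ^ (j ℕ.+ 1) * i ^ n * (1# - ζ ^ j) * (1# - (inv ζ ζ≉0 * q) ^ j)
    * t ^ (j ℕ.* (j ℕ.+ 1) ℕ.+ n ℕ.* (2 ℕ.* j ℕ.+ 1))

denominator : ℂ → ℕ → ℕ → ℂ
denominator t j n = 1# + i * t ^ (2 ℕ.* (j ℕ.+ n) ℕ.+ 1)

-- The double series is read as an iterated one: the inner sums over n ≥ 0
-- converge for every j = suc k, and so does the sum of their values over k.
DoubleSeries : (ζ : ℂ) → NonZero ζ → (q t v : ℂ) → Set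
DoubleSeries ζ ζ≉0 q t v =
  Σ[ [q]∞ ∈ ℂ ] Σ[ [ζ]∞ ∈ ℂ ] Σ[ [ζ⁻¹q]∞ ∈ ℂ ]
  ( ⟨ q ﹔ q ⟩∞≔ [q]∞
  × ⟨ ζ ﹔ q ⟩∞≔ [ζ]∞
  × ⟨ inv ζ ζ≉0 * q ﹔ q ⟩∞≔ [ζ⁻¹q]∞
  × Σ[ prefactor≉0 ∈ NonZero ([ζ]∞ * [ζ⁻¹q]∞ * [q]∞) ]
    Σ[ denominator≉0 ∈ (∀ k n → NonZero (denominator t (suc k) n)) ]
    Σ[ inner ∈ (ℕ → ℂ) ] Σ[ series ∈ ℂ ]
    ( (∀ k → HasSum (λ n →
        numerator ζ ζ≉0 q t (suc k) n / denominator t (suc k) n [ denominator≉0 k n ])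
        (inner k))
    × HasSum inner series
    × v ≈ 1# / ([ζ]∞ * [ζ⁻¹q]∞ * [q]∞) [ prefactor≉0 ] * series))

{-# OPTIONS --safe #-}

-- Put η = ζ⁻¹q. For n ≥ 1 the finite triple product, minus its vanishing instance ζ = 1, reads
--   (ζ)ₙ(η)ₙ / (q)₂ₙ = ∑_{1≤j≤n} c_j / ((q)ₙ₋ⱼ(q)ₙ₊ⱼ),  c_j = (-1)^(j+1) q^(j(j-1)/2) (1-ζ^j)(1-η^j).
-- Interchanging the summations leaves, for each j, with a = -i t^(2j+1) and b = i t^(2j+1),
--   (q)∞² / (-q;q²)∞ · ∑_m (-q;q²)ⱼ₊ₘ q^m / ((q)ₘ(q)₂ⱼ₊ₘ) = ∑_n b^n / (1 - a q^n),
-- a case of Heine's transformation. Letting a and b vary independently, the left side R(a,b)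
-- satisfies R(a,b) = 1/(1-a) + b R(aq,b), because the corresponding combination of partial
-- sums telescopes to a product; iterating this equation gives the right side.
-- Every limit involved converges geometrically, with one rational ratio ρ < 1 that bounds
-- |t|, |ζ| and |η|, so all the analysis is a calculus of O(ρⁿ) estimates.
module Submission where

open import Algebra.Bundles using (CommutativeRing; Semiring)
import Algebra.Definitions.RawSemiring
import Algebra.Properties.AbelianGroup
import Algebra.Properties.CommutativeSemiring.Exp
import Algebra.Properties.Ring
import Algebra.Properties.Semiring.Mult.TCOptimised
import Algebra.Solver.Ring
open import Algebra.Solver.Ring.AlmostCommutativeRing
  using (fromCommutativeRing; _-Raw-AlmostCommutative⟶_; Induced-equivalence)
open import Data.Fin.Base using (toℕ)
open import Data.Integer.Base as ℤ using (ℤ; 0ℤ; +_; -[1+_])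
import Data.Integer.Properties as ℤ
open import Data.Integer.Solver using () renaming (module +-*-Solver to ℤ-Solver)
open import Data.Maybe.Base using (just; nothing)
open import Data.Nat.Base as ℕ using (ℕ; zero; suc)
import Data.Nat.Properties as ℕ
open import Data.Nat.Solver using () renaming (module +-*-Solver to ℕ-Solver)
open import Data.Product.Base using (_,_; _×_; ∃-syntax; Σ-syntax; proj₁; proj₂)
open import Data.Rational.Base as ℚ using (ℚ; 0ℚ; 1ℚ; ½)
import Data.Rational.Properties as ℚ
open import Data.Rational.Solver using () renaming (module +-*-Solver to ℚ-Solver)
import Data.Rational.Unnormalised.Base as ℚᵘ
import Data.Rational.Unnormalised.Properties as ℚᵘ
open import Data.Sum.Base using (inj₁; inj₂)
open import Function.Base using (_∘_; _$_)
open import Level using (0ℓ)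
import Relation.Binary.Reasoning.Setoid
open import Relation.Binary.Definitions using (WeaklyDecidable)
open import Relation.Binary.PropositionalEquality as ≡ using (_≡_)
open import Relation.Nullary using (yes; no; contradiction)

-- The series for a given j lies on the line a = -b, but the step from a to aq leaves that line;
-- this forces the two-parameter family. Only the orbits a_α = -i t^(2α+1) and b_β = i t^(2β+1) are
-- visited, and there a_α b_β = q^(α+β+1), so the denominator (ab;q) of the Heine series reduces to
-- q-factorials. The factors to be inverted are then all of the form 1 - u with |u| ≤ ρ, and
-- geometric series invert them; an infinite product is inverted by the convergent product of these
-- inverses. Non-vanishing is thus always proved by exhibiting an inverse. The interchange of
-- summations has to keep the rate ρⁿ although an antidiagonal has n + 1 terms. It does so because ρ
-- bounds |t|, so that |q| ≤ ρ²: the factor q^j contributes ρ^(2j), one half of which completes the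
-- rate while the other half pays for the summation over j.

-- Inequalities between rationals and decay of powers.

module RationalEstimates where

  open import Data.Rational.Base using (_≤_; _<_; _+_; _*_; -_; _-_)
  open import Algebra.Properties.CommutativeSemiring.Exp
    (CommutativeRing.commutativeSemiring ℚ.+-*-commutativeRing) public
    using () renaming (_^_ to _^ℚ_; ^-homo-* to ^ℚ-homo-*)
  open import Algebra.Definitions.RawSemiring ℚ.+-*-rawSemiring using () renaming (_×_ to _·_)
  open import Relation.Binary.PropositionalEquality
  open import Defs using (square-nonNeg; split)

  0≤1 : 0ℚ ≤ 1ℚ
  0≤1 = ℚ.nonNegative⁻¹ 1ℚ

  ≤-by : ∀ {p q} r → 0ℚ ≤ r → p + r ≡ q → p ≤ q
  ≤-by {p} {q} r 0≤r eq = subst₂ _≤_ (ℚ.+-identityʳ p) eq (ℚ.+-monoʳ-≤ p 0≤r)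

  0≤+ : ∀ {p q} → 0ℚ ≤ p → 0ℚ ≤ q → 0ℚ ≤ p + q
  0≤+ 0≤p 0≤q = ℚ.+-mono-≤ 0≤p 0≤q

  0≤* : ∀ {p q} → 0ℚ ≤ p → 0ℚ ≤ q → 0ℚ ≤ p * q
  0≤* {p} {q} 0≤p 0≤q = ℚ.nonNegative⁻¹ (p * q)
    ⦃ ℚ.nonNeg*nonNeg⇒nonNeg p ⦃ ℚ.nonNegative 0≤p ⦄ q ⦃ ℚ.nonNegative 0≤q ⦄ ⦄

  0<* : ∀ {p q} → 0ℚ < p → 0ℚ < q → 0ℚ < p * q
  0<* {p} {q} 0<p 0<q = ℚ.positive⁻¹ (p * q)
    ⦃ ℚ.pos*pos⇒pos p ⦃ ℚ.positive 0<p ⦄ q ⦃ ℚ.positive 0<q ⦄ ⦄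

  ≤⇒0≤- : ∀ {p q} → p ≤ q → 0ℚ ≤ q - p
  ≤⇒0≤- {p} {q} p≤q = subst (_≤ q - p) (ℚ.+-inverseʳ p) (ℚ.+-monoˡ-≤ (- p) p≤q)

  <⇒0<- : ∀ {p q} → p < q → 0ℚ < q - p
  <⇒0<- {p} {q} p<q = subst (_< q - p) (ℚ.+-inverseʳ p) (ℚ.+-monoˡ-< (- p) p<q)

  *-mono-≤ : ∀ {p q r s} → 0ℚ ≤ r → p ≤ q → r ≤ s → 0ℚ ≤ q → p * r ≤ q * s
  *-mono-≤ {p} {q} {r} {s} 0≤r p≤q r≤s 0≤q = ℚ.≤-trans
    (ℚ.*-monoʳ-≤-nonNeg r ⦃ ℚ.nonNegative 0≤r ⦄ p≤q)
    (ℚ.*-monoˡ-≤-nonNeg q ⦃ ℚ.nonNegative 0≤q ⦄ r≤s)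

  *-monoʳ : ∀ {p q} r → 0ℚ ≤ r → p ≤ q → r * p ≤ r * q
  *-monoʳ r 0≤r = ℚ.*-monoˡ-≤-nonNeg r ⦃ ℚ.nonNegative 0≤r ⦄

  square-mono : ∀ {p q} → 0ℚ ≤ p → p ≤ q → p * p ≤ q * q
  square-mono 0≤p p≤q = *-mono-≤ 0≤p p≤q p≤q (ℚ.≤-trans 0≤p p≤q)

  square-cancel : ∀ {p q} → 0ℚ ≤ q → p * p ≤ q * q → p ≤ q
  square-cancel {p} {q} 0≤q pp≤qq with p ℚ.≤? q
  ... | yes p≤q = p≤q
  ... | no p≰q = contradiction
    (ℚ.<-≤-trans
      (ℚ.≤-<-trans (*-monoʳ q 0≤q (ℚ.<⇒≤ q<p)) (ℚ.*-monoˡ-<-pos p ⦃ ℚ.positive (ℚ.≤-<-trans 0≤q q<p) ⦄ q<p))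
      pp≤qq)
    (ℚ.<-irrefl refl)
    where q<p = ℚ.≰⇒> p≰q

  0<½* : ∀ {ε} → 0ℚ < ε → 0ℚ < ½ * ε
  0<½* = 0<* (ℚ.positive⁻¹ ½)

  ^ℚ-nonNeg : ∀ {r} → 0ℚ ≤ r → ∀ n → 0ℚ ≤ r ^ℚ n
  ^ℚ-nonNeg 0≤r zero    = 0≤1
  ^ℚ-nonNeg 0≤r (suc n) = 0≤* 0≤r (^ℚ-nonNeg 0≤r n)

  ^ℚ-pos : ∀ {r} → 0ℚ < r → ∀ n → 0ℚ < r ^ℚ n
  ^ℚ-pos 0<r zero    = ℚ.positive⁻¹ 1ℚ
  ^ℚ-pos 0<r (suc n) = 0<* 0<r (^ℚ-pos 0<r n)

  ^ℚ-≤1 : ∀ {r} → 0ℚ ≤ r → r ≤ 1ℚ → ∀ n → r ^ℚ n ≤ 1ℚ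
  ^ℚ-≤1 0≤r r≤1 zero    = ℚ.≤-refl
  ^ℚ-≤1 0≤r r≤1 (suc n) = *-mono-≤ (^ℚ-nonNeg 0≤r n) r≤1 (^ℚ-≤1 0≤r r≤1 n) 0≤1

  ^ℚ-antitone : ∀ {r} → 0ℚ ≤ r → r ≤ 1ℚ → ∀ {m n} → m ℕ.≤ n → r ^ℚ n ≤ r ^ℚ m
  ^ℚ-antitone 0≤r r≤1 {n = n} ℕ.z≤n = ^ℚ-≤1 0≤r r≤1 n
  ^ℚ-antitone 0≤r r≤1 (ℕ.s≤s m≤n) = *-monoʳ _ 0≤r (^ℚ-antitone 0≤r r≤1 m≤n)

  ·-nonNeg : ∀ n {p} → 0ℚ ≤ p → 0ℚ ≤ n · p
  ·-nonNeg zero    0≤p = ℚ.≤-refl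
  ·-nonNeg (suc n) 0≤p = 0≤+ 0≤p (·-nonNeg n 0≤p)

  ·-*-assoc : ∀ n p q → (n · p) * q ≡ n · (p * q)
  ·-*-assoc zero    p q = ℚ.*-zeroˡ q
  ·-*-assoc (suc n) p q = trans (ℚ.*-distribʳ-+ q p (n · p)) (cong (λ x → p * q + x) (·-*-assoc n p q))

  -- Multiples are computed among unnormalised rationals, where the denominator of `p` stays fixed
  -- and no gcd enters.
  toℚᵘ-· : ∀ n p → ℚ.toℚᵘ (n · p) ℚᵘ.≃ ℚᵘ.mkℚᵘ (+ n ℤ.* ℚ.↥ p) (ℚ.ℚ.denominator-1 p)
  toℚᵘ-· zero    p@record{} = ℚᵘ.*≡* refl
  toℚᵘ-· (suc n) p@record{} =
    ℚᵘ.≃-trans (ℚ.toℚᵘ-homo-+ p (n · p))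
      (ℚᵘ.≃-trans (ℚᵘ.+-congʳ (ℚ.toℚᵘ p) (toℚᵘ-· n p))
        (ℚᵘ.*≡* (ℤS.solve 3 (λ n a d → (a ℤS.:* d ℤS.:+ (n ℤS.:* a) ℤS.:* d) ℤS.:* d
                                        ℤS.:= ((ℤS.con (+ 1) ℤS.:+ n) ℤS.:* a) ℤS.:* (d ℤS.:* d))
                  refl (+ n) (ℚ.↥ p) (ℚ.↧ p))))
    where module ℤS = ℤ-Solver

  archimedean : ∀ p → 0ℚ < p → ∃[ n ] 1ℚ ≤ n · p
  archimedean p@(ℚ.mkℚ (+ zero) _ _)    0<p = contradiction (ℚ.positive 0<p) λ ()
  archimedean p@(ℚ.mkℚ (-[1+ _ ]) _ _)  0<p = contradiction (ℚ.positive 0<p) λ ()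
  -- The denominator is a sufficient multiple: d times (a + 1)/d is a + 1, which is at least 1.
  archimedean p@(ℚ.mkℚ (+ suc a) d-1 _) 0<p = d , ℚ.toℚᵘ-cancel-≤
    (ℚᵘ.≤-respʳ-≃ (ℚᵘ.≃-sym (toℚᵘ-· d p))
      (ℚᵘ.*≤* (ℤ.+≤+ (subst₂ ℕ._≤_ (sym (ℕ.*-identityˡ d)) (sym (ℕ.*-identityʳ _)) (ℕ.m≤m*n d (suc a))))))
    where d = suc d-1

  module Powers {r : ℚ} (0<r : 0ℚ < r) (r<1 : r < 1ℚ) where

    0≤r = ℚ.<⇒≤ 0<r
    r≤1 = ℚ.<⇒≤ r<1
    open ℚ-Solver

    -- Bernoulli's inequality for 1/r, multiplied out to avoid the reciprocal. In the induction step
    -- the slack is exactly rⁿ(1 - r)((1 - r) + n(1 - r)).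
    bernoulli : ∀ n → r ^ℚ n * (1ℚ + n · (1ℚ - r)) ≤ 1ℚ
    bernoulli zero    = ℚ.≤-refl
    bernoulli (suc n) = ℚ.≤-trans
      (≤-by (r ^ℚ n * ((1ℚ - r) * ((1ℚ - r) + x))) (0≤* (^ℚ-nonNeg 0≤r n) (0≤* 0≤1-r (0≤+ 0≤1-r (·-nonNeg n 0≤1-r))))
        (solve 3 (λ r p x → (r :* p) :* (con 1ℚ :+ ((con 1ℚ :- r) :+ x)) :+ p :* ((con 1ℚ :- r) :* ((con 1ℚ :- r) :+ x))
                            := p :* (con 1ℚ :+ x)) refl r (r ^ℚ n) x))
      (bernoulli n)
      where
      x = n · (1ℚ - r)
      0≤1-r = ≤⇒0≤- r≤1

    -- Once N(1 - r)ε ≥ 1, `bernoulli` gives r^N ≤ r^N · N(1 - r) · ε ≤ ε.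
    powers-vanish : ∀ ε → 0ℚ < ε → ∃[ N ] ∀ n → N ℕ.≤ n → r ^ℚ n ≤ ε
    powers-vanish ε 0<ε =
      let N , 1≤N·δ = archimedean δ (0<* 0<1-r 0<ε)
      in N , λ n N≤n → ℚ.≤-trans (^ℚ-antitone 0≤r r≤1 N≤n) (bound N 1≤N·δ)
      where
      0<1-r = <⇒0<- r<1
      δ = (1ℚ - r) * ε
      bound : ∀ N → 1ℚ ≤ N · δ → r ^ℚ N ≤ ε
      bound N 1≤N·δ = begin
        p                                ≡⟨ ℚ.*-identityʳ p ⟨
        p * 1ℚ                           ≤⟨ *-monoʳ p 0≤p 1≤N·δ ⟩
        p * (N · δ)                      ≡⟨ cong (p *_) (·-*-assoc N (1ℚ - r) ε) ⟨
        p * (x * ε)                      ≤⟨ ≤-by (p * ε) (0≤* 0≤p 0≤ε)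
                                              (solve 3 (λ p x e → p :* (x :* e) :+ p :* e := (p :* (con 1ℚ :+ x)) :* e) refl p x ε) ⟩
        (p * (1ℚ + x)) * ε               ≤⟨ *-mono-≤ 0≤ε (bernoulli N) ℚ.≤-refl 0≤1 ⟩
        1ℚ * ε                           ≡⟨ ℚ.*-identityˡ ε ⟩
        ε                                ∎
        where
        open ℚ.≤-Reasoning
        p = r ^ℚ N
        x = N · (1ℚ - r)
        0≤p = ^ℚ-nonNeg 0≤r N
        0≤ε = ℚ.<⇒≤ 0<ε

  0<⊓ : ∀ {p q} → 0ℚ < p → 0ℚ < q → 0ℚ < p ℚ.⊓ q
  0<⊓ {p} {q} 0<p 0<q with ℚ.⊓-sel p q
  ... | inj₁ eq = subst (0ℚ <_) (sym eq) 0<p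
  ... | inj₂ eq = subst (0ℚ <_) (sym eq) 0<q

-- Discs in the rational plane.

module RationalDiscs where

  open import Data.Rational.Base using (_≤_; _<_; _+_; _*_; -_; _-_)
  open import Relation.Binary.PropositionalEquality
  open import Defs using (square-nonNeg)
  open RationalEstimates
  open ℚ-Solver

  infix 4 ⟪_,_⟫∈_
  -- The inequality |a + bi| ≤ B without square roots. The sign of `B` is recorded because comparing
  -- squares is meaningful only for non-negative radii.
  record ⟪_,_⟫∈_ (a b B : ℚ) : Set where
    constructor disc
    field
      disc-radius≥0 : 0ℚ ≤ B
      disc-within   : a * a + b * b ≤ B * B

  disc-≡ : ∀ {a b c d B} → a ≡ c → b ≡ d → ⟪ a , b ⟫∈ B → ⟪ c , d ⟫∈ B
  disc-≡ refl refl z = z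

  disc-radius : ∀ {a b B C} → B ≡ C → ⟪ a , b ⟫∈ B → ⟪ a , b ⟫∈ C
  disc-radius refl z = z

  disc-weaken : ∀ {a b B C} → B ≤ C → ⟪ a , b ⟫∈ B → ⟪ a , b ⟫∈ C
  disc-weaken B≤C (disc 0≤B z) = disc (ℚ.≤-trans 0≤B B≤C) $ ℚ.≤-trans z (square-mono 0≤B B≤C)

  disc-neg : ∀ {a b B} → ⟪ a , b ⟫∈ B → ⟪ - a , - b ⟫∈ B
  disc-neg {a} {b} {B} (disc 0≤B z) = disc (0≤B) $
    subst (_≤ B * B) (solve 2 (λ a b → a :* a :+ b :* b := :- a :* :- a :+ :- b :* :- b) refl a b) z

  -- Multiplicativity of the norm, by the two-square identity of Brahmagupta and Fibonacci.
  disc-* : ∀ {a b c d B C} → ⟪ a , b ⟫∈ B → ⟪ c , d ⟫∈ C → ⟪ a * c + - (b * d) , a * d + b * c ⟫∈ (B * C)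
  disc-* {a} {b} {c} {d} {B} {C} (disc 0≤B z) (disc 0≤C w) = disc (0≤* 0≤B 0≤C) $
    subst₂ _≤_
      (solve 4 (λ a b c d → (a :* a :+ b :* b) :* (c :* c :+ d :* d)
         := (a :* c :+ :- (b :* d)) :* (a :* c :+ :- (b :* d)) :+ (a :* d :+ b :* c) :* (a :* d :+ b :* c)) refl a b c d)
      (solve 2 (λ B C → (B :* B) :* (C :* C) := (B :* C) :* (B :* C)) refl B C)
      (*-mono-≤ (0≤+ (square-nonNeg c) (square-nonNeg d)) z w (square-nonNeg B))

  -- By Lagrange's identity the slack is (ad - bc)².
  cauchy-schwarz : ∀ {a b c d B C} → ⟪ a , b ⟫∈ B → ⟪ c , d ⟫∈ C → a * c + b * d ≤ B * C
  cauchy-schwarz {a} {b} {c} {d} {B} {C} (disc 0≤B z) (disc 0≤C w) = square-cancel (0≤* 0≤B 0≤C)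
    (ℚ.≤-trans
      (≤-by ((a * d - b * c) * (a * d - b * c)) (square-nonNeg (a * d - b * c))
        (solve 4 (λ a b c d → (a :* c :+ b :* d) :* (a :* c :+ b :* d) :+ (a :* d :- b :* c) :* (a :* d :- b :* c)
           := (a :* a :+ b :* b) :* (c :* c :+ d :* d)) refl a b c d))
      (subst ((a * a + b * b) * (c * c + d * d) ≤_)
        (solve 2 (λ B C → (B :* B) :* (C :* C) := (B :* C) :* (B :* C)) refl B C)
        (*-mono-≤ (0≤+ (square-nonNeg c) (square-nonNeg d)) z w (square-nonNeg B))))

  disc-+ : ∀ {a b c d B C} → ⟪ a , b ⟫∈ B → ⟪ c , d ⟫∈ C → ⟪ a + c , b + d ⟫∈ (B + C)
  disc-+ {a} {b} {c} {d} {B} {C} z@(disc 0≤B z≤) w@(disc 0≤C w≤) = disc (0≤+ 0≤B 0≤C) $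
    subst₂ _≤_
      (solve 4 (λ a b c d → (a :* a :+ b :* b) :+ ((c :* c :+ d :* d) :+ ((a :* c :+ b :* d) :+ (a :* c :+ b :* d)))
         := (a :+ c) :* (a :+ c) :+ (b :+ d) :* (b :+ d)) refl a b c d)
      (solve 2 (λ B C → B :* B :+ (C :* C :+ (B :* C :+ B :* C)) := (B :+ C) :* (B :+ C)) refl B C)
      (ℚ.+-mono-≤ z≤ (ℚ.+-mono-≤ w≤ (ℚ.+-mono-≤ z·w≤ z·w≤)))
    where z·w≤ = cauchy-schwarz {a} {b} {c} {d} z w

  disc-abs₁ : ∀ {a b B} → ⟪ a , b ⟫∈ B → ℚ.∣ a ∣ ≤ B
  disc-abs₁ {a} {b} {B} (disc 0≤B z) = square-cancel 0≤B
    (subst (_≤ B * B) (trans (sym (ℚ.0≤p⇒∣p∣≡p (square-nonNeg a))) (ℚ.∣p*q∣≡∣p∣*∣q∣ a a))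
      (ℚ.≤-trans (≤-by (b * b) (square-nonNeg b) refl) z))

  disc-swap : ∀ {a b B} → ⟪ a , b ⟫∈ B → ⟪ b , a ⟫∈ B
  disc-swap {a} {b} {B} (disc 0≤B z) = disc (0≤B) $ subst (_≤ B * B) (ℚ.+-comm (a * a) (b * b)) z

  abs-square : ∀ a → ℚ.∣ a ∣ * ℚ.∣ a ∣ ≡ a * a
  abs-square a = trans (sym (ℚ.∣p*q∣≡∣p∣*∣q∣ a a)) (ℚ.0≤p⇒∣p∣≡p (square-nonNeg a))

  disc-abs : ∀ {a b B C} → ℚ.∣ a ∣ ≤ B → ℚ.∣ b ∣ ≤ C → ⟪ a , b ⟫∈ (B + C)
  disc-abs {a} {b} {B} {C} a≤B b≤C = disc (0≤+ 0≤B 0≤C) $ ℚ.≤-trans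
    (subst₂ (λ x y → x + y ≤ B * B + C * C) (abs-square a) (abs-square b)
      (ℚ.+-mono-≤ (square-mono (ℚ.0≤∣p∣ a) a≤B) (square-mono (ℚ.0≤∣p∣ b) b≤C)))
    (≤-by (B * C + B * C) (0≤+ 0≤BC 0≤BC)
      (solve 2 (λ B C → B :* B :+ C :* C :+ (B :* C :+ B :* C) := (B :+ C) :* (B :+ C)) refl B C))
    where
    0≤B = ℚ.≤-trans (ℚ.0≤∣p∣ a) a≤B
    0≤C = ℚ.≤-trans (ℚ.0≤∣p∣ b) b≤C
    0≤BC = 0≤* 0≤B 0≤C

open RationalEstimates using (_^ℚ_)

-- The norm is given only through its rational upper bounds, so no real numbers
-- are needed to state the estimates. Completeness is required for geometrically
-- convergent sequences only.
record CompleteNormedRing : Set₁ where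
  field
    commutativeRing : CommutativeRing 0ℓ 0ℓ
  open CommutativeRing commutativeRing public
  infix 4 ∣_∣≤_
  field
    ∣_∣≤_ : Carrier → ℚ → Set
    norm-radius≥0 : ∀ {z B} → ∣ z ∣≤ B → 0ℚ ℚ.≤ B
    norm-cong : ∀ {z w B} → z ≈ w → ∣ z ∣≤ B → ∣ w ∣≤ B
    norm-weaken : ∀ {z B C} → B ℚ.≤ C → ∣ z ∣≤ B → ∣ z ∣≤ C
    norm-+ : ∀ {z w B C} → ∣ z ∣≤ B → ∣ w ∣≤ C → ∣ z + w ∣≤ B ℚ.+ C
    norm-* : ∀ {z w B C} → ∣ z ∣≤ B → ∣ w ∣≤ C → ∣ z * w ∣≤ B ℚ.* C
    norm-neg : ∀ {z B} → ∣ z ∣≤ B → ∣ - z ∣≤ B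
    norm-0 : ∣ 0# ∣≤ 0ℚ
    norm-1 : ∣ 1# ∣≤ 1ℚ
    norm-finite : ∀ z → ∃[ B ] ∣ z ∣≤ B
    norm-separated : ∀ {z} → (∀ ε → 0ℚ ℚ.< ε → ∣ z ∣≤ ε) → z ≈ 0#
    complete : ∀ {r} → 0ℚ ℚ.< r → r ℚ.< 1ℚ → ∀ D (f : ℕ → Carrier) →
      (∀ n k → ∣ f (n ℕ.+ k) + - f n ∣≤ D ℚ.* r ^ℚ n) →
      ∃[ L ] (∀ n → ∣ L + - f n ∣≤ D ℚ.* r ^ℚ n)

-- A ring solver with integer coefficients.

module IntegerCoefficients (R : CommutativeRing 0ℓ 0ℓ) where

  open CommutativeRing R
  open Algebra.Properties.Ring ring
  open Algebra.Properties.AbelianGroup +-abelianGroup using (⁻¹-∙-comm)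
  open Algebra.Properties.Semiring.Mult.TCOptimised semiring renaming (_×_ to _·_)
  open Relation.Binary.Reasoning.Setoid setoid

  ⟦_⟧ℤ : ℤ → Carrier
  ⟦ + n ⟧ℤ      = n · 1#
  ⟦ -[1+ n ] ⟧ℤ = - (suc n · 1#)

  neg-homo : ∀ x → ⟦ ℤ.- x ⟧ℤ ≈ - ⟦ x ⟧ℤ
  neg-homo (+ zero)   = sym -0#≈0#
  neg-homo (+ suc n)  = refl
  neg-homo (-[1+ n ]) = sym (-‿involutive _)

  ⊖-homo : ∀ m n → ⟦ m ℤ.⊖ n ⟧ℤ ≈ m · 1# + - (n · 1#)
  ⊖-homo zero zero       = sym (trans (+-identityˡ _) -0#≈0#)
  ⊖-homo zero (suc n)    = sym (+-identityˡ _)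
  ⊖-homo (suc m) zero    = sym (trans (+-congˡ -0#≈0#) (+-identityʳ _))
  ⊖-homo (suc m) (suc n) = begin
    ⟦ suc m ℤ.⊖ suc n ⟧ℤ                      ≡⟨ ≡.cong ⟦_⟧ℤ (ℤ.[1+m]⊖[1+n]≡m⊖n m n) ⟩
    ⟦ m ℤ.⊖ n ⟧ℤ                              ≈⟨ ⊖-homo m n ⟩
    m · 1# + - (n · 1#)                       ≈⟨ +-identityˡ _ ⟨
    0# + (m · 1# + - (n · 1#))                ≈⟨ +-congʳ (-‿inverseʳ 1#) ⟨
    (1# + - 1#) + (m · 1# + - (n · 1#))       ≈⟨ +-assoc _ _ _ ⟩
    1# + (- 1# + (m · 1# + - (n · 1#)))       ≈⟨ +-congˡ (+-assoc _ _ _) ⟨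
    1# + (- 1# + m · 1# + - (n · 1#))         ≈⟨ +-congˡ (+-congʳ (+-comm _ _)) ⟩
    1# + (m · 1# + - 1# + - (n · 1#))         ≈⟨ +-congˡ (+-assoc _ _ _) ⟩
    1# + (m · 1# + (- 1# + - (n · 1#)))       ≈⟨ +-assoc _ _ _ ⟨
    (1# + m · 1#) + (- 1# + - (n · 1#))       ≈⟨ +-congˡ (⁻¹-∙-comm _ _) ⟩
    (1# + m · 1#) + - (1# + n · 1#)           ≈⟨ +-cong (sym (1+× m 1#)) (-‿cong (sym (1+× n 1#))) ⟩
    suc m · 1# + - (suc n · 1#)               ∎

  +-homo : ∀ x y → ⟦ x ℤ.+ y ⟧ℤ ≈ ⟦ x ⟧ℤ + ⟦ y ⟧ℤ
  +-homo (+ m)    (+ n)    = ×-homo-+ 1# m n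
  +-homo (+ m)    -[1+ n ] = ⊖-homo m (suc n)
  +-homo -[1+ m ] (+ n)    = trans (⊖-homo n (suc m)) (+-comm _ _)
  +-homo -[1+ m ] -[1+ n ] = begin
    - (suc (suc (m ℕ.+ n)) · 1#)           ≡⟨ ≡.cong (λ k → - (k · 1#)) (≡.cong suc (ℕ.+-suc m n)) ⟨
    - ((suc m ℕ.+ suc n) · 1#)             ≈⟨ -‿cong (×-homo-+ 1# (suc m) (suc n)) ⟩
    - (suc m · 1# + suc n · 1#)            ≈⟨ ⁻¹-∙-comm _ _ ⟨
    - (suc m · 1#) + - (suc n · 1#)        ∎

  *-homo-+ : ∀ m n → ⟦ + m ℤ.* + n ⟧ℤ ≈ ⟦ + m ⟧ℤ * ⟦ + n ⟧ℤ
  *-homo-+ m n = begin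
    ⟦ + m ℤ.* + n ⟧ℤ      ≡⟨ ≡.cong ⟦_⟧ℤ (ℤ.pos-* m n) ⟨
    (m ℕ.* n) · 1#        ≈⟨ ×1-homo-* m n ⟩
    m · 1# * n · 1#       ∎

  *-homo : ∀ x y → ⟦ x ℤ.* y ⟧ℤ ≈ ⟦ x ⟧ℤ * ⟦ y ⟧ℤ
  *-homo (+ m) (+ n)       = *-homo-+ m n
  *-homo (+ m) -[1+ n ]    = begin
    ⟦ + m ℤ.* -[1+ n ] ⟧ℤ            ≡⟨ ≡.cong ⟦_⟧ℤ (ℤ.neg-distribʳ-* (+ m) (+ suc n)) ⟨
    ⟦ ℤ.- (+ m ℤ.* + suc n) ⟧ℤ       ≈⟨ neg-homo (+ m ℤ.* + suc n) ⟩
    - ⟦ + m ℤ.* + suc n ⟧ℤ           ≈⟨ -‿cong (*-homo-+ m (suc n)) ⟩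
    - (m · 1# * suc n · 1#)          ≈⟨ -‿distribʳ-* _ _ ⟩
    m · 1# * - (suc n · 1#)          ∎
  *-homo -[1+ m ] y        = begin
    ⟦ -[1+ m ] ℤ.* y ⟧ℤ              ≡⟨ ≡.cong ⟦_⟧ℤ (ℤ.neg-distribˡ-* (+ suc m) y) ⟨
    ⟦ ℤ.- (+ suc m ℤ.* y) ⟧ℤ         ≈⟨ neg-homo (+ suc m ℤ.* y) ⟩
    - ⟦ + suc m ℤ.* y ⟧ℤ             ≈⟨ -‿cong (pos y) ⟩
    - (suc m · 1# * ⟦ y ⟧ℤ)          ≈⟨ -‿distribˡ-* _ _ ⟩
    - (suc m · 1#) * ⟦ y ⟧ℤ          ∎
    where
    pos : ∀ y → ⟦ + suc m ℤ.* y ⟧ℤ ≈ suc m · 1# * ⟦ y ⟧ℤ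
    pos (+ n)    = *-homo-+ (suc m) n
    pos -[1+ n ] = *-homo (+ suc m) -[1+ n ]

  morphism : ℤ.+-*-rawRing -Raw-AlmostCommutative⟶ fromCommutativeRing R
  morphism = record
    { ⟦_⟧ = ⟦_⟧ℤ ; +-homo = +-homo ; *-homo = *-homo ; -‿homo = neg-homo ; 0-homo = refl ; 1-homo = refl }

  -- Coefficients of normal forms are compared in ℤ, since equality in `R` itself need not be
  -- decidable.
  _≟ℤ_ : WeaklyDecidable (Induced-equivalence morphism)
  x ≟ℤ y with x ℤ.≟ y
  ... | yes x≡y = just (reflexive (≡.cong ⟦_⟧ℤ x≡y))
  ... | no _    = nothing

  open Algebra.Solver.Ring ℤ.+-*-rawRing (fromCommutativeRing R) morphism _≟ℤ_ public
    using (Polynomial; solve; _:=_; _:+_; _:*_; _:-_; :-_; con)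

  :1 : ∀ {n} → Polynomial n
  :1 = con (+ 1)

-- Estimates O(ρⁿ), limits, series and infinite products.

module Analysis (A : CompleteNormedRing) {ρ : ℚ} (0<ρ : 0ℚ ℚ.< ρ) (ρ<1 : ρ ℚ.< 1ℚ) where

  open CompleteNormedRing A hiding (zero)
  open IntegerCoefficients commutativeRing
  open Relation.Binary.Reasoning.Setoid setoid
  open Algebra.Properties.CommutativeSemiring.Exp commutativeSemiring
  open RationalEstimates
  open import Defs using (split)
  module ℚS = ℚ-Solver

  open Powers 0<ρ ρ<1 using (powers-vanish) renaming (0≤r to 0≤ρ; r≤1 to ρ≤1)

  abstract
    geometric-constant : ∃[ K ] (0ℚ ℚ.< K × (1ℚ ℚ.- ρ) ℚ.* K ≡ 1ℚ)
    geometric-constant = split (1ℚ ℚ.- ρ) 1ℚ (<⇒0<- ρ<1) (ℚ.positive⁻¹ 1ℚ)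

  -- The sum 1/(1 - ρ) of the geometric series, known only through the equation (1 - ρ)K = 1.
  K : ℚ
  K = proj₁ geometric-constant

  0≤K : 0ℚ ℚ.≤ K
  0≤K = ℚ.<⇒≤ (proj₁ (proj₂ geometric-constant))

  rescale : ∀ C → K ℚ.* C ℚ.* (1ℚ ℚ.- ρ) ≡ C
  rescale C = ≡.trans (ℚS.solve 3 (λ k c r → k ℚS.:* c ℚS.:* r ℚS.:= c ℚS.:* (r ℚS.:* k)) ≡.refl K C (1ℚ ℚ.- ρ))
    (≡.trans (≡.cong (C ℚ.*_) (proj₂ (proj₂ geometric-constant))) (ℚ.*-identityʳ C))

  norm-≡ : ∀ {z B C} → B ≡ C → ∣ z ∣≤ B → ∣ z ∣≤ C
  norm-≡ ≡.refl b = b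

  -- One constant serves the whole family indexed by `X`. This uniformity in the parameters is what
  -- later permits exchanging sums and bounding remainders.
  record O {X : Set} (f : X → Carrier) (e : X → ℕ) : Set where
    constructor big-O
    field
      constant   : ℚ
      constant≥0 : 0ℚ ℚ.≤ constant
      bound      : ∀ x → ∣ f x ∣≤ constant ℚ.* ρ ^ℚ e x

  module _ {X : Set} where

    O-cong : ∀ {f g : X → Carrier} {e} → (∀ x → f x ≈ g x) → O f e → O g e
    O-cong f≈g (big-O C 0≤C b) = big-O C 0≤C λ x → norm-cong (f≈g x) (b x)

    O-weaken : ∀ {f : X → Carrier} {d e} → (∀ x → d x ℕ.≤ e x) → O f e → O f d
    O-weaken d≤e (big-O C 0≤C b) = big-O C 0≤C λ x →
      norm-weaken (*-monoʳ C 0≤C (^ℚ-antitone 0≤ρ ρ≤1 (d≤e x))) (b x)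

    O-+ : ∀ {f g : X → Carrier} {e} → O f e → O g e → O (λ x → f x + g x) e
    O-+ {e = e} (big-O C 0≤C b) (big-O D 0≤D c) = big-O (C ℚ.+ D) (0≤+ 0≤C 0≤D) λ x →
      norm-≡ (≡.sym (ℚ.*-distribʳ-+ (ρ ^ℚ e x) C D)) (norm-+ (b x) (c x))

    O-neg : ∀ {f : X → Carrier} {e} → O f e → O (λ x → - f x) e
    O-neg (big-O C 0≤C b) = big-O C 0≤C λ x → norm-neg (b x)

    O-* : ∀ {f g : X → Carrier} {d e} → O f d → O g e → O (λ x → f x * g x) (λ x → d x ℕ.+ e x)
    O-* {d = d} {e} (big-O C 0≤C b) (big-O D 0≤D c) = big-O (C ℚ.* D) (0≤* 0≤C 0≤D) λ x →
      norm-≡ (≡.trans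
        (ℚS.solve 4 (λ C D x y → (C ℚS.:* x) ℚS.:* (D ℚS.:* y) ℚS.:= (C ℚS.:* D) ℚS.:* (x ℚS.:* y)) ≡.refl
          C D (ρ ^ℚ d x) (ρ ^ℚ e x))
        (≡.cong (C ℚ.* D ℚ.*_) (≡.sym (^ℚ-homo-* ρ (d x) (e x))))) (norm-* (b x) (c x))

    O-const : ∀ c → O {X} (λ _ → c) (λ _ → 0)
    O-const c = let B , c≤B = norm-finite c in
      big-O B (norm-radius≥0 c≤B) λ _ → norm-≡ (≡.sym (ℚ.*-identityʳ B)) c≤B

    O-unit : ∀ {f : X → Carrier} {e} → (∀ x → ∣ f x ∣≤ ρ ^ℚ e x) → O f e
    O-unit b = big-O 1ℚ 0≤1 λ x → norm-≡ (≡.sym (ℚ.*-identityˡ _)) (b x)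

    O-subst : ∀ {Y : Set} (h : Y → X) {f : X → Carrier} {e} → O f e → O (f ∘ h) (e ∘ h)
    O-subst h (big-O C 0≤C b) = big-O C 0≤C (b ∘ h)

  -- The step bound D(1 - ρ)ρⁿ is Dρⁿ - Dρⁿ⁺¹, so the bounds themselves telescope and no geometric
  -- sum has to be evaluated.
  telescope : ∀ (f : ℕ → Carrier) D → (∀ n → ∣ f (suc n) + - f n ∣≤ D ℚ.* (1ℚ ℚ.- ρ) ℚ.* ρ ^ℚ n) →
    ∀ n k → ∣ f (k ℕ.+ n) + - f n ∣≤ D ℚ.* (ρ ^ℚ n ℚ.- ρ ^ℚ (k ℕ.+ n))
  telescope f D step n zero = norm-≡
    (ℚS.solve 2 (λ D x → ℚS.con 0ℚ ℚS.:= D ℚS.:* (x ℚS.:- x)) ≡.refl D (ρ ^ℚ n))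
    (norm-cong (sym (-‿inverseʳ (f n))) norm-0)
  telescope f D step n (suc k) = norm-≡
    (ℚS.solve 4 (λ D r x y → D ℚS.:* (ℚS.con 1ℚ ℚS.:- r) ℚS.:* x ℚS.:+ D ℚS.:* (y ℚS.:- x)
        ℚS.:= D ℚS.:* (y ℚS.:- r ℚS.:* x)) ≡.refl D ρ (ρ ^ℚ (k ℕ.+ n)) (ρ ^ℚ n))
    (norm-cong (solve 3 (λ a b c → (a :+ :- b) :+ (b :+ :- c) := a :+ :- c) refl
       (f (suc (k ℕ.+ n))) (f (k ℕ.+ n)) (f n))
      (norm-+ (step (k ℕ.+ n)) (telescope f D step n k)))

  -- The weight `e` records decay in the parameter on top of the decay in `n`, so that the limits
  -- can in turn be summed over the parameter.
  record UniformLimit {X : Set} (f : X → ℕ → Carrier) (L : X → Carrier) (e : X → ℕ) : Set where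
    constructor uniform
    field
      rate : O {X × ℕ} (λ (x , n) → L x + - f x n) (λ (x , n) → e x ℕ.+ n)

  open UniformLimit

  module _ {X : Set} where

    limits : ∀ (f : X → ℕ → Carrier) {e : X → ℕ} →
      O {X × ℕ} (λ (x , n) → f x (suc n) + - f x n) (λ (x , n) → e x ℕ.+ n) →
      Σ[ L ∈ (X → Carrier) ] UniformLimit f L e
    limits f {e} (big-O C 0≤C b) =
      (λ x → proj₁ (lim x)) , uniform (big-O (K ℚ.* C) (0≤* 0≤K 0≤C) λ (x , n) →
        norm-≡ (regroup (K ℚ.* C) x n) (proj₂ (lim x) n))
      where
      -- The factor `K` puts the step bound C into the shape D(1 - ρ) required by `telescope`.
      D : X → ℚ
      D x = K ℚ.* C ℚ.* ρ ^ℚ e x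
      0≤D : ∀ x → 0ℚ ℚ.≤ D x
      0≤D x = 0≤* (0≤* 0≤K 0≤C) (^ℚ-nonNeg 0≤ρ (e x))
      regroup : ∀ C x n → C ℚ.* ρ ^ℚ e x ℚ.* ρ ^ℚ n ≡ C ℚ.* ρ ^ℚ (e x ℕ.+ n)
      regroup C x n = ≡.trans (ℚ.*-assoc C _ _) (≡.cong (C ℚ.*_) (≡.sym (^ℚ-homo-* ρ (e x) n)))
      step : ∀ x n → ∣ f x (suc n) + - f x n ∣≤ D x ℚ.* (1ℚ ℚ.- ρ) ℚ.* ρ ^ℚ n
      step x n = norm-≡
        (≡.trans (≡.sym (regroup C x n)) (≡.cong (ℚ._* ρ ^ℚ n)
          (≡.trans (≡.cong (ℚ._* ρ ^ℚ e x) (≡.sym (rescale C)))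
            (ℚS.solve 3 (λ c r x → c ℚS.:* r ℚS.:* x ℚS.:= c ℚS.:* x ℚS.:* r) ≡.refl (K ℚ.* C) (1ℚ ℚ.- ρ) (ρ ^ℚ e x)))))
        (b (x , n))
      lim : ∀ x → ∃[ L ] (∀ n → ∣ L + - f x n ∣≤ D x ℚ.* ρ ^ℚ n)
      lim x = complete 0<ρ ρ<1 (D x) (f x) λ n k →
        ≡.subst (λ m → ∣ f x m + - f x n ∣≤ D x ℚ.* ρ ^ℚ n) (ℕ.+-comm k n)
          (norm-weaken (*-monoʳ (D x) (0≤D x) (≤-by (ρ ^ℚ (k ℕ.+ n)) (^ℚ-nonNeg 0≤ρ (k ℕ.+ n))
              (ℚS.solve 2 (λ a b → a ℚS.:- b ℚS.:+ b ℚS.:= a) ≡.refl (ρ ^ℚ n) (ρ ^ℚ (k ℕ.+ n)))))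
            (telescope (f x) (D x) (step x) n k))

  vanishing : ∀ {z} → O {ℕ} (λ _ → z) (λ n → n) → z ≈ 0#
  vanishing {z} (big-O C 0≤C b) = norm-separated λ ε 0<ε →
    -- The constant C may be zero, so ε is divided by C + 1.
    let δ , 0<δ , eq = split (C ℚ.+ 1ℚ) ε (ℚ.+-mono-≤-< 0≤C (ℚ.positive⁻¹ 1ℚ)) 0<ε
        N , small = powers-vanish δ 0<δ
    in norm-weaken (ℚ.≤-trans
         (*-mono-≤ (^ℚ-nonNeg 0≤ρ N) (≤-by {C} 1ℚ 0≤1 ≡.refl) (small N ℕ.≤-refl) (0≤+ 0≤C 0≤1))
         (ℚ.≤-reflexive eq)) (b N)

  infix 4 _⇝_
  _⇝_ : (ℕ → Carrier) → Carrier → Set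
  f ⇝ L = O (λ n → L + - f n) (λ n → n)

  ⇝-at : ∀ {X : Set} {f : X → ℕ → Carrier} {L e} → UniformLimit f L e → ∀ x → f x ⇝ L x
  ⇝-at {f = f} {L} {e} (uniform o) x = O-weaken (λ n → ℕ.m≤n+m n (e x))
    (O-subst (x ,_) {λ (x , n) → L x + - f x n} {λ (x , n) → e x ℕ.+ n} o)

  ⇝-cong : ∀ {f g L M} → (∀ n → f n ≈ g n) → L ≈ M → f ⇝ L → g ⇝ M
  ⇝-cong f≈g L≈M = O-cong λ n → +-cong L≈M (-‿cong (f≈g n))

  ⇝-unique : ∀ {f L M} → f ⇝ L → f ⇝ M → L ≈ M
  ⇝-unique {f} {L} {M} f⇝L f⇝M = begin
    L              ≈⟨ solve 2 (λ l m → l := (l :+ :- m) :+ m) refl L M ⟩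
    (L + - M) + M  ≈⟨ +-congʳ (vanishing (O-cong
                         (λ n → solve 3 (λ l m x → (l :+ :- x) :+ :- (m :+ :- x) := l :+ :- m) refl L M (f n))
                         (O-+ f⇝L (O-neg f⇝M)))) ⟩
    0# + M         ≈⟨ +-identityˡ M ⟩
    M              ∎

  ⇝-const : ∀ {f L} → (∀ n → f n ≈ L) → f ⇝ L
  ⇝-const {f} {L} f≈L = big-O 0ℚ ℚ.≤-refl λ n → norm-≡ (≡.sym (ℚ.*-zeroˡ (ρ ^ℚ n)))
    (norm-cong (sym (trans (+-congˡ (-‿cong (f≈L n))) (-‿inverseʳ L))) norm-0)

  ⇝-bounded : ∀ {f L} → f ⇝ L → O f (λ _ → 0)
  ⇝-bounded {f} {L} f⇝L = O-cong (λ n → solve 2 (λ l x → l :+ :- (l :+ :- x) := x) refl L (f n))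
    (O-+ (O-const L) (O-neg (O-weaken (λ _ → ℕ.z≤n) f⇝L)))

  ⇝-+ : ∀ {f g L M} → f ⇝ L → g ⇝ M → (λ n → f n + g n) ⇝ L + M
  ⇝-+ {f} {g} {L} {M} f⇝L g⇝M = O-cong
    (λ n → solve 4 (λ l x m y → (l :+ :- x) :+ (m :+ :- y) := (l :+ m) :+ :- (x :+ y)) refl L (f n) M (g n))
    (O-+ f⇝L g⇝M)

  ⇝-* : ∀ {f g L M} → f ⇝ L → g ⇝ M → (λ n → f n * g n) ⇝ L * M
  ⇝-* {f} {g} {L} {M} f⇝L g⇝M = O-cong
    (λ n → solve 4 (λ l x m y → l :* (m :+ :- y) :+ y :* (l :+ :- x) := l :* m :+ :- (x :* y)) refl L (f n) M (g n))
    (O-+ (O-* (O-const L) g⇝M) (O-* (⇝-bounded g⇝M) f⇝L))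

  ⇝-scale : ∀ {f L} c → f ⇝ L → (λ n → c * f n) ⇝ c * L
  ⇝-scale c = ⇝-* (⇝-const λ _ → refl)

  ⇝-reindex : ∀ {f L} (h : ℕ → ℕ) → (∀ n → n ℕ.≤ h n) → f ⇝ L → (f ∘ h) ⇝ L
  ⇝-reindex {f} {L} h n≤h f⇝L = O-weaken n≤h (O-subst h {λ n → L + - f n} {λ n → n} f⇝L)

  sumTo prodTo : (ℕ → Carrier) → ℕ → Carrier
  sumTo f zero    = 0#
  sumTo f (suc n) = sumTo f n + f n
  prodTo f zero    = 1#
  prodTo f (suc n) = prodTo f n * f n

  sumTo-cong : ∀ {f g} → (∀ k → f k ≈ g k) → ∀ n → sumTo f n ≈ sumTo g n
  sumTo-cong f≈g zero    = refl
  sumTo-cong f≈g (suc n) = +-cong (sumTo-cong f≈g n) (f≈g n)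

  prodTo-cong : ∀ {f g} → (∀ k → f k ≈ g k) → ∀ n → prodTo f n ≈ prodTo g n
  prodTo-cong f≈g zero    = refl
  prodTo-cong f≈g (suc n) = *-cong (prodTo-cong f≈g n) (f≈g n)

  sumTo-scale : ∀ c f n → sumTo (λ k → c * f k) n ≈ c * sumTo f n
  sumTo-scale c f zero    = sym (zeroʳ c)
  sumTo-scale c f (suc n) = trans (+-congʳ (sumTo-scale c f n)) (sym (distribˡ c (sumTo f n) (f n)))

  sumTo-shift : ∀ f n → sumTo f (suc n) ≈ f 0 + sumTo (f ∘ suc) n
  sumTo-shift f zero    = +-comm 0# (f 0)
  sumTo-shift f (suc n) = trans (+-congʳ (sumTo-shift f n)) (+-assoc (f 0) (sumTo (f ∘ suc) n) (f (suc n)))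

  series : ∀ {X : Set} (f : X → ℕ → Carrier) {e : X → ℕ} →
    O {X × ℕ} (λ (x , n) → f x n) (λ (x , n) → e x ℕ.+ n) →
    Σ[ S ∈ (X → Carrier) ] UniformLimit (λ x → sumTo (f x)) S e
  series f of = limits (λ x → sumTo (f x)) (O-cong
    (λ (x , n) → solve 2 (λ s a → a := (s :+ a) :+ :- s) refl (sumTo (f x) n) (f x n)) of)

  -- At n = 0 the partial sum is empty, so the error bound there is a bound for the sum itself.
  series-bounded : ∀ {X : Set} {f : X → ℕ → Carrier} {e : X → ℕ} {S : X → Carrier} →
    UniformLimit (λ x → sumTo (f x)) S e → O S e
  series-bounded {f = f} {e} {S} (uniform o) = O-cong (λ x → solve 1 (λ s → s :+ :- con 0ℤ := s) refl (S x))
    (O-weaken (λ x → ℕ.m≤m+n (e x) 0) (O-subst (_, 0) {λ (x , n) → S x + - sumTo (f x) n} {λ (x , n) → e x ℕ.+ n} o))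

  norm-^ : ∀ {z B} → ∣ z ∣≤ B → ∀ n → ∣ z ^ n ∣≤ B ^ℚ n
  norm-^ b zero    = norm-1
  norm-^ b (suc n) = norm-* b (norm-^ b n)

  sumTo-geometric : ∀ z n → (1# + - z) * sumTo (z ^_) n ≈ 1# + - (z ^ n)
  sumTo-geometric z zero    = trans (zeroʳ _) (sym (-‿inverseʳ 1#))
  sumTo-geometric z (suc n) = trans (distribˡ _ _ _) (trans (+-congʳ (sumTo-geometric z n))
    (solve 2 (λ z p → (:1 :+ :- p) :+ (:1 :+ :- z) :* p := :1 :+ :- (z :* p)) refl z (z ^ n)))

  -- The inverse of 1 - u is the Neumann series of powers of u. The common bound ρ yields one
  -- constant for all the inverses.
  inverses : ∀ {X : Set} (u : X → Carrier) → (∀ x → ∣ u x ∣≤ ρ) →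
    Σ[ v ∈ (X → Carrier) ] (O v (λ _ → 0) × ∀ x → (1# + - u x) * v x ≈ 1#)
  inverses u ∣u∣≤ρ = proj₁ s , series-bounded (proj₂ s) , λ x → ⇝-unique
    (⇝-scale (1# + - u x) (⇝-at (proj₂ s) x))
    (O-cong (λ n → begin
        u x ^ n                                     ≈⟨ solve 1 (λ p → p := :1 :+ :- (:1 :+ :- p)) refl (u x ^ n) ⟩
        1# + - (1# + - (u x ^ n))                   ≈⟨ +-congˡ (-‿cong (sumTo-geometric (u x) n)) ⟨
        1# + - ((1# + - u x) * sumTo (u x ^_) n)    ∎)
      (O-unit λ n → norm-^ (∣u∣≤ρ x) n))
    where
    s = series (λ x n → u x ^ n) {λ _ → 0} (O-unit λ (x , n) → norm-^ (∣u∣≤ρ x) n)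

  bounded-tail : ∀ N {f : ℕ → Carrier} → O (λ n → f (N ℕ.+ n)) (λ _ → 0) → O f (λ _ → 0)
  bounded-tail zero    o = o
  bounded-tail (suc N) {f} o with bounded-tail N {f ∘ suc} o
  ... | big-O C 0≤C b = let B , f0≤B = norm-finite (f 0)
                            0≤B = norm-radius≥0 f0≤B in
    big-O (B ℚ.+ C) (0≤+ 0≤B 0≤C) λ
      { zero    → norm-weaken (≤-by C 0≤C (≡.sym (ℚ.*-identityʳ _))) f0≤B
      ; (suc n) → norm-weaken (≤-by B 0≤B
          (ℚS.solve 2 (λ B C → C ℚS.:* ℚS.con 1ℚ ℚS.:+ B ℚS.:= (B ℚS.:+ C) ℚS.:* ℚS.con 1ℚ) ≡.refl B C)) (b n) }

  module Product {u : ℕ → Carrier} (ou : O u (λ n → n)) where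

    P : ℕ → Carrier
    P = prodTo (λ k → 1# + u k)

    open O ou renaming (constant to C; constant≥0 to 0≤C; bound to ∣u∣≤)

    c : ℚ
    c = K ℚ.* C
    0≤c = 0≤* 0≤K 0≤C

    product-bounded : O P (λ _ → 0)
    product-bounded =
      -- `N` is chosen with cρᴺ ≤ ½, so that 1 - cρⁿ stays at least ½ from `N` on. The constant 2M
      -- then covers the starting value: M = 2M · ½ ≤ 2M(1 - cρᴺ).
      let η , 0<η , eq = split (c ℚ.+ 1ℚ) ½ (ℚ.+-mono-≤-< 0≤c (ℚ.positive⁻¹ 1ℚ)) (ℚ.positive⁻¹ ½)
          N , small = powers-vanish η 0<η
          M , PN≤M = norm-finite (P N)
          0≤M = norm-radius≥0 PN≤M
          0≤2M = 0≤+ 0≤M 0≤M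
          cρᴺ≤½ : c ℚ.* ρ ^ℚ N ℚ.≤ ½
          cρᴺ≤½ = ℚ.≤-trans (*-mono-≤ (^ℚ-nonNeg 0≤ρ N) (≤-by {c} 1ℚ 0≤1 ≡.refl) (small N ℕ.≤-refl) (0≤+ 0≤c 0≤1))
            (ℚ.≤-reflexive eq)
      in bounded-tail N (big-O (M ℚ.+ M) 0≤2M λ n →
           norm-weaken (*-monoʳ (M ℚ.+ M) 0≤2M
               (≤-by (c ℚ.* ρ ^ℚ (n ℕ.+ N)) (0≤* 0≤c (^ℚ-nonNeg 0≤ρ (n ℕ.+ N)))
                 (ℚS.solve 1 (λ x → ℚS.con 1ℚ ℚS.:- x ℚS.:+ x ℚS.:= ℚS.con 1ℚ) ≡.refl (c ℚ.* ρ ^ℚ (n ℕ.+ N)))))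
             (≡.subst (λ m → ∣ P m ∣≤ (M ℚ.+ M) ℚ.* (1ℚ ℚ.- c ℚ.* ρ ^ℚ (n ℕ.+ N))) (ℕ.+-comm n N)
               (tail (M ℚ.+ M) 0≤2M N
                 (norm-weaken (ℚ.≤-trans (ℚ.≤-reflexive (ℚS.solve 1 (λ m → m ℚS.:= (m ℚS.:+ m) ℚS.:* (ℚS.con 1ℚ ℚS.:- ℚS.con ½)) ≡.refl M))
                     (*-monoʳ (M ℚ.+ M) 0≤2M (ℚ.+-monoʳ-≤ 1ℚ (ℚ.neg-antimono-≤ cρᴺ≤½)))) PN≤M) n)))
      where
      -- The factor 1 − cρⁿ makes the bound self-improving: it absorbs 1 + Cρⁿ since c(1 − ρ) = C.
      tail : ∀ B → 0ℚ ℚ.≤ B → ∀ N → ∣ P N ∣≤ B ℚ.* (1ℚ ℚ.- c ℚ.* ρ ^ℚ N) →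
        ∀ n → ∣ P (n ℕ.+ N) ∣≤ B ℚ.* (1ℚ ℚ.- c ℚ.* ρ ^ℚ (n ℕ.+ N))
      tail B 0≤B N base zero    = base
      tail B 0≤B N base (suc n) = norm-weaken
        (≤-by (B ℚ.* (c ℚ.* x ℚ.* (C ℚ.* x))) (0≤* 0≤B (0≤* (0≤* 0≤c 0≤x) (0≤* 0≤C 0≤x)))
          (≡.trans (≡.cong (λ C → B ℚ.* (1ℚ ℚ.- c ℚ.* x) ℚ.* (1ℚ ℚ.+ C ℚ.* x) ℚ.+ B ℚ.* (c ℚ.* x ℚ.* (C ℚ.* x))) (≡.sym (rescale C)))
            (ℚS.solve 4 (λ B c r x → let C = c ℚS.:* (ℚS.con 1ℚ ℚS.:- r) in
                B ℚS.:* (ℚS.con 1ℚ ℚS.:- c ℚS.:* x) ℚS.:* (ℚS.con 1ℚ ℚS.:+ C ℚS.:* x) ℚS.:+ B ℚS.:* (c ℚS.:* x ℚS.:* (C ℚS.:* x))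
                  ℚS.:= B ℚS.:* (ℚS.con 1ℚ ℚS.:- c ℚS.:* (r ℚS.:* x))) ≡.refl B c ρ x)))
        (norm-* (tail B 0≤B N base n) (norm-+ norm-1 (∣u∣≤ (n ℕ.+ N))))
        where
        x = ρ ^ℚ (n ℕ.+ N)
        0≤x = ^ℚ-nonNeg 0≤ρ (n ℕ.+ N)

    product-limit : ∃[ L ] P ⇝ L
    product-limit =
      let L , o = limits {X = ℕ} (λ _ → P) {λ _ → 0} (O-cong
            (λ (_ , n) → solve 2 (λ p x → p :* x := p :* (:1 :+ x) :+ :- p) refl (P n) (u n))
            (O-subst proj₂ {λ n → P n * u n} {λ n → n} (O-* product-bounded ou)))
      in L 0 , ⇝-at o 0

  -- The product of the factors 1 - u k is carried together with the product of their inverses.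
  -- Convergence of both makes `V∞` an inverse of `W∞`, which is how non-vanishing of an infinite
  -- product is obtained.
  record EulerProduct (u : ℕ → Carrier) : Set where
    field
      v           : ℕ → Carrier
      v-inverse   : ∀ k → (1# + - u k) * v k ≈ 1#
      {W∞ V∞}     : Carrier
      W⇝          : prodTo (λ k → 1# + - u k) ⇝ W∞
      V⇝          : prodTo v ⇝ V∞

    W V : ℕ → Carrier
    W = prodTo (λ k → 1# + - u k)
    V = prodTo v

    W-inverse : ∀ n → W n * V n ≈ 1#
    W-inverse zero    = *-identityˡ 1#
    W-inverse (suc n) = begin
      (W n * w) * (V n * v n)   ≈⟨ solve 4 (λ a b c d → (a :* b) :* (c :* d) := (a :* c) :* (b :* d)) refl (W n) w (V n) (v n) ⟩
      (W n * V n) * (w * v n)   ≈⟨ *-cong (W-inverse n) (v-inverse n) ⟩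
      1# * 1#                   ≈⟨ *-identityˡ 1# ⟩
      1#                        ∎
      where w = 1# + - u n

    V-suc : ∀ n → V n ≈ (1# + - u n) * V (suc n)
    V-suc n = begin
      V n                          ≈⟨ *-identityʳ (V n) ⟨
      V n * 1#                     ≈⟨ *-congˡ (v-inverse n) ⟨
      V n * ((1# + - u n) * v n)   ≈⟨ solve 3 (λ a b c → a :* (b :* c) := b :* (a :* c)) refl (V n) (1# + - u n) (v n) ⟩
      (1# + - u n) * (V n * v n)   ∎

    W∞-inverse : W∞ * V∞ ≈ 1#
    W∞-inverse = ⇝-unique (⇝-* W⇝ V⇝) (⇝-const W-inverse)

  -- From (1 - u)v = 1 follows v = 1 + uv, so the product of the inverses is again a product of
  -- factors 1 + O(ρᵏ) and the same convergence result applies to it.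
  eulerProduct : ∀ {u} → (∀ k → ∣ u k ∣≤ ρ ^ℚ suc k) → EulerProduct u
  eulerProduct {u} ∣u∣≤ = record
    { v = v ; v-inverse = inv-v
    ; W⇝ = proj₂ (Product.product-limit (O-neg ou))
    ; V⇝ = ⇝-cong (prodTo-cong λ k → begin
          1# + u k * v k                       ≈⟨ +-congʳ (inv-v k) ⟨
          (1# + - u k) * v k + u k * v k       ≈⟨ solve 2 (λ u v → (:1 :+ :- u) :* v :+ u :* v := v) refl (u k) (v k) ⟩
          v k                                  ∎)
        refl (proj₂ (Product.product-limit ouv))
    }
    where
    ou : O u (λ k → k)
    ou = O-weaken (λ k → ℕ.n≤1+n k) (O-unit ∣u∣≤)
    inv : Σ[ v ∈ (ℕ → Carrier) ] (O v (λ _ → 0) × ∀ x → (1# + - u x) * v x ≈ 1#)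
    inv = inverses u λ k → norm-weaken
      (ℚ.≤-trans (^ℚ-antitone 0≤ρ ρ≤1 (ℕ.s≤s (ℕ.z≤n {k}))) (ℚ.≤-reflexive (ℚ.*-identityʳ ρ))) (∣u∣≤ k)
    v = proj₁ inv
    ov = proj₁ (proj₂ inv)
    inv-v = proj₂ (proj₂ inv)
    ouv : O (λ k → u k * v k) (λ k → k)
    ouv = O-weaken (λ k → ℕ.m≤m+n k 0) (O-* ou ov)

-- Finite sums over antidiagonals.

module Antidiagonals (A : CompleteNormedRing) {ρ : ℚ} (0<ρ : 0ℚ ℚ.< ρ) (ρ<1 : ρ ℚ.< 1ℚ) where

  open CompleteNormedRing A hiding (zero)
  open IntegerCoefficients commutativeRing
  open Relation.Binary.Reasoning.Setoid setoid
  open Algebra.Properties.CommutativeSemiring.Exp commutativeSemiring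
  open Analysis A 0<ρ ρ<1

  -- The sum over l + r = n. Both indices are passed to the summand, so that the truncated
  -- difference n - l never appears.
  Δ : ℕ → (ℕ → ℕ → Carrier) → Carrier
  Δ zero    g = g 0 0
  Δ (suc n) g = g 0 (suc n) + Δ n (λ l r → g (suc l) r)

  Δ-suc : ∀ n g → Δ (suc n) g ≈ Δ n (λ l r → g l (suc r)) + g (suc n) 0
  Δ-suc zero    g = refl
  Δ-suc (suc n) g = trans (+-congˡ (Δ-suc n (λ l r → g (suc l) r))) (sym (+-assoc _ _ _))

  Δ-cong : ∀ n {g h} → (∀ l r → l ℕ.+ r ≡ n → g l r ≈ h l r) → Δ n g ≈ Δ n h
  Δ-cong zero    g≈h = g≈h 0 0 ≡.refl
  Δ-cong (suc n) g≈h = +-cong (g≈h 0 (suc n) ≡.refl) (Δ-cong n λ l r eq → g≈h (suc l) r (≡.cong suc eq))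

  Δ-+ : ∀ n g h → Δ n (λ l r → g l r + h l r) ≈ Δ n g + Δ n h
  Δ-+ zero    g h = refl
  Δ-+ (suc n) g h = trans (+-congˡ (Δ-+ n _ _))
    (solve 4 (λ a b c d → (a :+ b) :+ (c :+ d) := (a :+ c) :+ (b :+ d)) refl _ _ _ _)

  Δ-scale : ∀ c n g → Δ n (λ l r → c * g l r) ≈ c * Δ n g
  Δ-scale c zero    g = refl
  Δ-scale c (suc n) g = trans (+-congˡ (Δ-scale c n _)) (sym (distribˡ c _ _))

  -- The terms of the antidiagonal l + r = 2n that lie j places from its centre, where m = n - j:
  -- the pair (m, m + 2j), (m + 2j, m), or for j = 0 the single central term.
  fold : (ℕ → ℕ → Carrier) → ℕ → ℕ → Carrier
  fold g zero    m = g m m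
  fold g (suc j) m = g m (m ℕ.+ (suc j ℕ.+ suc j)) + g (m ℕ.+ (suc j ℕ.+ suc j)) m

  -- Each induction step strips both ends of the antidiagonal; they form the pair with j = n and m =
  -- 0.
  Δ-fold : ∀ n g → Δ (n ℕ.+ n) g ≈ Δ n (fold g)
  Δ-fold zero    g = refl
  Δ-fold (suc n) g = begin
    Δ (suc (n ℕ.+ suc n)) g
      ≡⟨ ≡.cong (λ k → Δ (suc k) g) (ℕ.+-suc n n) ⟩
    g 0 (suc (suc (n ℕ.+ n))) + Δ (suc (n ℕ.+ n)) (λ l r → g (suc l) r)
      ≈⟨ +-congˡ (Δ-suc (n ℕ.+ n) (λ l r → g (suc l) r)) ⟩
    g 0 (suc (suc (n ℕ.+ n))) + (Δ (n ℕ.+ n) g⁺ + g (suc (suc (n ℕ.+ n))) 0)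
      ≡⟨ ≡.cong (λ k → g 0 (suc k) + (Δ (n ℕ.+ n) g⁺ + g (suc k) 0)) (ℕ.+-suc n n) ⟨
    g 0 (suc (n ℕ.+ suc n)) + (Δ (n ℕ.+ n) g⁺ + g (suc (n ℕ.+ suc n)) 0)
      ≈⟨ solve 3 (λ a b c → a :+ (b :+ c) := b :+ (a :+ c)) refl _ _ _ ⟩
    Δ (n ℕ.+ n) g⁺ + fold g (suc n) 0
      ≈⟨ +-congʳ (Δ-fold n g⁺) ⟩
    Δ n (fold g⁺) + fold g (suc n) 0
      ≈⟨ +-congʳ (Δ-cong n λ { zero m _ → refl ; (suc j) m _ → refl }) ⟩
    Δ n (λ j m → fold g j (suc m)) + fold g (suc n) 0
      ≈⟨ Δ-suc n (fold g) ⟨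
    Δ (suc n) (fold g) ∎
    where
    g⁺ : ℕ → ℕ → Carrier
    g⁺ l r = g (suc l) (suc r)

  prodTo-shift : ∀ f n → prodTo f (suc n) ≈ f 0 * prodTo (f ∘ suc) n
  prodTo-shift f zero    = *-comm 1# (f 0)
  prodTo-shift f (suc n) = trans (*-congʳ (prodTo-shift f n)) (*-assoc (f 0) (prodTo (f ∘ suc) n) (f (suc n)))

  1^n≈1 : ∀ n → 1# ^ n ≈ 1#
  1^n≈1 zero    = refl
  1^n≈1 (suc n) = trans (*-identityˡ _) (1^n≈1 n)

  -- The q-Pascal recurrences and the finite triple product.

  module QSeries (q : Carrier) (Q : EulerProduct (λ k → q ^ suc k)) where

    open EulerProduct Q

    poch : Carrier → ℕ → Carrier
    poch a = prodTo (λ k → 1# + - (a * q ^ k))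

    cancel : ∀ n {x y} → (1# + - q ^ suc n) * x ≈ (1# + - q ^ suc n) * y → x ≈ y
    cancel n {x} {y} eq = begin
      x                            ≈⟨ restore x ⟨
      v n * ((1# + - q ^ suc n) * x)     ≈⟨ *-congˡ eq ⟩
      v n * ((1# + - q ^ suc n) * y)     ≈⟨ restore y ⟩
      y                            ∎
      where
      restore : ∀ x → v n * ((1# + - q ^ suc n) * x) ≈ x
      restore x = trans (solve 3 (λ v w x → v :* (w :* x) := (w :* v) :* x) refl (v n) (1# + - q ^ suc n) x)
        (trans (*-congʳ (v-inverse n)) (*-identityˡ x))

    -- Here `V` r is 1/(q)ᵣ. Replacing it by (1 - q^(r+1)) `V` (r + 1) moves to the next
    -- antidiagonal, and the end term r = 0 that is missing there may be added because it contains 1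
    -- - q⁰ = 0.
    lower-right : ∀ n (c : ℕ → ℕ → Carrier) → Δ n (λ l r → c l (suc r) * (V l * V r))
      ≈ Δ (suc n) (λ l r → c l r * (1# + - q ^ r) * (V l * V r))
    lower-right n c = begin
      Δ n (λ l r → c l (suc r) * (V l * V r))
        ≈⟨ Δ-cong n (λ l r _ → trans (*-congˡ (*-congˡ (V-suc r)))
             (solve 4 (λ c a w b → c :* (a :* (w :* b)) := c :* w :* (a :* b)) refl _ _ _ _)) ⟩
      Δ n (λ l r → h l (suc r))
        ≈⟨ solve 3 (λ d c w → d := d :+ c :* (:1 :+ :- :1) :* w) refl (Δ n (λ l r → h l (suc r))) (c (suc n) 0) (V (suc n) * V 0) ⟩
      Δ n (λ l r → h l (suc r)) + h (suc n) 0
        ≈⟨ Δ-suc n h ⟨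
      Δ (suc n) h ∎
      where
      h : ℕ → ℕ → Carrier
      h l r = c l r * (1# + - q ^ r) * (V l * V r)

    lower-left : ∀ n (c : ℕ → ℕ → Carrier) → Δ n (λ l r → c (suc l) r * (V l * V r))
      ≈ Δ (suc n) (λ l r → c l r * (1# + - q ^ l) * (V l * V r))
    lower-left n c = begin
      Δ n (λ l r → c (suc l) r * (V l * V r))
        ≈⟨ Δ-cong n (λ l r _ → trans (*-congˡ (*-congʳ (V-suc l)))
             (solve 4 (λ c w a b → c :* ((w :* a) :* b) := c :* w :* (a :* b)) refl _ _ _ _)) ⟩
      Δ n (λ l r → h (suc l) r)
        ≈⟨ solve 3 (λ d c w → d := c :* (:1 :+ :- :1) :* w :+ d) refl (Δ n (λ l r → h (suc l) r)) (c 0 (suc n)) (V 0 * V (suc n)) ⟩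
      Δ (suc n) h ∎
      where
      h : ℕ → ℕ → Carrier
      h l r = c l r * (1# + - q ^ l) * (V l * V r)

    -- On the antidiagonal q^l q^r is the constant qⁿ, so the factor leaves the sum.
    collect : ∀ n (f : ℕ → Carrier) (g h : ℕ → ℕ → Carrier) →
      (∀ l r → g l r + h l r ≈ (1# + - (q ^ l * q ^ r)) * (f l * (V l * V r))) →
      Δ n g + Δ n h ≈ (1# + - q ^ n) * Δ n (λ l r → f l * (V l * V r))
    collect n f g h eq = begin
      Δ n g + Δ n h                                                          ≈⟨ Δ-+ n g h ⟨
      Δ n (λ l r → g l r + h l r)                                            ≈⟨ Δ-cong n (λ l r l+r≡n → trans (eq l r)
           (*-congʳ (+-congˡ (-‿cong (trans (sym (^-homo-* q l r)) (^-congʳ q l+r≡n)))))) ⟩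
      Δ n (λ l r → (1# + - q ^ n) * (f l * (V l * V r)))                     ≈⟨ Δ-scale (1# + - q ^ n) n _ ⟩
      (1# + - q ^ n) * Δ n (λ l r → f l * (V l * V r))                       ∎

    -- The two q-Pascal rules, with q-binomials written as products of reciprocal q-factorials. With
    -- x = q^l and y = q^r they rest on 1 - xy = (1 - y) + y(1 - x) here and on 1 - xy = (1 - x) +
    -- x(1 - y) in `pascal₂`.
    pascal₁ : ∀ n f → Δ n (λ l r → f l * (V l * V r)) + Δ n (λ l r → f (suc l) * q ^ r * (V l * V r))
      ≈ (1# + - q ^ suc n) * Δ (suc n) (λ l r → f l * (V l * V r))
    pascal₁ n f = trans (+-cong (lower-right n (λ l r → f l)) (lower-left n (λ l r → f l * q ^ r)))
      (collect (suc n) f _ _ λ l r →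
        solve 4 (λ f a b w → f :* (:1 :+ :- b) :* w :+ f :* b :* (:1 :+ :- a) :* w := (:1 :+ :- (a :* b)) :* (f :* w))
          refl (f l) (q ^ l) (q ^ r) (V l * V r))

    pascal₂ : ∀ n f → Δ n (λ l r → f (suc l) * (V l * V r)) + Δ n (λ l r → f l * q ^ l * (V l * V r))
      ≈ (1# + - q ^ suc n) * Δ (suc n) (λ l r → f l * (V l * V r))
    pascal₂ n f = trans (+-cong (lower-left n (λ l r → f l)) (lower-right n (λ l r → f l * q ^ l)))
      (collect (suc n) f _ _ λ l r →
        solve 4 (λ f a b w → f :* (:1 :+ :- a) :* w :+ f :* a :* (:1 :+ :- b) :* w := (:1 :+ :- (a :* b)) :* (f :* w))
          refl (f l) (q ^ l) (q ^ r) (V l * V r))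

    -- s j = (-1)^j q^(j(j-1)/2)
    s : ℕ → Carrier
    s zero    = 1#
    s (suc j) = - (q ^ j * s j)

    module TripleProduct (ζ η : Carrier) (ζη≈q : ζ * η ≈ q) where

      -- E n l = (-1)^k q^(k(k-1)/2) ζ^k for k = l - n, where η = q/ζ takes care of k < 0.
      E : ℕ → ℕ → Carrier
      E zero    l       = s l * ζ ^ l
      E (suc n) zero    = s (suc n) * η ^ suc n
      E (suc n) (suc l) = E n l

      E-left : ∀ m p → E (m ℕ.+ p) m ≡ E p 0
      E-left zero    p = ≡.refl
      E-left (suc m) p = E-left m p

      E-right : ∀ m p k → E (m ℕ.+ p) (m ℕ.+ (p ℕ.+ k)) ≡ E 0 k
      E-right zero    zero    k = ≡.refl
      E-right zero    (suc p) k = E-right zero p k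
      E-right (suc m) p       k = E-right m p k

      E-middle : ∀ m → E m m ≡ E 0 0
      E-middle zero    = ≡.refl
      E-middle (suc m) = E-middle m

      step-ζ : ∀ m l r → l ℕ.+ r ≡ m → - (ζ * q ^ m) * E 0 l ≈ E 0 (suc l) * q ^ r
      step-ζ m l r ≡.refl = trans (*-congʳ (-‿cong (*-congˡ (^-homo-* q l r))))
        (solve 5 (λ z a b s p → :- (z :* (a :* b)) :* (s :* p) := (:- (a :* s) :* (z :* p)) :* b) refl
          ζ (q ^ l) (q ^ r) (s l) (ζ ^ l))

      -- The factor -ηqⁿ lowers the exponent k = l - n by one. For k ≤ 0 it appends an η; for k > 0
      -- it has to remove a ζ, and there ζη = q is used.
      step-η : ∀ n l → - (η * q ^ n) * E n l ≈ E (suc n) l * q ^ l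
      step-η zero    zero    = solve 1 (λ e → :- (e :* :1) :* (:1 :* :1) := (:- (:1 :* :1) :* (e :* :1)) :* :1) refl η
      step-η (suc n) zero    =
        solve 4 (λ e p s x → :- (e :* p) :* (s :* x) := (:- (p :* s) :* (e :* x)) :* :1) refl η (q ^ suc n) (s (suc n)) (η ^ suc n)
      step-η zero    (suc l) = begin
        - (η * 1#) * (- (q ^ l * s l) * (ζ * ζ ^ l))
          ≈⟨ solve 5 (λ e p s z x → :- (e :* :1) :* (:- (p :* s) :* (z :* x)) := (s :* x) :* ((z :* e) :* p)) refl η (q ^ l) (s l) ζ (ζ ^ l) ⟩
        (s l * ζ ^ l) * ((ζ * η) * q ^ l)
          ≈⟨ *-congˡ (*-congʳ ζη≈q) ⟩
        (s l * ζ ^ l) * (q * q ^ l) ∎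
      step-η (suc n) (suc l) = begin
        - (η * (q * q ^ n)) * E n l     ≈⟨ solve 4 (λ e q p x → :- (e :* (q :* p)) :* x := q :* (:- (e :* p) :* x)) refl η q (q ^ n) (E n l) ⟩
        q * (- (η * q ^ n) * E n l)     ≈⟨ *-congˡ (step-η n l) ⟩
        q * (E (suc n) l * q ^ l)       ≈⟨ solve 3 (λ q x p → q :* (x :* p) := x :* (q :* p)) refl q (E (suc n) l) (q ^ l) ⟩
        E (suc n) l * (q * q ^ l)       ∎

      F : ℕ → ℕ → Carrier
      F n m = Δ (n ℕ.+ m) (λ l r → E n l * (V l * V r))

      expand : ∀ n N a (f : ℕ → ℕ → Carrier) → (∀ l r → l ℕ.+ r ≡ N → - a * E n l ≈ f l r) →
        Δ N (λ l r → E n l * (V l * V r)) + Δ N (λ l r → f l r * (V l * V r))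
          ≈ (1# + - a) * Δ N (λ l r → E n l * (V l * V r))
      expand n N a f eq = begin
        Δ N g + Δ N (λ l r → f l r * (V l * V r))     ≈⟨ +-congˡ (Δ-cong N λ l r l+r≡N → trans (*-congʳ (sym (eq l r l+r≡N))) (*-assoc _ _ _)) ⟩
        Δ N g + Δ N (λ l r → - a * g l r)             ≈⟨ +-congˡ (Δ-scale (- a) N g) ⟩
        Δ N g + - a * Δ N g                           ≈⟨ solve 2 (λ x a → x :+ :- a :* x := (:1 :+ :- a) :* x) refl (Δ N g) a ⟩
        (1# + - a) * Δ N g                            ∎
        where
        g : ℕ → ℕ → Carrier
        g l r = E n l * (V l * V r)

      -- The q-binomial theorem with a shifted origin. The factors in ζ are built up first, with n =
      -- 0, by `pascal₁`; each factor in η then moves the origin of `E` one place, by `pascal₂`.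
      -- Both rules produce the sum multiplied by 1 - q^(n+m+1), hence the use of `cancel`.
      finite-triple-product : ∀ n m → poch ζ m * poch η n * V (n ℕ.+ m) ≈ F n m
      finite-triple-product zero zero = solve 0 (:1 :* :1 :* :1 := :1 :* :1 :* (:1 :* :1)) refl
      finite-triple-product zero (suc m) = cancel m (begin
        (1# + - q ^ suc m) * (poch ζ m * (1# + - (ζ * q ^ m)) * 1# * V (suc m))
          ≈⟨ solve 4 (λ w p a v → w :* (p :* a :* :1 :* v) := a :* (p :* :1 :* (w :* v))) refl
               (1# + - q ^ suc m) (poch ζ m) (1# + - (ζ * q ^ m)) (V (suc m)) ⟩
        (1# + - (ζ * q ^ m)) * (poch ζ m * 1# * ((1# + - q ^ suc m) * V (suc m)))
          ≈⟨ *-congˡ (*-congˡ (V-suc m)) ⟨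
        (1# + - (ζ * q ^ m)) * (poch ζ m * 1# * V m)
          ≈⟨ *-congˡ (finite-triple-product zero m) ⟩
        (1# + - (ζ * q ^ m)) * F 0 m
          ≈⟨ expand 0 m (ζ * q ^ m) (λ l r → E 0 (suc l) * q ^ r) (step-ζ m) ⟨
        Δ m (λ l r → E 0 l * (V l * V r)) + Δ m (λ l r → E 0 (suc l) * q ^ r * (V l * V r))
          ≈⟨ pascal₁ m (E 0) ⟩
        (1# + - q ^ suc m) * F 0 (suc m) ∎)
      finite-triple-product (suc n) m = cancel (n ℕ.+ m) (begin
        (1# + - q ^ suc (n ℕ.+ m)) * (poch ζ m * (poch η n * (1# + - (η * q ^ n))) * V (suc (n ℕ.+ m)))
          ≈⟨ solve 5 (λ w p r a v → w :* (p :* (r :* a) :* v) := a :* (p :* r :* (w :* v))) refl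
               (1# + - q ^ suc (n ℕ.+ m)) (poch ζ m) (poch η n) (1# + - (η * q ^ n)) (V (suc (n ℕ.+ m))) ⟩
        (1# + - (η * q ^ n)) * (poch ζ m * poch η n * ((1# + - q ^ suc (n ℕ.+ m)) * V (suc (n ℕ.+ m))))
          ≈⟨ *-congˡ (*-congˡ (V-suc (n ℕ.+ m))) ⟨
        (1# + - (η * q ^ n)) * (poch ζ m * poch η n * V (n ℕ.+ m))
          ≈⟨ *-congˡ (finite-triple-product n m) ⟩
        (1# + - (η * q ^ n)) * F n m
          ≈⟨ expand n (n ℕ.+ m) (η * q ^ n) (λ l r → E (suc n) l * q ^ l) (λ l r _ → step-η n l) ⟨
        Δ (n ℕ.+ m) (λ l r → E n l * (V l * V r)) + Δ (n ℕ.+ m) (λ l r → E (suc n) l * q ^ l * (V l * V r))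
          ≈⟨ pascal₂ (n ℕ.+ m) (E (suc n)) ⟩
        (1# + - q ^ suc (n ℕ.+ m)) * F (suc n) m ∎)

      θ : ℕ → Carrier
      θ zero    = 1#
      θ (suc j) = s (suc j) * (ζ ^ suc j + η ^ suc j)

      -- With equally many factors in ζ and η the exponents j and -j carry the same weight
      -- 1/((q)ₘ(q)ₘ₊₂ⱼ) and the same coefficient `s` j, so folding merges them.
      symmetric-triple-product : ∀ n → poch ζ n * poch η n * V (n ℕ.+ n) ≈ Δ n (λ j m → θ j * (V m * V (m ℕ.+ (j ℕ.+ j))))
      symmetric-triple-product n = trans (finite-triple-product n n) (trans (Δ-fold n _) (Δ-cong n terms))
        where
        terms : ∀ j m → j ℕ.+ m ≡ n → fold (λ l r → E n l * (V l * V r)) j m ≈ θ j * (V m * V (m ℕ.+ (j ℕ.+ j)))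
        terms zero m ≡.refl = begin
          E m m * (V m * V m)             ≡⟨ ≡.cong₂ (λ e k → e * (V m * V k)) (E-middle m) (≡.sym (ℕ.+-identityʳ m)) ⟩
          1# * 1# * (V m * V (m ℕ.+ 0))   ≈⟨ *-congʳ (*-identityˡ 1#) ⟩
          1# * (V m * V (m ℕ.+ 0))        ∎
        terms (suc j) m ≡.refl = begin
          E (k ℕ.+ m) m * (V m * V M) + E (k ℕ.+ m) M * (V M * V m)
            ≡⟨ ≡.cong (λ n → E n m * (V m * V M) + E n M * (V M * V m)) (ℕ.+-comm k m) ⟩
          E (m ℕ.+ k) m * (V m * V M) + E (m ℕ.+ k) M * (V M * V m)
            ≡⟨ ≡.cong₂ (λ x y → x * (V m * V M) + y * (V M * V m)) (E-left m k) (E-right m k k) ⟩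
          s k * η ^ k * (V m * V M) + s k * ζ ^ k * (V M * V m)
            ≈⟨ solve 5 (λ s e z a b → s :* e :* (a :* b) :+ s :* z :* (b :* a) := s :* (z :+ e) :* (a :* b)) refl
                 (s k) (η ^ k) (ζ ^ k) (V m) (V M) ⟩
          s k * (ζ ^ k + η ^ k) * (V m * V M) ∎
          where
          k = suc j
          M = m ℕ.+ (k ℕ.+ k)

    module _ (ζ η : Carrier) (ζη≈q : ζ * η ≈ q) where

      private
        module General = TripleProduct ζ η ζη≈q
        module Trivial = TripleProduct 1# q (*-identityˡ q)

      c : ℕ → Carrier
      c j = s j * - ((1# + - ζ ^ j) * (1# + - η ^ j))

      -- Since q^j = ζ^jη^j, the bracket is ζ^j + η^j - 1 - ζ^jη^j = -(1 - ζ^j)(1 - η^j). At j = 0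
      -- both coefficients are 1 and cancel.
      c-difference : ∀ j → General.θ j + - 1# * Trivial.θ j ≈ c j
      c-difference zero    = solve 0 (:1 :+ :- :1 :* :1 := :1 :* :- ((:1 :+ :- :1) :* (:1 :+ :- :1))) refl
      c-difference (suc j) = begin
        s k * (ζ ^ k + η ^ k) + - 1# * (s k * (1# ^ k + q ^ k))
          ≈⟨ +-congˡ (*-congˡ (*-congˡ (+-cong (1^n≈1 k) (trans (^-congˡ k (sym ζη≈q)) (^-distrib-* ζ η k))))) ⟩
        s k * (ζ ^ k + η ^ k) + - 1# * (s k * (1# + ζ ^ k * η ^ k))
          ≈⟨ solve 3 (λ s z e → s :* (z :+ e) :+ :- :1 :* (s :* (:1 :+ z :* e)) := s :* :- ((:1 :+ :- z) :* (:1 :+ :- e))) refl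
               (s k) (ζ ^ k) (η ^ k) ⟩
        s k * - ((1# + - ζ ^ k) * (1# + - η ^ k)) ∎
        where k = suc j

      poch-1 : ∀ n → poch 1# (suc n) ≈ 0#
      poch-1 n = trans (prodTo-shift (λ k → 1# + - (1# * q ^ k)) n)
        (trans (*-congʳ (solve 0 (:1 :+ :- (:1 :* :1) := :1 :+ :- :1) refl)) (trans (*-congʳ (-‿inverseʳ 1#)) (zeroˡ _)))

      -- The finite triple product vanishes at ζ = 1; subtracting this instance produces the factors 1 − ζʲ and 1 − ηʲ.
      poch-expansion : ∀ n → poch ζ (suc n) * poch η (suc n) * V (suc n ℕ.+ suc n)
        ≈ Δ (suc n) (λ j m → c j * (V m * V (m ℕ.+ (j ℕ.+ j))))
      poch-expansion n = begin
        L ζ η                                                 ≈⟨ solve 3 (λ l p v → l := l :+ :- :1 :* (con 0ℤ :* p :* v)) refl (L ζ η) (poch q N) (V (N ℕ.+ N)) ⟩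
        L ζ η + - 1# * (0# * poch q N * V (N ℕ.+ N))          ≈⟨ +-congˡ (*-congˡ (*-congʳ (*-congʳ (poch-1 n)))) ⟨
        L ζ η + - 1# * L 1# q                                 ≈⟨ +-cong (General.symmetric-triple-product N) (*-congˡ (Trivial.symmetric-triple-product N)) ⟩
        Δ N (S General.θ) + - 1# * Δ N (S Trivial.θ)          ≈⟨ +-congˡ (Δ-scale (- 1#) N (S Trivial.θ)) ⟨
        Δ N (S General.θ) + Δ N (λ j m → - 1# * S Trivial.θ j m)
                                                              ≈⟨ Δ-+ N (S General.θ) (λ j m → - 1# * S Trivial.θ j m) ⟨
        Δ N (λ j m → S General.θ j m + - 1# * S Trivial.θ j m)
                                                              ≈⟨ Δ-cong N (λ j m _ → trans
                                                                   (solve 3 (λ a b w → a :* w :+ :- :1 :* (b :* w) := (a :+ :- :1 :* b) :* w)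
                                                                     refl (General.θ j) (Trivial.θ j) (V m * V (m ℕ.+ (j ℕ.+ j))))
                                                                   (*-congʳ (c-difference j))) ⟩
        Δ N (S c)                                             ∎
        where
        N = suc n
        L : Carrier → Carrier → Carrier
        L a b = poch a N * poch b N * V (N ℕ.+ N)
        S : (ℕ → Carrier) → ℕ → ℕ → Carrier
        S f j m = f j * (V m * V (m ℕ.+ (j ℕ.+ j)))

-- Interchange of the two summations.

module SeriesIdentity (A : CompleteNormedRing) {ρ : ℚ} (0<ρ : 0ℚ ℚ.< ρ) (ρ<1 : ρ ℚ.< 1ℚ) where

  open CompleteNormedRing A hiding (zero)
  open IntegerCoefficients commutativeRing
  open Relation.Binary.Reasoning.Setoid setoid
  open Algebra.Properties.CommutativeSemiring.Exp commutativeSemiring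
  open Analysis A 0<ρ ρ<1
  open Antidiagonals A 0<ρ ρ<1
  open RationalEstimates
  open Powers 0<ρ ρ<1 using () renaming (0≤r to 0≤ρ; r≤1 to ρ≤1)

  -- On j + m = n the bound is ρⁿρ^j. The surplus ρ^j makes the n + 1 terms sum to at most Kρⁿ;
  -- without it a factor n + 1 would spoil the rate. The induction closes because 1 + ρK = K.
  Δ-norm : ∀ n D (h : ℕ → ℕ → Carrier) → 0ℚ ℚ.≤ D → (∀ j m → ∣ h j m ∣≤ D ℚ.* ρ ^ℚ (j ℕ.+ j ℕ.+ m)) →
    ∣ Δ n h ∣≤ D ℚ.* K ℚ.* ρ ^ℚ n
  Δ-norm zero D h 0≤D b = norm-weaken
    (≤-by (D ℚ.* K ℚ.* ρ) (0≤* (0≤* 0≤D 0≤K) 0≤ρ)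
      (≡.trans (≡.cong (λ x → x ℚ.* 1ℚ ℚ.+ D ℚ.* K ℚ.* ρ) (≡.sym (rescale D)))
        (ℚS.solve 3 (λ D K r → K ℚS.:* D ℚS.:* (ℚS.con 1ℚ ℚS.:- r) ℚS.:* ℚS.con 1ℚ ℚS.:+ D ℚS.:* K ℚS.:* r
          ℚS.:= D ℚS.:* K ℚS.:* ℚS.con 1ℚ) ≡.refl D K ρ)))
    (b 0 0)
  Δ-norm (suc n) D h 0≤D b = norm-≡
    (≡.trans (≡.cong (λ x → x ℚ.* (ρ ℚ.* ρ ^ℚ n) ℚ.+ (D ℚ.* (ρ ℚ.* ρ)) ℚ.* K ℚ.* ρ ^ℚ n) (≡.sym (rescale D)))
      (ℚS.solve 4 (λ D K r x → K ℚS.:* D ℚS.:* (ℚS.con 1ℚ ℚS.:- r) ℚS.:* (r ℚS.:* x) ℚS.:+ (D ℚS.:* (r ℚS.:* r)) ℚS.:* K ℚS.:* x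
          ℚS.:= D ℚS.:* K ℚS.:* (r ℚS.:* x)) ≡.refl D K ρ (ρ ^ℚ n)))
    (norm-+ (b 0 (suc n)) (Δ-norm n (D ℚ.* (ρ ℚ.* ρ)) (λ j m → h (suc j) m) (0≤* 0≤D (0≤* 0≤ρ 0≤ρ)) λ j m →
      norm-≡ (≡.trans (≡.cong (λ k → D ℚ.* (ρ ℚ.* ρ ^ℚ (k ℕ.+ m))) (ℕ.+-suc j j))
        (ℚS.solve 3 (λ D r x → D ℚS.:* (r ℚS.:* (r ℚS.:* x)) ℚS.:= D ℚS.:* (r ℚS.:* r) ℚS.:* x) ≡.refl D ρ (ρ ^ℚ (j ℕ.+ j ℕ.+ m))))
        (b (suc j) m)))

  O-Δ : ∀ {h : ℕ → ℕ → Carrier} → O {ℕ × ℕ} (λ (j , m) → h j m) (λ (j , m) → j ℕ.+ j ℕ.+ m) →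
    O (λ n → Δ n h) (λ n → n)
  O-Δ (big-O C 0≤C b) = big-O (C ℚ.* K) (0≤* 0≤C 0≤K) λ n → Δ-norm n C _ 0≤C λ j m → b (j , m)

  -- The triangle j + m ≤ n is summed by rows: `Δ` n runs over j ≤ n, and its second index n - j
  -- measures how much of row j lies in the triangle.
  sumTo-Δ : ∀ g n → sumTo (λ n → Δ n g) (suc n) ≈ Δ n (λ j m → sumTo (g j) (suc m))
  sumTo-Δ g zero    = refl
  sumTo-Δ g (suc n) = begin
    sumTo (λ n → Δ n g) (suc n) + Δ (suc n) g
      -- The added zero is the empty partial sum of row n + 1, the end term that `Δ-suc` expects.
      ≈⟨ +-congʳ (trans (sumTo-Δ g n) (sym (+-identityʳ _))) ⟩
    Δ n (λ j m → sumTo (g j) (suc m)) + 0# + Δ (suc n) g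
      ≈⟨ +-congʳ (Δ-suc n (λ j m → sumTo (g j) m)) ⟨
    Δ (suc n) (λ j m → sumTo (g j) m) + Δ (suc n) g
      ≈⟨ Δ-+ (suc n) (λ j m → sumTo (g j) m) g ⟨
    Δ (suc n) (λ j m → sumTo (g j) (suc m)) ∎

  sumTo-Δ₁ : ∀ R n → sumTo R (suc n) ≈ Δ n (λ j _ → R j)
  sumTo-Δ₁ R zero    = +-identityˡ (R 0)
  sumTo-Δ₁ R (suc n) = trans (+-congʳ (sumTo-Δ₁ R n)) (sym (Δ-suc n (λ j _ → R j)))

  -- The error is the tail of the sum of `R` plus the tails of the rows cut off by the triangle. The
  -- uniform rate bounds the latter by ρ^(2j+m), and `O-Δ` adds them up to O(ρⁿ).
  double-series : ∀ (g : ℕ → ℕ → Carrier) R {S} → UniformLimit (λ j → sumTo (g j)) R (λ j → j ℕ.+ j) →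
    sumTo R ⇝ S → (λ n → sumTo (λ n → Δ n g) (suc n)) ⇝ S
  double-series g R {S} (uniform o) R⇝S = O-cong
    (λ n → begin
      (S + - sumTo R (suc n)) + Δ n (λ j m → R j + - sumTo (g j) (suc m))
        ≈⟨ +-congˡ (Δ-cong n λ j m _ → +-congˡ (solve 1 (λ x → :- x := :- :1 :* x) refl (sumTo (g j) (suc m)))) ⟩
      (S + - sumTo R (suc n)) + Δ n (λ j m → R j + - 1# * sumTo (g j) (suc m))
        ≈⟨ +-congˡ (trans (Δ-+ n (λ j m → R j) (λ j m → - 1# * sumTo (g j) (suc m)))
             (+-cong (sym (sumTo-Δ₁ R n)) (trans (Δ-scale (- 1#) n (λ j m → sumTo (g j) (suc m))) (*-congˡ (sym (sumTo-Δ g n)))))) ⟩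
      (S + - sumTo R (suc n)) + (sumTo R (suc n) + - 1# * sumTo (λ n → Δ n g) (suc n))
        ≈⟨ solve 3 (λ s r d → (s :+ :- r) :+ (r :+ :- :1 :* d) := s :+ :- d) refl S (sumTo R (suc n)) (sumTo (λ n → Δ n g) (suc n)) ⟩
      S + - sumTo (λ n → Δ n g) (suc n) ∎)
    (O-+ (⇝-reindex suc ℕ.n≤1+n R⇝S) (O-Δ (O-weaken (λ (j , m) → ℕ.+-monoʳ-≤ (j ℕ.+ j) (ℕ.n≤1+n m))
      (O-subst (λ (j , m) → j , suc m) {λ (j , n) → R j + - sumTo (g j) n} {λ (j , n) → j ℕ.+ j ℕ.+ n} o))))

  -- The functional equation of Heine type and the two expansions.

  module Identity {q t ζ η ι : Carrier}
    (t²≈q : t ^ 2 ≈ q) (ζη≈q : ζ * η ≈ q) (ι²≈-1 : ι * ι ≈ - 1#)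
    (∣t∣≤ : ∣ t ∣≤ ρ) (∣ζ∣≤ : ∣ ζ ∣≤ ρ) (∣η∣≤ : ∣ η ∣≤ ρ) (∣ι∣≤ : ∣ ι ∣≤ 1ℚ) where

    module ℕS = ℕ-Solver

    odd : ℕ → ℕ
    odd k = 2 ℕ.* k ℕ.+ 1

    odd-+ : ∀ k m → odd (k ℕ.+ m) ≡ odd k ℕ.+ 2 ℕ.* m
    odd-+ = ℕS.solve 2 (λ k m → ℕS.con 2 ℕS.:* (k ℕS.:+ m) ℕS.:+ ℕS.con 1 ℕS.:= (ℕS.con 2 ℕS.:* k ℕS.:+ ℕS.con 1) ℕS.:+ ℕS.con 2 ℕS.:* m) ≡.refl

    odd+odd : ∀ k m → odd k ℕ.+ odd m ≡ 2 ℕ.* suc (k ℕ.+ m)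
    odd+odd = ℕS.solve 2 (λ k m → (ℕS.con 2 ℕS.:* k ℕS.:+ ℕS.con 1) ℕS.:+ (ℕS.con 2 ℕS.:* m ℕS.:+ ℕS.con 1) ℕS.:= ℕS.con 2 ℕS.:* (ℕS.con 1 ℕS.:+ (k ℕS.:+ m))) ≡.refl

    q^≈t^ : ∀ m → q ^ m ≈ t ^ (2 ℕ.* m)
    q^≈t^ m = trans (^-congˡ m (sym t²≈q)) (^-assocʳ t 2 m)

    -- The doubled exponent comes from q = t² and provides the surplus needed in `Δ-norm`.
    norm-q^ : ∀ m → ∣ q ^ m ∣≤ ρ ^ℚ (m ℕ.+ m)
    norm-q^ m = norm-cong (sym (q^≈t^ m)) (≡.subst (λ k → ∣ t ^ k ∣≤ ρ ^ℚ (m ℕ.+ m))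
      (≡.cong (m ℕ.+_) (≡.sym (ℕ.+-identityʳ m))) (norm-^ ∣t∣≤ (m ℕ.+ m)))

    norm-q^′ : ∀ m → ∣ q ^ m ∣≤ ρ ^ℚ m
    norm-q^′ m = norm-weaken (^ℚ-antitone 0≤ρ ρ≤1 (ℕ.m≤m+n m m)) (norm-q^ m)

    b : ℕ → Carrier
    b k = ι * t ^ odd k

    a : ℕ → Carrier
    a k = - b k

    norm-b : ∀ k → ∣ b k ∣≤ ρ ^ℚ suc k
    norm-b k = norm-weaken (^ℚ-antitone 0≤ρ ρ≤1 (≡.subst (suc k ℕ.≤_) (ℕ.+-comm 1 (2 ℕ.* k)) (ℕ.s≤s (ℕ.m≤m+n k (k ℕ.+ 0)))))
      (norm-≡ (ℚ.*-identityˡ _) (norm-* ∣ι∣≤ (norm-^ ∣t∣≤ (odd k))))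

    norm-b′ : ∀ k → ∣ b k ∣≤ ρ
    norm-b′ k = norm-weaken (ℚ.≤-trans (^ℚ-antitone 0≤ρ ρ≤1 (ℕ.s≤s (ℕ.z≤n {k}))) (ℚ.≤-reflexive (ℚ.*-identityʳ ρ))) (norm-b k)

    b-shift : ∀ k m → b (k ℕ.+ m) ≈ b k * q ^ m
    b-shift k m = begin
      ι * t ^ odd (k ℕ.+ m)              ≡⟨ ≡.cong (λ e → ι * t ^ e) (odd-+ k m) ⟩
      ι * t ^ (odd k ℕ.+ 2 ℕ.* m)        ≈⟨ *-congˡ (^-homo-* t (odd k) (2 ℕ.* m)) ⟩
      ι * (t ^ odd k * t ^ (2 ℕ.* m))    ≈⟨ *-congˡ (*-congˡ (q^≈t^ m)) ⟨
      ι * (t ^ odd k * q ^ m)            ≈⟨ *-assoc ι (t ^ odd k) (q ^ m) ⟨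
      ι * t ^ odd k * q ^ m              ∎

    -- With ι² = -1 the product of the two Heine parameters is an integral power of q, so `V` can
    -- express the denominators.
    a*b : ∀ k m → a k * b m ≈ q ^ suc (k ℕ.+ m)
    a*b k m = begin
      - (ι * t ^ odd k) * (ι * t ^ odd m)       ≈⟨ solve 3 (λ i x y → :- (i :* x) :* (i :* y) := :- (i :* i) :* (x :* y)) refl ι (t ^ odd k) (t ^ odd m) ⟩
      - (ι * ι) * (t ^ odd k * t ^ odd m)       ≈⟨ *-congʳ (-‿cong ι²≈-1) ⟩
      - (- 1#) * (t ^ odd k * t ^ odd m)        ≈⟨ solve 1 (λ x → :- (:- :1) :* x := x) refl (t ^ odd k * t ^ odd m) ⟩
      t ^ odd k * t ^ odd m                     ≈⟨ ^-homo-* t (odd k) (odd m) ⟨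
      t ^ (odd k ℕ.+ odd m)                     ≡⟨ ≡.cong (t ^_) (odd+odd k m) ⟩
      t ^ (2 ℕ.* suc (k ℕ.+ m))                 ≈⟨ q^≈t^ (suc (k ℕ.+ m)) ⟨
      q ^ suc (k ℕ.+ m)                         ∎

    Q : EulerProduct (λ k → q ^ suc k)
    Q = eulerProduct (λ k → norm-q^′ (suc k))
    P⁺ : EulerProduct a
    P⁺ = eulerProduct (λ k → norm-neg (norm-b k))
    P⁻ : EulerProduct b
    P⁻ = eulerProduct norm-b
    Z : EulerProduct (λ k → ζ * q ^ k)
    Z = eulerProduct (λ k → norm-* ∣ζ∣≤ (norm-q^′ k))
    H : EulerProduct (λ k → η * q ^ k)
    H = eulerProduct (λ k → norm-* ∣η∣≤ (norm-q^′ k))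

    module Q = EulerProduct Q
    module P⁺ = EulerProduct P⁺
    module P⁻ = EulerProduct P⁻
    module Z = EulerProduct Z
    module H = EulerProduct H
    open Q using (V; V-suc)
    open P⁺ using () renaming (W to W⁺)
    open P⁻ using () renaming (W to W⁻)
    open QSeries q Q

    W-bounded : ∀ {u} (P : EulerProduct u) → O (EulerProduct.W P) (λ _ → 0)
    W-bounded P = ⇝-bounded (EulerProduct.W⇝ P)

    -- W⁺ n * W⁻ n is (−q;q²)ₙ, and τ α β is the summand of the Heine series ₂φ₁(a_α, b_β; a_α b_β; q, q),
    -- rescaled to be free of denominators in α and β; note a_α b_β = q^(α+β+1).
    τ : ℕ → ℕ → ℕ → Carrier
    τ α β m = q ^ m * (W⁺ (α ℕ.+ m) * W⁻ (β ℕ.+ m) * (V m * V (m ℕ.+ (α ℕ.+ β))))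

    O-τ : O {(ℕ × ℕ) × ℕ} (λ ((α , β) , m) → τ α β m) (λ (_ , m) → m)
    O-τ = O-weaken (λ (_ , m) → ℕ.m≤m+n m 0) (O-* (O-unit λ (_ , m) → norm-q^′ m)
      (O-* (O-* (O-subst (λ ((α , β) , m) → α ℕ.+ m) {W⁺} {λ _ → 0} (W-bounded P⁺))
                (O-subst (λ ((α , β) , m) → β ℕ.+ m) {W⁻} {λ _ → 0} (W-bounded P⁻)))
           (O-* (O-subst proj₂ {V} {λ _ → 0} (⇝-bounded Q.V⇝))
                (O-subst (λ ((α , β) , m) → m ℕ.+ (α ℕ.+ β)) {V} {λ _ → 0} (⇝-bounded Q.V⇝)))))

    abstract
      T-limit : Σ[ T ∈ (ℕ × ℕ → Carrier) ] UniformLimit (λ (α , β) → sumTo (τ α β)) T (λ _ → 0)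
      T-limit = series (λ (α , β) → τ α β) {λ _ → 0} O-τ

    T : ℕ → ℕ → Carrier
    T α β = proj₁ T-limit (α , β)

    module _ (α β : ℕ) where

      -- The closed form of `partial` (n + 1): a product of four factors, each with a known limit.
      U : ℕ → Carrier
      U m = W⁺ (suc (α ℕ.+ m)) * W⁻ (suc (β ℕ.+ m)) * (V m * V (suc (m ℕ.+ (α ℕ.+ β))))

      increment : ℕ → Carrier
      increment m = (1# + - a α) * (1# + - b β) * (q ^ m * (W⁺ (α ℕ.+ m) * W⁻ (β ℕ.+ m) * (V m * V (suc (m ℕ.+ (α ℕ.+ β))))))

      q-product : ∀ m → q ^ suc (m ℕ.+ (α ℕ.+ β)) ≈ q ^ m * (a α * b β)
      q-product m = begin
        q ^ suc (m ℕ.+ (α ℕ.+ β))     ≡⟨ ≡.cong (q ^_) (ℕ.+-suc m (α ℕ.+ β)) ⟨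
        q ^ (m ℕ.+ suc (α ℕ.+ β))     ≈⟨ ^-homo-* q m (suc (α ℕ.+ β)) ⟩
        q ^ m * q ^ suc (α ℕ.+ β)     ≈⟨ *-congˡ (a*b α β) ⟨
        q ^ m * (a α * b β)           ∎

      a-shift : ∀ k m → a (k ℕ.+ m) ≈ a k * q ^ m
      a-shift k m = trans (-‿cong (b-shift k m)) (solve 2 (λ x y → :- (x :* y) := :- x :* y) refl (b k) (q ^ m))

      V-lower : ∀ m → V (m ℕ.+ (α ℕ.+ β)) ≈ (1# + - (q ^ m * (a α * b β))) * V (suc (m ℕ.+ (α ℕ.+ β)))
      V-lower m = trans (V-suc (m ℕ.+ (α ℕ.+ β))) (*-congʳ (+-congˡ (-‿cong (q-product m))))

      -- After the common factors are removed this is (1 - abqᵐ) - b(1 - aqᵐ) = 1 - b: subtracting b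
      -- times the series at aq removes the dependence on m from the bracket.
      τ-difference : ∀ m → (1# + - a α) * (τ α β m + - (b β * τ (suc α) β m)) ≈ increment m
      τ-difference m = begin
        (1# + - a α) * (p * (x * y * (V m * V (m ℕ.+ (α ℕ.+ β)))) + - (b β * (p * (x * (1# + - a (α ℕ.+ m)) * y * (V m * V (m ℕ.+ suc (α ℕ.+ β)))))))
          ≈⟨ *-congˡ (+-cong (*-congˡ (*-congˡ (*-congˡ (V-lower m))))
               (-‿cong (*-congˡ (*-congˡ (*-cong (*-congʳ (*-congˡ (+-congˡ (-‿cong (a-shift α m)))))
                 (*-congˡ (reflexive (≡.cong V (ℕ.+-suc m (α ℕ.+ β)))))))))) ⟩
        (1# + - a α) * (p * (x * y * (V m * ((1# + - (p * (a α * b β))) * V″))) + - (b β * (p * (x * (1# + - (a α * p)) * y * (V m * V″)))))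
          ≈⟨ solve 7 (λ a b p x y v w →
               (:1 :+ :- a) :* (p :* (x :* y :* (v :* ((:1 :+ :- (p :* (a :* b))) :* w))) :+ :- (b :* (p :* (x :* (:1 :+ :- (a :* p)) :* y :* (v :* w)))))
                 := (:1 :+ :- a) :* (:1 :+ :- b) :* (p :* (x :* y :* (v :* w)))) refl (a α) (b β) p x y (V m) V″ ⟩
        increment m ∎
        where
        p = q ^ m
        x = W⁺ (α ℕ.+ m)
        y = W⁻ (β ℕ.+ m)
        V″ = V (suc (m ℕ.+ (α ℕ.+ β)))

      -- With p = q^(m+1) the common factors leave (1 - p)(1 - abp) + (1 - a)(1 - b)p = (1 - ap)(1 -
      -- bp).
      U-step : ∀ m → U m + increment (suc m) ≈ U (suc m)
      U-step m = begin
        W⁺ (suc (α ℕ.+ m)) * W⁻ (suc (β ℕ.+ m)) * (V m * V (suc m ℕ.+ (α ℕ.+ β))) + increment (suc m)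
          ≡⟨ ≡.cong₂ (λ k l → W⁺ k * W⁻ l * (V m * V (suc m ℕ.+ (α ℕ.+ β))) + increment (suc m)) (ℕ.+-suc α m) (ℕ.+-suc β m) ⟨
        x * y * (V m * V (suc m ℕ.+ (α ℕ.+ β))) + increment (suc m)
          ≈⟨ +-congʳ (*-congˡ (*-cong (V-suc m) (V-lower (suc m)))) ⟩
        x * y * ((1# + - p) * V (suc m) * ((1# + - (p * (a α * b β))) * V″)) + increment (suc m)
          ≈⟨ solve 7 (λ a b p x y v w →
               x :* y :* ((:1 :+ :- p) :* v :* ((:1 :+ :- (p :* (a :* b))) :* w)) :+ (:1 :+ :- a) :* (:1 :+ :- b) :* (p :* (x :* y :* (v :* w)))
                 := x :* (:1 :+ :- (a :* p)) :* (y :* (:1 :+ :- (b :* p))) :* (v :* w)) refl (a α) (b β) p x y (V (suc m)) V″ ⟩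
        x * (1# + - (a α * p)) * (y * (1# + - (b β * p))) * (V (suc m) * V″)
          ≈⟨ *-congʳ (*-cong (*-congˡ (+-congˡ (-‿cong (a-shift α (suc m))))) (*-congˡ (+-congˡ (-‿cong (b-shift β (suc m)))))) ⟨
        U (suc m) ∎
        where
        p = q ^ suc m
        x = W⁺ (α ℕ.+ suc m)
        y = W⁻ (β ℕ.+ suc m)
        V″ = V (suc (suc m ℕ.+ (α ℕ.+ β)))

      U-zero : increment 0 ≈ U 0
      U-zero = begin
        (1# + - a α) * (1# + - b β) * (1# * (x * y * (1# * V″)))
          ≈⟨ solve 5 (λ a b x y w → (:1 :+ :- a) :* (:1 :+ :- b) :* (:1 :* (x :* y :* (:1 :* w)))
               := x :* (:1 :+ :- (a :* :1)) :* (y :* (:1 :+ :- (b :* :1))) :* (:1 :* w)) refl (a α) (b β) x y V″ ⟩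
        x * (1# + - (a α * 1#)) * (y * (1# + - (b β * 1#))) * (1# * V″)
          ≈⟨ *-congʳ (*-cong (*-congˡ (+-congˡ (-‿cong (a-shift α 0)))) (*-congˡ (+-congˡ (-‿cong (b-shift β 0))))) ⟨
        U 0 ∎
        where
        x = W⁺ (α ℕ.+ 0)
        y = W⁻ (β ℕ.+ 0)
        V″ = V (suc (α ℕ.+ β))

      partial : ℕ → Carrier
      partial n = (1# + - a α) * (sumTo (τ α β) n + - (b β * sumTo (τ (suc α) β) n))

      partial-suc : ∀ n → partial (suc n) ≈ partial n + increment n
      partial-suc n = trans
        (solve 6 (λ w b s x s′ x′ → w :* (s :+ x :+ :- (b :* (s′ :+ x′))) := w :* (s :+ :- (b :* s′)) :+ w :* (x :+ :- (b :* x′))) refl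
          (1# + - a α) (b β) (sumTo (τ α β) n) (τ α β n) (sumTo (τ (suc α) β) n) (τ (suc α) β n))
        (+-congˡ (τ-difference n))

      partial≈U : ∀ n → partial (suc n) ≈ U n
      partial≈U zero    = begin
        partial 1                   ≈⟨ partial-suc 0 ⟩
        partial 0 + increment 0     ≈⟨ solve 3 (λ w b x → w :* (con 0ℤ :+ :- (b :* con 0ℤ)) :+ x := x) refl (1# + - a α) (b β) (increment 0) ⟩
        increment 0                 ≈⟨ U-zero ⟩
        U 0                         ∎
      partial≈U (suc n) = trans (partial-suc (suc n)) (trans (+-congʳ (partial≈U n)) (U-step n))

      -- The limit of `partial≈U`. Shifts of the index by α and β disappear in the limit, so the
      -- right side is the same for all parameters.
      T-equation : (1# + - a α) * (T α β + - (b β * T (suc α) β)) ≈ P⁺.W∞ * P⁻.W∞ * (Q.V∞ * Q.V∞)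
      T-equation = ⇝-unique
        (⇝-cong partial≈U refl (⇝-reindex suc ℕ.n≤1+n
          (⇝-scale (1# + - a α) (⇝-+ (⇝-at (proj₂ T-limit) (α , β))
            (⇝-cong (λ n → solve 2 (λ b s → :- b :* s := :- (b :* s)) refl (b β) (sumTo (τ (suc α) β) n))
              (solve 2 (λ b s → :- b :* s := :- (b :* s)) refl (b β) (T (suc α) β))
              (⇝-scale (- b β) (⇝-at (proj₂ T-limit) (suc α , β))))))))
        (⇝-* (⇝-* (⇝-reindex (λ m → suc (α ℕ.+ m)) (λ m → ℕ.m≤n⇒m≤1+n (ℕ.m≤n+m m α)) P⁺.W⇝)
                  (⇝-reindex (λ m → suc (β ℕ.+ m)) (λ m → ℕ.m≤n⇒m≤1+n (ℕ.m≤n+m m β)) P⁻.W⇝))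
             (⇝-* Q.V⇝ (⇝-reindex (λ m → suc (m ℕ.+ (α ℕ.+ β))) (λ m → ℕ.m≤n⇒m≤1+n (ℕ.m≤m+n m (α ℕ.+ β))) Q.V⇝)))

    -- The constant (q)∞²/(-q;q²)∞, which normalises the right side of `T-equation` to 1.
    κ : Carrier
    κ = Q.W∞ * Q.W∞ * (P⁺.V∞ * P⁻.V∞)

    κ-inverse : κ * (P⁺.W∞ * P⁻.W∞ * (Q.V∞ * Q.V∞)) ≈ 1#
    κ-inverse = begin
      κ * (P⁺.W∞ * P⁻.W∞ * (Q.V∞ * Q.V∞))
        ≈⟨ solve 6 (λ w v x x′ y y′ → w :* w :* (x′ :* y′) :* (x :* y :* (v :* v)) := (w :* v) :* (w :* v) :* ((x :* x′) :* (y :* y′))) refl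
             Q.W∞ Q.V∞ P⁺.W∞ P⁺.V∞ P⁻.W∞ P⁻.V∞ ⟩
      (Q.W∞ * Q.V∞) * (Q.W∞ * Q.V∞) * ((P⁺.W∞ * P⁺.V∞) * (P⁻.W∞ * P⁻.V∞))
        ≈⟨ *-cong (*-cong Q.W∞-inverse Q.W∞-inverse) (*-cong P⁺.W∞-inverse P⁻.W∞-inverse) ⟩
      1# * 1# * (1# * 1#)
        ≈⟨ solve 0 (:1 :* :1 :* (:1 :* :1) := :1) refl ⟩
      1# ∎

    R : ℕ → ℕ → Carrier
    R α β = κ * T α β

    R-equation : ∀ α β → R α β ≈ P⁺.v α + b β * R (suc α) β
    R-equation α β = begin
      R α β
        ≈⟨ solve 4 (λ k x b y → k :* x := :1 :* (k :* (x :+ :- (b :* y))) :+ b :* (k :* y)) refl κ (T α β) (b β) (T (suc α) β) ⟩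
      1# * (κ * D) + b β * R (suc α) β
        ≈⟨ +-congʳ (*-congʳ (P⁺.v-inverse α)) ⟨
      (1# + - a α) * P⁺.v α * (κ * D) + b β * R (suc α) β
        ≈⟨ +-congʳ (solve 4 (λ w v k d → w :* v :* (k :* d) := v :* (k :* (w :* d))) refl (1# + - a α) (P⁺.v α) κ D) ⟩
      P⁺.v α * (κ * ((1# + - a α) * D)) + b β * R (suc α) β
        ≈⟨ +-congʳ (*-congˡ (trans (*-congˡ (T-equation α β)) κ-inverse)) ⟩
      P⁺.v α * 1# + b β * R (suc α) β
        ≈⟨ +-congʳ (*-identityʳ (P⁺.v α)) ⟩
      P⁺.v α + b β * R (suc α) β ∎
      where D = T α β + - (b β * T (suc α) β)

    R-unroll : ∀ α β n → R α β ≈ sumTo (λ n → b β ^ n * P⁺.v (α ℕ.+ n)) n + b β ^ n * R (α ℕ.+ n) β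
    R-unroll α β zero = begin
      R α β                             ≡⟨ ≡.cong (λ k → R k β) (ℕ.+-identityʳ α) ⟨
      R (α ℕ.+ 0) β                     ≈⟨ solve 1 (λ x → x := con 0ℤ :+ :1 :* x) refl (R (α ℕ.+ 0) β) ⟩
      0# + 1# * R (α ℕ.+ 0) β           ∎
    R-unroll α β (suc n) = begin
      R α β
        ≈⟨ R-unroll α β n ⟩
      Σ + b β ^ n * R (α ℕ.+ n) β
        ≈⟨ +-congˡ (*-congˡ (R-equation (α ℕ.+ n) β)) ⟩
      Σ + b β ^ n * (P⁺.v (α ℕ.+ n) + b β * R (suc (α ℕ.+ n)) β)
        ≈⟨ solve 5 (λ s p v b r → s :+ p :* (v :+ b :* r) := s :+ p :* v :+ b :* p :* r) refl
             Σ (b β ^ n) (P⁺.v (α ℕ.+ n)) (b β) (R (suc (α ℕ.+ n)) β) ⟩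
      Σ + b β ^ n * P⁺.v (α ℕ.+ n) + b β * b β ^ n * R (suc (α ℕ.+ n)) β
        ≡⟨ ≡.cong (λ k → Σ + b β ^ n * P⁺.v (α ℕ.+ n) + b β * b β ^ n * R k β) (ℕ.+-suc α n) ⟨
      Σ + b β ^ n * P⁺.v (α ℕ.+ n) + b β * b β ^ n * R (α ℕ.+ suc n) β ∎
      where Σ = sumTo (λ n → b β ^ n * P⁺.v (α ℕ.+ n)) n

    O-T : O {ℕ × ℕ} (λ (α , β) → T α β) (λ _ → 0)
    O-T = series-bounded (proj₂ T-limit)

    -- The remainder bⁿR(aqⁿ, b) is O(ρⁿ), since |b| ≤ ρ and `T` is bounded uniformly in its first
    -- parameter.
    R-series : ∀ α β → sumTo (λ n → b β ^ n * P⁺.v (α ℕ.+ n)) ⇝ R α β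
    R-series α β = O-cong
      (λ n → begin
        b β ^ n * R (α ℕ.+ n) β            ≈⟨ solve 2 (λ s x → x := (s :+ x) :+ :- s) refl (Σ n) (b β ^ n * R (α ℕ.+ n) β) ⟩
        (Σ n + b β ^ n * R (α ℕ.+ n) β) + - Σ n      ≈⟨ +-congʳ (R-unroll α β n) ⟨
        R α β + - Σ n                      ∎)
      (O-weaken (λ n → ℕ.m≤m+n n 0) (O-* (O-unit λ n → norm-^ (norm-b′ β) n)
        (O-* (O-const κ) (O-subst (λ n → α ℕ.+ n , β) {λ (α , β) → T α β} {λ _ → 0} O-T))))
      where
      Σ : ℕ → Carrier
      Σ = sumTo (λ n → b β ^ n * P⁺.v (α ℕ.+ n))

    C : ℕ → Carrier
    C = c ζ η ζη≈q

    norm-s : ∀ j → ∣ s j ∣≤ 1ℚ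
    norm-s zero    = norm-1
    norm-s (suc j) = norm-neg (norm-weaken
      (*-mono-≤ 0≤1 (^ℚ-≤1 0≤ρ ρ≤1 j) ℚ.≤-refl 0≤1) (norm-* (norm-q^′ j) (norm-s j)))

    O-C : O C (λ _ → 0)
    O-C = O-* (O-unit norm-s) (O-neg (O-* (one-minus ∣ζ∣≤) (one-minus ∣η∣≤)))
      where
      one-minus : ∀ {z} → ∣ z ∣≤ ρ → O (λ j → 1# + - z ^ j) (λ _ → 0)
      one-minus ∣z∣≤ρ = O-+ (O-const 1#) (O-neg (O-unit λ j → norm-weaken (^ℚ-≤1 0≤ρ ρ≤1 j) (norm-^ ∣z∣≤ρ j)))

    r : ℕ → Carrier
    r j = C j * q ^ j * T j j

    -- With n = j + m this is c_j (-q;q²)ₙ qⁿ / ((q)ₙ₋ⱼ(q)ₙ₊ⱼ), the general term of the interchanged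
    -- double sum.
    g : ℕ → ℕ → Carrier
    g j m = C j * q ^ j * τ j j m

    g-limit : UniformLimit (λ j → sumTo (g j)) r (λ j → j ℕ.+ j)
    g-limit = uniform (O-cong
      (λ (j , n) → trans
        (solve 3 (λ c x y → c :* (x :+ :- y) := c :* x :+ :- (c :* y)) refl (C j * q ^ j) (T j j) (sumTo (τ j j) n))
        (+-congˡ (-‿cong (sym (sumTo-scale (C j * q ^ j) (τ j j) n)))))
      (O-* (O-* (O-subst proj₁ {C} {λ _ → 0} O-C) (O-unit λ (j , _) → norm-q^ j))
        (O-subst (λ (j , n) → (j , j) , n) {λ ((α , β) , n) → T α β + - sumTo (τ α β) n} {λ (_ , n) → n} (rate (proj₂ T-limit)))))
      where open UniformLimit

    abstract
      r-sum : ∃[ S ] sumTo r ⇝ S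
      r-sum = let S , lim = series {X = ℕ} (λ _ → r) {λ _ → 0} (O-subst proj₂ {r} {λ j → j}
                    (O-weaken (λ j → ℕ.m≤m+n j j) (series-bounded g-limit)))
              in S 0 , ⇝-at lim 0

    S : Carrier
    S = proj₁ r-sum

    left-term : ℕ → Carrier
    left-term n = poch ζ n * poch η n * (W⁺ n * W⁻ n) * V (n ℕ.+ n) * q ^ n

    -- The index starts at 1: at 0 the left side is 1, whereas `Δ` 0 `g` vanishes together with c₀.
    left-term≈Δ : ∀ n → left-term (suc n) ≈ Δ (suc n) g
    left-term≈Δ n = begin
      poch ζ N * poch η N * (W⁺ N * W⁻ N) * V (N ℕ.+ N) * q ^ N
        ≈⟨ solve 5 (λ x y w v p → x :* y :* w :* v :* p := w :* p :* (x :* y :* v)) refl (poch ζ N) (poch η N) (W⁺ N * W⁻ N) (V (N ℕ.+ N)) (q ^ N) ⟩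
      W⁺ N * W⁻ N * q ^ N * (poch ζ N * poch η N * V (N ℕ.+ N))
        ≈⟨ *-congˡ (poch-expansion ζ η ζη≈q n) ⟩
      W⁺ N * W⁻ N * q ^ N * Δ N (λ j m → C j * (V m * V (m ℕ.+ (j ℕ.+ j))))
        ≈⟨ Δ-scale (W⁺ N * W⁻ N * q ^ N) N (λ j m → C j * (V m * V (m ℕ.+ (j ℕ.+ j)))) ⟨
      Δ N (λ j m → W⁺ N * W⁻ N * q ^ N * (C j * (V m * V (m ℕ.+ (j ℕ.+ j)))))
        ≈⟨ Δ-cong N terms ⟩
      Δ N g ∎
      where
      N = suc n
      terms : ∀ j m → j ℕ.+ m ≡ N → W⁺ N * W⁻ N * q ^ N * (C j * (V m * V (m ℕ.+ (j ℕ.+ j)))) ≈ g j m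
      terms j m eq = begin
        W⁺ N * W⁻ N * q ^ N * (C j * (V m * V (m ℕ.+ (j ℕ.+ j))))
          ≡⟨ ≡.cong (λ N → W⁺ N * W⁻ N * q ^ N * (C j * (V m * V (m ℕ.+ (j ℕ.+ j))))) eq ⟨
        W⁺ (j ℕ.+ m) * W⁻ (j ℕ.+ m) * q ^ (j ℕ.+ m) * (C j * (V m * V (m ℕ.+ (j ℕ.+ j))))
          ≈⟨ *-congʳ (*-congˡ (^-homo-* q j m)) ⟩
        W⁺ (j ℕ.+ m) * W⁻ (j ℕ.+ m) * (q ^ j * q ^ m) * (C j * (V m * V (m ℕ.+ (j ℕ.+ j))))
          ≈⟨ solve 5 (λ w p p′ c v → w :* (p :* p′) :* (c :* v) := c :* p :* (p′ :* (w :* v))) refl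
               (W⁺ (j ℕ.+ m) * W⁻ (j ℕ.+ m)) (q ^ j) (q ^ m) (C j) (V m * V (m ℕ.+ (j ℕ.+ j))) ⟩
        g j m ∎

    C-zero : C 0 ≈ 0#
    C-zero = solve 0 (:1 :* :- ((:1 :+ :- :1) :* (:1 :+ :- :1)) := con 0ℤ) refl

    left-sum : sumTo (λ k → left-term (suc k)) ⇝ S
    left-sum = ⇝-cong
      (λ n → begin
        sumTo (λ n → Δ n g) (suc n)                  ≈⟨ sumTo-shift (λ n → Δ n g) n ⟩
        -- The antidiagonal of index 0 contributes a multiple of c₀ = 0, so the sum may start at n =
        -- 1.
        g 0 0 + sumTo (λ n → Δ (suc n) g) n          ≈⟨ +-cong (trans (*-congʳ (trans (*-congʳ C-zero) (zeroˡ _))) (zeroˡ _))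
                                                          (sumTo-cong (λ n → sym (left-term≈Δ n)) n) ⟩
        0# + sumTo (λ k → left-term (suc k)) n       ≈⟨ +-identityˡ _ ⟩
        sumTo (λ k → left-term (suc k)) n            ∎)
      refl (double-series g r g-limit (proj₂ r-sum))

    right-term : ℕ → ℕ → Carrier
    right-term j n = C j * q ^ j * (b j ^ n * P⁺.v (j ℕ.+ n))

    inner-sum : ∀ j → sumTo (right-term j) ⇝ κ * r j
    inner-sum j = ⇝-cong (λ n → sym (sumTo-scale (C j * q ^ j) _ n))
      (solve 3 (λ c k t → c :* (k :* t) := k :* (c :* t)) refl (C j * q ^ j) κ (T j j))
      (⇝-scale (C j * q ^ j) (R-series j j))

    outer-sum : sumTo (λ k → κ * r (suc k)) ⇝ κ * S
    outer-sum = ⇝-cong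
      (λ n → begin
        κ * sumTo r (suc n)                        ≈⟨ *-congˡ (sumTo-shift r n) ⟩
        κ * (r 0 + sumTo (λ k → r (suc k)) n)      ≈⟨ *-congˡ (+-congʳ (trans (*-congʳ (trans (*-congʳ C-zero) (zeroˡ _))) (zeroˡ _))) ⟩
        κ * (0# + sumTo (λ k → r (suc k)) n)       ≈⟨ *-congˡ (+-identityˡ _) ⟩
        κ * sumTo (λ k → r (suc k)) n              ≈⟨ sumTo-scale κ (λ k → r (suc k)) n ⟨
        sumTo (λ k → κ * r (suc k)) n              ∎)
      refl (⇝-scale κ (⇝-reindex suc ℕ.n≤1+n (proj₂ r-sum)))

-- The operations are separate parameters and the sides are records, so that
-- instances for definitionally equal operations are compared without unfolding
-- the expressions built from them.
module Notation {C : Set} (_≈_ : C → C → Set) (_*_ : C → C → C) (-_ : C → C) (1# : C) (_^_ : C → ℕ → C)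
  (NonZero : C → Set) (_/_[_] : C → (w : C) → NonZero w → C)
  (⟨_﹔_⟩_ : C → C → ℕ → C) (_⟶_ : (ℕ → C) → C → Set) (HasSum : (ℕ → C) → C → Set)
  (ζ η q : C) (numerator denominator : ℕ → ℕ → C) where

  record LeftSide (v : C) : Set where
    field
      {[q]∞ [ζ]∞ [η]∞ [-q]∞} : C
      q-limit      : (λ n → ⟨ q ﹔ q ⟩ n) ⟶ [q]∞
      ζ-limit      : (λ n → ⟨ ζ ﹔ q ⟩ n) ⟶ [ζ]∞
      η-limit      : (λ n → ⟨ η ﹔ q ⟩ n) ⟶ [η]∞
      -q-limit     : (λ n → ⟨ (- q) ﹔ (q ^ 2) ⟩ n) ⟶ [-q]∞
      prefactor≉0  : NonZero (([ζ]∞ * [η]∞) * [-q]∞)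
      [q]₂ₙ≉0      : ∀ k → NonZero (⟨ q ﹔ q ⟩ (2 ℕ.* suc k))
      {series}     : C
      series-sum   : HasSum (λ k →
        ((((⟨ ζ ﹔ q ⟩ (suc k)) * (⟨ η ﹔ q ⟩ (suc k))) * (⟨ (- q) ﹔ (q ^ 2) ⟩ (suc k)))
          / (⟨ q ﹔ q ⟩ (2 ℕ.* suc k)) [ [q]₂ₙ≉0 k ]) * (q ^ suc k)) series
      value        : v ≈ (([q]∞ / (([ζ]∞ * [η]∞) * [-q]∞) [ prefactor≉0 ]) * series)

  record RightSide (v : C) : Set where
    field
      {[q]∞ [ζ]∞ [η]∞} : C
      q-limit       : (λ n → ⟨ q ﹔ q ⟩ n) ⟶ [q]∞
      ζ-limit       : (λ n → ⟨ ζ ﹔ q ⟩ n) ⟶ [ζ]∞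
      η-limit       : (λ n → ⟨ η ﹔ q ⟩ n) ⟶ [η]∞
      prefactor≉0   : NonZero (([ζ]∞ * [η]∞) * [q]∞)
      denominator≉0 : ∀ k n → NonZero (denominator (suc k) n)
      {inner}       : ℕ → C
      {series}      : C
      inner-sum     : ∀ k → HasSum (λ n → numerator (suc k) n / denominator (suc k) n [ denominator≉0 k n ]) (inner k)
      series-sum    : HasSum inner series
      value         : v ≈ ((1# / (([ζ]∞ * [η]∞) * [q]∞) [ prefactor≉0 ]) * series)

-- The two sides in the notation of the theorem.

module Sides (A : CompleteNormedRing) {ρ : ℚ} (0<ρ : 0ℚ ℚ.< ρ) (ρ<1 : ρ ℚ.< 1ℚ) where

  open CompleteNormedRing A hiding (zero)
  open IntegerCoefficients commutativeRing
  open Relation.Binary.Reasoning.Setoid setoid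
  open Algebra.Properties.CommutativeSemiring.Exp commutativeSemiring
  open Analysis A 0<ρ ρ<1
  open Antidiagonals A 0<ρ ρ<1
  open SeriesIdentity A 0<ρ ρ<1

  open Algebra.Definitions.RawSemiring (Semiring.rawSemiring semiring) using (sum; product)

  sum≈sumTo : ∀ n f → sum {n} (f ∘ toℕ) ≈ sumTo f n
  sum≈sumTo zero    f = refl
  sum≈sumTo (suc n) f = trans (+-congˡ (sum≈sumTo n (f ∘ suc))) (sym (sumTo-shift f n))

  product≈prodTo : ∀ n f → product {n} (f ∘ toℕ) ≈ prodTo f n
  product≈prodTo zero    f = refl
  product≈prodTo (suc n) f = trans (*-congˡ (product≈prodTo n (f ∘ suc))) (sym (prodTo-shift f n))

  inverse-unique : ∀ z {x y} → z * x ≈ 1# → z * y ≈ 1# → x ≈ y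
  inverse-unique z {x} {y} zx≈1 zy≈1 = begin
    x               ≈⟨ *-identityʳ x ⟨
    x * 1#          ≈⟨ *-congˡ zy≈1 ⟨
    x * (z * y)     ≈⟨ solve 3 (λ x z y → x :* (z :* y) := (z :* x) :* y) refl x z y ⟩
    (z * x) * y     ≈⟨ *-congʳ zx≈1 ⟩
    1# * y          ≈⟨ *-identityˡ y ⟩
    y               ∎

  /-cong-inverse : ∀ z w {x y} → w * x ≈ 1# → w * y ≈ 1# → z * x ≈ z * y
  /-cong-inverse z w wx≈1 wy≈1 = *-congˡ (inverse-unique w wx≈1 wy≈1)

  module Values
    (NonZero : Carrier → Set) (invertible⇒nonZero : ∀ z w → z * w ≈ 1# → NonZero z)
    (_/_[_] : Carrier → (w : Carrier) → NonZero w → Carrier)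
    (/-inverse : ∀ z w w≉0 {x} → w * x ≈ 1# → z / w [ w≉0 ] ≈ z * x)
    (⟨_﹔_⟩_ : Carrier → Carrier → ℕ → Carrier)
    (poch≈prodTo : ∀ x p n → ⟨ x ﹔ p ⟩ n ≈ prodTo (λ k → 1# + - (x * p ^ k)) n)
    (_⟶_ : (ℕ → Carrier) → Carrier → Set) (⇝⇒⟶ : ∀ f L → f ⇝ L → f ⟶ L)
    (HasSum : (ℕ → Carrier) → Carrier → Set) (⇝⇒HasSum : ∀ f L → sumTo f ⇝ L → HasSum f L)
    {q t ζ η ι : Carrier} (t²≈q : t ^ 2 ≈ q) (ζη≈q : ζ * η ≈ q) (ι²≈-1 : ι * ι ≈ - 1#)
    (∣t∣≤ : ∣ t ∣≤ ρ) (∣ζ∣≤ : ∣ ζ ∣≤ ρ) (∣η∣≤ : ∣ η ∣≤ ρ) (∣ι∣≤ : ∣ ι ∣≤ 1ℚ)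
    (numerator denominator : ℕ → ℕ → Carrier)
    (numerator-def : ∀ j n → numerator j n ≈ (- 1#) ^ (j ℕ.+ 1) * ι ^ n * (1# + - ζ ^ j) * (1# + - η ^ j)
      * t ^ (j ℕ.* (j ℕ.+ 1) ℕ.+ n ℕ.* (2 ℕ.* j ℕ.+ 1)))
    (denominator-def : ∀ j n → denominator j n ≈ 1# + ι * t ^ (2 ℕ.* (j ℕ.+ n) ℕ.+ 1))
    where

    open Identity t²≈q ζη≈q ι²≈-1 ∣t∣≤ ∣ζ∣≤ ∣η∣≤ ∣ι∣≤
    open Notation _≈_ _*_ -_ 1# _^_ NonZero _/_[_] ⟨_﹔_⟩_ _⟶_ HasSum ζ η q numerator denominator

    inverse-* : ∀ {z z′ w w′} → z * z′ ≈ 1# → w * w′ ≈ 1# → (z * w) * (z′ * w′) ≈ 1#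
    inverse-* {z} {z′} {w} {w′} zz′≈1 ww′≈1 = begin
      (z * w) * (z′ * w′)     ≈⟨ solve 4 (λ z z′ w w′ → (z :* w) :* (z′ :* w′) := (z :* z′) :* (w :* w′)) refl z z′ w w′ ⟩
      (z * z′) * (w * w′)     ≈⟨ *-cong zz′≈1 ww′≈1 ⟩
      1# * 1#                 ≈⟨ *-identityˡ 1# ⟩
      1#                      ∎

    A∞ A∞⁻¹ : Carrier
    A∞   = P⁺.W∞ * P⁻.W∞
    A∞⁻¹ = P⁺.V∞ * P⁻.V∞

    A∞-inverse : A∞ * A∞⁻¹ ≈ 1#
    A∞-inverse = inverse-* P⁺.W∞-inverse P⁻.W∞-inverse

    -- The factorisation 1 + q^(2k+1) = (1 + iq^(k+½))(1 - iq^(k+½)), which splits (-q;q²)ₙ into the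
    -- two products with parameters a and b.
    odd-factor : ∀ k → 1# + - (- q * (q ^ 2) ^ k) ≈ (1# + - a k) * (1# + - b k)
    odd-factor k = begin
      1# + - (- q * (q ^ 2) ^ k)      ≈⟨ +-congˡ (-‿cong (*-congˡ (^-assocʳ q 2 k))) ⟩
      1# + - (- q * q ^ (2 ℕ.* k))    ≡⟨ ≡.cong (λ e → 1# + - (- q * q ^ (k ℕ.+ e))) (ℕ.+-identityʳ k) ⟩
      1# + - (- q * q ^ (k ℕ.+ k))    ≈⟨ solve 2 (λ q x → :1 :+ :- (:- q :* x) := :1 :+ q :* x) refl q (q ^ (k ℕ.+ k)) ⟩
      1# + q ^ suc (k ℕ.+ k)          ≈⟨ +-congˡ (a*b k k) ⟨
      1# + a k * b k                  ≈⟨ solve 1 (λ b → :1 :+ :- b :* b := (:1 :+ :- (:- b)) :* (:1 :+ :- b)) refl (b k) ⟩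
      (1# + - a k) * (1# + - b k)     ∎

    odd-product : ∀ n → prodTo (λ k → 1# + - (- q * (q ^ 2) ^ k)) n ≈ P⁺.W n * P⁻.W n
    odd-product zero    = sym (*-identityˡ 1#)
    odd-product (suc n) = trans (*-cong (odd-product n) (odd-factor n))
      (solve 4 (λ x y u v → (x :* y) :* (u :* v) := (x :* u) :* (y :* v)) refl (P⁺.W n) (P⁻.W n) (1# + - a n) (1# + - b n))

    left-prefactor⁻¹ right-prefactor⁻¹ : Carrier
    left-prefactor⁻¹  = Z.V∞ * H.V∞ * A∞⁻¹
    right-prefactor⁻¹ = Z.V∞ * H.V∞ * Q.V∞

    left-prefactor-inverse : (Z.W∞ * H.W∞ * A∞) * left-prefactor⁻¹ ≈ 1#
    left-prefactor-inverse = inverse-* (inverse-* Z.W∞-inverse H.W∞-inverse) A∞-inverse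

    right-prefactor-inverse : (Z.W∞ * H.W∞ * Q.W∞) * right-prefactor⁻¹ ≈ 1#
    right-prefactor-inverse = inverse-* (inverse-* Z.W∞-inverse H.W∞-inverse) Q.W∞-inverse

    -- The factor q^j raises the exponent j(j - 1)/2 of q to j(j + 1)/2; as a power of t it becomes
    -- j(j + 1), with no halving.
    s-power : ∀ j → QSeries.s q Q j * q ^ j ≈ (- 1#) ^ j * t ^ (j ℕ.* (j ℕ.+ 1))
    s-power zero    = refl
    s-power (suc j) = begin
      - (q ^ j * s) * q ^ suc j
        ≈⟨ solve 3 (λ p s r → :- (p :* s) :* r := :- :1 :* (s :* p) :* r) refl (q ^ j) s (q ^ suc j) ⟩
      - 1# * (s * q ^ j) * q ^ suc j
        ≈⟨ *-cong (*-congˡ (s-power j)) (q^≈t^ (suc j)) ⟩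
      - 1# * ((- 1#) ^ j * t ^ (j ℕ.* (j ℕ.+ 1))) * t ^ (2 ℕ.* suc j)
        ≈⟨ solve 4 (λ m x y z → m :* (x :* y) :* z := m :* x :* (y :* z)) refl (- 1#) ((- 1#) ^ j) (t ^ (j ℕ.* (j ℕ.+ 1))) (t ^ (2 ℕ.* suc j)) ⟩
      (- 1#) ^ suc j * (t ^ (j ℕ.* (j ℕ.+ 1)) * t ^ (2 ℕ.* suc j))
        ≈⟨ *-congˡ (^-homo-* t (j ℕ.* (j ℕ.+ 1)) (2 ℕ.* suc j)) ⟨
      (- 1#) ^ suc j * t ^ (j ℕ.* (j ℕ.+ 1) ℕ.+ 2 ℕ.* suc j)
        ≡⟨ ≡.cong (λ e → (- 1#) ^ suc j * t ^ e) (exponent j) ⟩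
      (- 1#) ^ suc j * t ^ (suc j ℕ.* (suc j ℕ.+ 1)) ∎
      where
      s = QSeries.s q Q j
      exponent : ∀ j → j ℕ.* (j ℕ.+ 1) ℕ.+ 2 ℕ.* suc j ≡ suc j ℕ.* (suc j ℕ.+ 1)
      exponent = ℕS.solve 1 (λ j → j ℕS.:* (j ℕS.:+ ℕS.con 1) ℕS.:+ ℕS.con 2 ℕS.:* (ℕS.con 1 ℕS.:+ j)
                   ℕS.:= (ℕS.con 1 ℕS.:+ j) ℕS.:* ((ℕS.con 1 ℕS.:+ j) ℕS.:+ ℕS.con 1)) ≡.refl

    b^ : ∀ j n → b j ^ n ≈ ι ^ n * t ^ (n ℕ.* odd j)
    b^ j n = begin
      (ι * t ^ odd j) ^ n           ≈⟨ ^-distrib-* ι (t ^ odd j) n ⟩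
      ι ^ n * (t ^ odd j) ^ n       ≈⟨ *-congˡ (^-assocʳ t (odd j) n) ⟩
      ι ^ n * t ^ (odd j ℕ.* n)     ≡⟨ ≡.cong (λ e → ι ^ n * t ^ e) (ℕ.*-comm (odd j) n) ⟩
      ι ^ n * t ^ (n ℕ.* odd j)     ∎

    numerator-≈ : ∀ j n → numerator j n ≈ C j * q ^ j * b j ^ n
    numerator-≈ j n = begin
      numerator j n
        ≈⟨ numerator-def j n ⟩
      (- 1#) ^ (j ℕ.+ 1) * ι ^ n * z * e * t ^ (j ℕ.* (j ℕ.+ 1) ℕ.+ n ℕ.* odd j)
        ≈⟨ *-cong (*-congʳ (*-congʳ (*-congʳ (^-homo-* (- 1#) j 1)))) (^-homo-* t (j ℕ.* (j ℕ.+ 1)) (n ℕ.* odd j)) ⟩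
      (- 1#) ^ j * (- 1# * 1#) * ι ^ n * z * e * (t ^ (j ℕ.* (j ℕ.+ 1)) * t ^ (n ℕ.* odd j))
        ≈⟨ solve 6 (λ m i z e x y → m :* (:- :1 :* :1) :* i :* z :* e :* (x :* y) := (m :* x) :* :- (z :* e) :* (i :* y)) refl
             ((- 1#) ^ j) (ι ^ n) z e (t ^ (j ℕ.* (j ℕ.+ 1))) (t ^ (n ℕ.* odd j)) ⟩
      ((- 1#) ^ j * t ^ (j ℕ.* (j ℕ.+ 1))) * - (z * e) * (ι ^ n * t ^ (n ℕ.* odd j))
        ≈⟨ *-cong (*-congʳ (s-power j)) (b^ j n) ⟨
      (s * q ^ j) * - (z * e) * b j ^ n
        ≈⟨ solve 4 (λ s p w b → (s :* p) :* w :* b := s :* w :* p :* b) refl s (q ^ j) (- (z * e)) (b j ^ n) ⟩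
      C j * q ^ j * b j ^ n ∎
      where
      s = QSeries.s q Q j
      z = 1# + - ζ ^ j
      e = 1# + - η ^ j

    pochhammer-limit : ∀ {x p L f} → (∀ n → prodTo (λ k → 1# + - (x * p ^ k)) n ≈ f n) → f ⇝ L → (λ n → ⟨ x ﹔ p ⟩ n) ⟶ L
    pochhammer-limit {x} {p} eq lim = ⇝⇒⟶ _ _ (⇝-cong (λ n → sym (trans (poch≈prodTo x p n) (eq n))) refl lim)

    hasSum : ∀ {f g L} → (∀ k → f k ≈ g k) → sumTo g ⇝ L → HasSum f L
    hasSum f≈g lim = ⇝⇒HasSum _ _ (⇝-cong (sumTo-cong λ k → sym (f≈g k)) refl lim)

    q-product-inverse : ∀ n → ⟨ q ﹔ q ⟩ (2 ℕ.* n) * Q.V (n ℕ.+ n) ≈ 1#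
    q-product-inverse n = begin
      ⟨ q ﹔ q ⟩ (2 ℕ.* n) * Q.V (n ℕ.+ n)   ≈⟨ *-congʳ (poch≈prodTo q q (2 ℕ.* n)) ⟩
      Q.W (2 ℕ.* n) * Q.V (n ℕ.+ n)          ≡⟨ ≡.cong (λ e → Q.W (n ℕ.+ e) * Q.V (n ℕ.+ n)) (ℕ.+-identityʳ n) ⟩
      Q.W (n ℕ.+ n) * Q.V (n ℕ.+ n)          ≈⟨ Q.W-inverse (n ℕ.+ n) ⟩
      1#                                     ∎

    denominator-inverse : ∀ j n → denominator j n * P⁺.v (j ℕ.+ n) ≈ 1#
    denominator-inverse j n = trans
      (*-congʳ (trans (denominator-def j n) (solve 1 (λ b → :1 :+ b := :1 :+ :- (:- b)) refl (b (j ℕ.+ n)))))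
      (P⁺.v-inverse (j ℕ.+ n))

    value : Carrier
    value = Q.W∞ * left-prefactor⁻¹ * S

    leftSide : LeftSide value
    leftSide = record
      { q-limit     = pochhammer-limit (λ _ → refl) Q.W⇝
      ; ζ-limit     = pochhammer-limit (λ _ → refl) Z.W⇝
      ; η-limit     = pochhammer-limit (λ _ → refl) H.W⇝
      ; -q-limit    = pochhammer-limit odd-product (⇝-* P⁺.W⇝ P⁻.W⇝)
      ; prefactor≉0 = invertible⇒nonZero _ _ left-prefactor-inverse
      ; [q]₂ₙ≉0     = λ k → invertible⇒nonZero _ _ (q-product-inverse (suc k))
      ; series-sum  = hasSum
          (λ k → let n = suc k in *-congʳ (trans (/-inverse _ _ _ (q-product-inverse n)) (*-congʳ
            (*-cong (*-cong (poch≈prodTo ζ q n) (poch≈prodTo η q n)) (trans (poch≈prodTo (- q) (q ^ 2) n) (odd-product n))))))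
          left-sum
      ; value       = *-congʳ (sym (/-inverse _ _ _ left-prefactor-inverse))
      }

    -- The two prefactors differ exactly by `κ`: with A = (-q;q²)∞, (q)∞/A is 1/(q)∞ times (q)∞²/A.
    value-≈ : value ≈ 1# * right-prefactor⁻¹ * (κ * S)
    value-≈ = begin
      Q.W∞ * (Z.V∞ * H.V∞ * A∞⁻¹) * S
        ≈⟨ *-identityˡ _ ⟨
      1# * (Q.W∞ * (Z.V∞ * H.V∞ * A∞⁻¹) * S)
        ≈⟨ *-congʳ Q.W∞-inverse ⟨
      (Q.W∞ * Q.V∞) * (Q.W∞ * (Z.V∞ * H.V∞ * A∞⁻¹) * S)
        ≈⟨ solve 6 (λ w v z h a s → (w :* v) :* (w :* (z :* h :* a) :* s) := :1 :* (z :* h :* v) :* (w :* w :* a :* s)) refl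
             Q.W∞ Q.V∞ Z.V∞ H.V∞ A∞⁻¹ S ⟩
      1# * right-prefactor⁻¹ * (κ * S) ∎

    rightSide : RightSide value
    rightSide = record
      { q-limit       = pochhammer-limit (λ _ → refl) Q.W⇝
      ; ζ-limit       = pochhammer-limit (λ _ → refl) Z.W⇝
      ; η-limit       = pochhammer-limit (λ _ → refl) H.W⇝
      ; prefactor≉0   = invertible⇒nonZero _ _ right-prefactor-inverse
      ; denominator≉0 = λ k n → invertible⇒nonZero _ _ (denominator-inverse (suc k) n)
      ; inner-sum     = λ k → hasSum
          (λ n → trans (/-inverse _ _ _ (denominator-inverse (suc k) n)) (trans (*-congʳ (numerator-≈ (suc k) n)) (*-assoc _ _ _)))
          (inner-sum (suc k))
      ; series-sum    = ⇝⇒HasSum _ _ outer-sum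
      ; value         = trans value-≈ (*-congʳ (sym (/-inverse _ _ _ right-prefactor-inverse)))
      }

    abstract
      two-sides : ∃[ v ] (LeftSide v × RightSide v)
      two-sides = value , leftSide , rightSide

-- The complex numbers as a normed ring.

open import Defs
open RationalEstimates
open RationalDiscs
open ℚ-Solver using (solve; _:=_; _:+_; _:*_; :-_; _:-_; con)

Eventually : (ℕ → Set) → Set
Eventually P = ∃[ N ] (∀ n → N ℕ.≤ n → P n)

ev-map : ∀ {P Q : ℕ → Set} → (∀ n → P n → Q n) → Eventually P → Eventually Q
ev-map f (N , p) = N , λ n N≤n → f n (p n N≤n)

ev-zip : ∀ {P Q R : ℕ → Set} → (∀ n → P n → Q n → R n) → Eventually P → Eventually Q → Eventually R
ev-zip f (M , p) (N , q) = M ℕ.⊔ N , λ n l → f n (p n (ℕ.m⊔n≤o⇒m≤o M N l)) (q n (ℕ.m⊔n≤o⇒n≤o M N l))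

½*-double : ∀ ε → ½ ℚ.* ε ℚ.+ ½ ℚ.* ε ≡ ε
½*-double = solve 1 (λ e → con ½ :* e :+ con ½ :* e := e) ≡.refl

½*-< : ∀ {ε} → 0ℚ ℚ.< ε → ½ ℚ.* ε ℚ.< ε
½*-< {ε} 0<ε = ≡.subst₂ ℚ._<_ (ℚ.+-identityʳ (½ ℚ.* ε)) (½*-double ε) (ℚ.+-monoʳ-< (½ ℚ.* ε) (0<½* 0<ε))

infix 4 _∈[_]_
_∈[_]_ : ℂ → ℕ → ℚ → Set
z ∈[ n ] B = ⟪ seq (re z) n , seq (im z) n ⟫∈ B

infix 4 ∣_∣≤_
-- The slack ε makes the bound a property of the number and not of its approximations: a sequence
-- may approach a point of the circle of radius `B` from outside.
record ∣_∣≤_ (z : ℂ) (B : ℚ) : Set where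
  constructor bounded-by
  field
    radius≥0 : 0ℚ ℚ.≤ B
    within   : ∀ ε → 0ℚ ℚ.< ε → Eventually (λ n → z ∈[ n ] B ℚ.+ ε)
open ∣_∣≤_

norm-pointwise : ∀ {z w B} → (∀ n → seq (re z) n ≡ seq (re w) n) → (∀ n → seq (im z) n ≡ seq (im w) n) →
  ∣ z ∣≤ B → ∣ w ∣≤ B
norm-pointwise {z} {w} re≡ im≡ (bounded-by 0≤B b) = bounded-by 0≤B λ ε 0<ε →
  ev-map (λ n → disc-≡ (re≡ n) (im≡ n)) (b ε 0<ε)

norm-weaken : ∀ {z B C} → B ℚ.≤ C → ∣ z ∣≤ B → ∣ z ∣≤ C
norm-weaken {z} B≤C (bounded-by 0≤B b) = bounded-by (ℚ.≤-trans 0≤B B≤C) λ ε 0<ε →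
  ev-map (λ n → disc-weaken {seq (re z) n} (ℚ.+-monoˡ-≤ ε B≤C)) (b ε 0<ε)

norm-+ : ∀ {z w B C} → ∣ z ∣≤ B → ∣ w ∣≤ C → ∣ z + w ∣≤ B ℚ.+ C
norm-+ {z} {w} {B} {C} (bounded-by 0≤B b) (bounded-by 0≤C c) = bounded-by (0≤+ 0≤B 0≤C) λ ε 0<ε →
  ev-zip (λ n zn wn → disc-radius (eq ε) (disc-+ {seq (re z) n} {seq (im z) n} zn wn))
    (b _ (0<½* 0<ε)) (c _ (0<½* 0<ε))
  where
  eq : ∀ ε → B ℚ.+ ½ ℚ.* ε ℚ.+ (C ℚ.+ ½ ℚ.* ε) ≡ B ℚ.+ C ℚ.+ ε
  eq = solve 3 (λ B C e → B :+ con ½ :* e :+ (C :+ con ½ :* e) := B :+ C :+ e) ≡.refl B C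

norm-neg : ∀ {z B} → ∣ z ∣≤ B → ∣ - z ∣≤ B
norm-neg {z} (bounded-by 0≤B b) = bounded-by 0≤B λ ε 0<ε →
  ev-map (λ n → disc-neg {seq (re z) n}) (b ε 0<ε)

norm-* : ∀ {z w B C} → ∣ z ∣≤ B → ∣ w ∣≤ C → ∣ z * w ∣≤ B ℚ.* C
norm-* {z} {w} {B} {C} (bounded-by 0≤B b) (bounded-by 0≤C c) = bounded-by (0≤* 0≤B 0≤C) λ ε 0<ε →
  let K = B ℚ.+ C ℚ.+ 1ℚ
      0≤B+C = 0≤+ 0≤B 0≤C
      δ′ , 0<δ′ , Kδ′≡ε = split K ε (ℚ.+-mono-≤-< 0≤B+C (ℚ.positive⁻¹ 1ℚ)) 0<ε
      -- With δ ≤ 1 the product (B + δ)(C + δ) is at most BC + (B + C + 1)δ, and δ ≤ δ′ makes the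
      -- last term at most ε.
      δ = δ′ ℚ.⊓ 1ℚ
      0<δ : 0ℚ ℚ.< δ
      0<δ = 0<⊓ 0<δ′ (ℚ.positive⁻¹ 1ℚ)
      0≤δ = ℚ.<⇒≤ 0<δ
      bound : (B ℚ.+ δ) ℚ.* (C ℚ.+ δ) ℚ.≤ B ℚ.* C ℚ.+ ε
      bound = ℚ.≤-trans
        (≤-by (δ ℚ.* (1ℚ ℚ.- δ)) (0≤* 0≤δ (≤⇒0≤- (ℚ.p⊓q≤q δ′ 1ℚ)))
          (solve 3 (λ B C d → (B :+ d) :* (C :+ d) :+ d :* (con 1ℚ :- d)
             := B :* C :+ (B :+ C :+ con 1ℚ) :* d) ≡.refl B C δ))
        (ℚ.+-monoʳ-≤ (B ℚ.* C) (≡.subst (K ℚ.* δ ℚ.≤_) Kδ′≡ε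
          (*-monoʳ K (0≤+ 0≤B+C 0≤1) (ℚ.p⊓q≤p δ′ 1ℚ))))
  in ev-zip (λ n zn wn → disc-weaken {seq (re (z * w)) n} bound
       (disc-* {seq (re z) n} {seq (im z) n} zn wn)) (b δ 0<δ) (c δ 0<δ)

≈⇒norm : ∀ {z w} → z ≈ w → ∣ z - w ∣≤ 0ℚ
≈⇒norm {z} {w} (re≈ , im≈) = bounded-by ℚ.≤-refl λ ε 0<ε →
  ev-zip (λ n r i → disc-radius (≡.trans (½*-double ε) (≡.sym (ℚ.+-identityˡ ε)))
            (disc-abs {seq (re (z - w)) n} {seq (im (z - w)) n} (ℚ.<⇒≤ r) (ℚ.<⇒≤ i)))
    (re≈ _ (0<½* 0<ε)) (im≈ _ (0<½* 0<ε))

-- Together with `≈⇒norm` this turns equality into a zero bound on the difference, so each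
-- congruence law below follows from the norm laws and a rational identity.
norm⇒≈ : ∀ {z w} → ∣ z - w ∣≤ 0ℚ → z ≈ w
norm⇒≈ {z} {w} (bounded-by _ b) =
  (λ ε 0<ε → ev-map (λ n d → below 0<ε (disc-abs₁ {seq (re (z - w)) n} d)) (b _ (0<½* 0<ε))) ,
  (λ ε 0<ε → ev-map (λ n d → below 0<ε (disc-abs₁ (disc-swap {seq (re (z - w)) n} d))) (b _ (0<½* 0<ε)))
  where
  below : ∀ {x ε} → 0ℚ ℚ.< ε → x ℚ.≤ 0ℚ ℚ.+ ½ ℚ.* ε → x ℚ.< ε
  below {x} {ε} 0<ε x≤ = ℚ.≤-<-trans x≤ (≡.subst (ℚ._< ε) (≡.sym (ℚ.+-identityˡ _)) (½*-< 0<ε))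

norm-0 : ∣ 0# ∣≤ 0ℚ
norm-0 = bounded-by ℚ.≤-refl λ ε 0<ε → 0 , λ n _ →
  disc-weaken {0ℚ} {0ℚ} (ℚ.≤-trans (ℚ.<⇒≤ 0<ε) (ℚ.≤-reflexive (≡.sym (ℚ.+-identityˡ ε)))) (disc ℚ.≤-refl ℚ.≤-refl)

norm-1 : ∣ 1# ∣≤ 1ℚ
norm-1 = bounded-by 0≤1 λ ε 0<ε → 0 , λ n _ →
  disc-weaken {1ℚ} {0ℚ} (ℚ.≤-trans (ℚ.≤-reflexive (≡.sym (ℚ.+-identityʳ 1ℚ))) (ℚ.+-monoʳ-≤ 1ℚ (ℚ.<⇒≤ 0<ε))) (disc 0≤1 ℚ.≤-refl)

norm-i : ∣ i ∣≤ 1ℚ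
norm-i = bounded-by 0≤1 λ ε 0<ε → 0 , λ n _ →
  disc-weaken {0ℚ} {1ℚ} (ℚ.≤-trans (ℚ.≤-reflexive (≡.sym (ℚ.+-identityʳ 1ℚ))) (ℚ.+-monoʳ-≤ 1ℚ (ℚ.<⇒≤ 0<ε))) (disc 0≤1 ℚ.≤-refl)

pointwise : ∀ {z w} → (∀ n → seq (re z) n ≡ seq (re w) n) → (∀ n → seq (im z) n ≡ seq (im w) n) → z ≈ w
pointwise {z} {w} re≡ im≡ = norm⇒≈ {z} {w} (norm-pointwise
  (λ n → ≡.trans (≡.sym (ℚ.+-inverseʳ (seq (re z) n))) (≡.cong (λ x → seq (re z) n ℚ.- x) (re≡ n)))
  (λ n → ≡.trans (≡.sym (ℚ.+-inverseʳ (seq (im z) n))) (≡.cong (λ x → seq (im z) n ℚ.- x) (im≡ n)))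
  norm-0)

norm-cong : ∀ {z w B} → z ≈ w → ∣ z ∣≤ B → ∣ w ∣≤ B
norm-cong {z} {w} {B} z≈w ∣z∣≤B = norm-pointwise
  (λ n → cancel (seq (re z) n) (seq (re w) n)) (λ n → cancel (seq (im z) n) (seq (im w) n))
  (norm-weaken (ℚ.≤-reflexive (ℚ.+-identityʳ B)) (norm-+ ∣z∣≤B (norm-neg (≈⇒norm {z} {w} z≈w))))
  where
  cancel : ∀ a b → a ℚ.+ ℚ.- (a ℚ.+ ℚ.- b) ≡ b
  cancel = solve 2 (λ a b → a :+ :- (a :+ :- b) := b) ≡.refl

norm-finite : ∀ z → ∃[ B ] ∣ z ∣≤ B
norm-finite z =
  let B , 0<B , re≤ = eventually-bounded _ (cauchy (re z))
      C , 0<C , im≤ = eventually-bounded _ (cauchy (im z))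
  in B ℚ.+ C , bounded-by (0≤+ (ℚ.<⇒≤ 0<B) (ℚ.<⇒≤ 0<C)) λ ε 0<ε →
     ev-zip (λ n r i → disc-weaken {seq (re z) n} (≤-by ε (ℚ.<⇒≤ 0<ε) ≡.refl)
        (disc-abs {seq (re z) n} {seq (im z) n} r i)) re≤ im≤

norm-separated : ∀ {z} → (∀ ε → 0ℚ ℚ.< ε → ∣ z ∣≤ ε) → z ≈ 0#
norm-separated {z} small = norm⇒≈ {z} {0#} (norm-pointwise {z}
  (λ n → ≡.sym (ℚ.+-identityʳ _)) (λ n → ≡.sym (ℚ.+-identityʳ _))
  (bounded-by {z} ℚ.≤-refl λ ε 0<ε → ev-map
    (λ n → disc-radius (≡.trans (½*-double ε) (≡.sym (ℚ.+-identityˡ ε))))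
    (within (small _ (0<½* 0<ε)) _ (0<½* 0<ε))))

≈-refl : ∀ {z} → z ≈ z
≈-refl {z} = pointwise {z} {z} (λ _ → ≡.refl) (λ _ → ≡.refl)

≈-sym : ∀ {z w} → z ≈ w → w ≈ z
≈-sym {z} {w} z≈w = norm⇒≈ {w} {z} (norm-pointwise
  (λ n → flip (seq (re z) n) (seq (re w) n)) (λ n → flip (seq (im z) n) (seq (im w) n)) (norm-neg (≈⇒norm {z} {w} z≈w)))
  where
  flip : ∀ a b → ℚ.- (a ℚ.+ ℚ.- b) ≡ b ℚ.+ ℚ.- a
  flip = solve 2 (λ a b → :- (a :+ :- b) := b :+ :- a) ≡.refl

≈-trans : ∀ {z w u} → z ≈ w → w ≈ u → z ≈ u
≈-trans {z} {w} {u} z≈w w≈u = norm⇒≈ {z} {u} (norm-pointwise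
  (λ n → join (seq (re z) n) (seq (re w) n) (seq (re u) n))
  (λ n → join (seq (im z) n) (seq (im w) n) (seq (im u) n))
  (norm-+ (≈⇒norm {z} {w} z≈w) (≈⇒norm {w} {u} w≈u)))
  where
  join : ∀ a b c → (a ℚ.+ ℚ.- b) ℚ.+ (b ℚ.+ ℚ.- c) ≡ a ℚ.+ ℚ.- c
  join = solve 3 (λ a b c → (a :+ :- b) :+ (b :+ :- c) := a :+ :- c) ≡.refl

+-cong : ∀ {z w u v} → z ≈ w → u ≈ v → z + u ≈ w + v
+-cong {z} {w} {u} {v} z≈w u≈v = norm⇒≈ {z + u} {w + v} (norm-pointwise
  (λ n → ex (seq (re z) n) (seq (re w) n) (seq (re u) n) (seq (re v) n))
  (λ n → ex (seq (im z) n) (seq (im w) n) (seq (im u) n) (seq (im v) n))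
  (norm-+ (≈⇒norm {z} {w} z≈w) (≈⇒norm {u} {v} u≈v)))
  where
  ex : ∀ a b c d → (a ℚ.+ ℚ.- b) ℚ.+ (c ℚ.+ ℚ.- d) ≡ (a ℚ.+ c) ℚ.+ ℚ.- (b ℚ.+ d)
  ex = solve 4 (λ a b c d → (a :+ :- b) :+ (c :+ :- d) := (a :+ c) :+ :- (b :+ d)) ≡.refl

-‿cong : ∀ {z w} → z ≈ w → - z ≈ - w
-‿cong {z} {w} z≈w = norm⇒≈ { - z} { - w} (norm-pointwise
  (λ n → ex (seq (re z) n) (seq (re w) n)) (λ n → ex (seq (im z) n) (seq (im w) n))
  (norm-neg (≈⇒norm {z} {w} z≈w)))
  where
  ex : ∀ a b → ℚ.- (a ℚ.+ ℚ.- b) ≡ (ℚ.- a) ℚ.+ ℚ.- (ℚ.- b)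
  ex = solve 2 (λ a b → :- (a :+ :- b) := :- a :+ :- (:- b)) ≡.refl

*-cong : ∀ {z w u v} → z ≈ w → u ≈ v → z * u ≈ w * v
*-cong {z} {w} {u} {v} z≈w u≈v =
  let B , ∣z∣≤B = norm-finite z
      C , ∣v∣≤C = norm-finite v
  in norm⇒≈ {z * u} {w * v} (norm-pointwise
    (λ n → ex-re (seq (re z) n) (seq (im z) n) (seq (re w) n) (seq (im w) n)
                 (seq (re u) n) (seq (im u) n) (seq (re v) n) (seq (im v) n))
    (λ n → ex-im (seq (re z) n) (seq (im z) n) (seq (re w) n) (seq (im w) n)
                 (seq (re u) n) (seq (im u) n) (seq (re v) n) (seq (im v) n))
    (norm-weaken (ℚ.≤-reflexive (vanish B C))
      (norm-+ (norm-* ∣z∣≤B (≈⇒norm {u} {v} u≈v)) (norm-* (≈⇒norm {z} {w} z≈w) ∣v∣≤C))))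
  where
  vanish : ∀ B C → B ℚ.* 0ℚ ℚ.+ 0ℚ ℚ.* C ≡ 0ℚ
  vanish = solve 2 (λ B C → B :* con 0ℚ :+ con 0ℚ :* C := con 0ℚ) ≡.refl
  ex-re : ∀ a a′ b b′ c c′ d d′ →
    a ℚ.* (c ℚ.+ ℚ.- d) ℚ.+ ℚ.- (a′ ℚ.* (c′ ℚ.+ ℚ.- d′)) ℚ.+ ((a ℚ.+ ℚ.- b) ℚ.* d ℚ.+ ℚ.- ((a′ ℚ.+ ℚ.- b′) ℚ.* d′))
      ≡ a ℚ.* c ℚ.+ ℚ.- (a′ ℚ.* c′) ℚ.+ ℚ.- (b ℚ.* d ℚ.+ ℚ.- (b′ ℚ.* d′))
  ex-re = solve 8 (λ a a′ b b′ c c′ d d′ →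
    a :* (c :+ :- d) :+ :- (a′ :* (c′ :+ :- d′)) :+ ((a :+ :- b) :* d :+ :- ((a′ :+ :- b′) :* d′))
      := a :* c :+ :- (a′ :* c′) :+ :- (b :* d :+ :- (b′ :* d′))) ≡.refl
  ex-im : ∀ a a′ b b′ c c′ d d′ →
    a ℚ.* (c′ ℚ.+ ℚ.- d′) ℚ.+ a′ ℚ.* (c ℚ.+ ℚ.- d) ℚ.+ ((a ℚ.+ ℚ.- b) ℚ.* d′ ℚ.+ (a′ ℚ.+ ℚ.- b′) ℚ.* d)
      ≡ a ℚ.* c′ ℚ.+ a′ ℚ.* c ℚ.+ ℚ.- (b ℚ.* d′ ℚ.+ b′ ℚ.* d)
  ex-im = solve 8 (λ a a′ b b′ c c′ d d′ →
    a :* (c′ :+ :- d′) :+ a′ :* (c :+ :- d) :+ ((a :+ :- b) :* d′ :+ (a′ :+ :- b′) :* d)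
      := a :* c′ :+ a′ :* c :+ :- (b :* d′ :+ b′ :* d)) ≡.refl

ℂ-commutativeRing : CommutativeRing 0ℓ 0ℓ
ℂ-commutativeRing = record
  { Carrier = ℂ ; _≈_ = _≈_ ; _+_ = _+_ ; _*_ = _*_ ; -_ = -_ ; 0# = 0# ; 1# = 1#
  ; isCommutativeRing = record
    { isRing = record
      { +-isAbelianGroup = record
        { isGroup = record
          { isMonoid = record
            { isSemigroup = record
              { isMagma = record
                { isEquivalence = record { refl = λ {z} → ≈-refl {z} ; sym = λ {z} {w} → ≈-sym {z} {w} ; trans = λ {z} {w} {u} → ≈-trans {z} {w} {u} }
                ; ∙-cong = λ {z} {w} {u} {v} → +-cong {z} {w} {u} {v} }
              ; assoc = λ z w u → pointwise {(z + w) + u} {z + (w + u)}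
                  (λ n → ℚ.+-assoc (seq (re z) n) (seq (re w) n) (seq (re u) n))
                  (λ n → ℚ.+-assoc (seq (im z) n) (seq (im w) n) (seq (im u) n)) }
            ; identity =
                (λ z → pointwise {0# + z} {z} (λ n → ℚ.+-identityˡ (seq (re z) n)) (λ n → ℚ.+-identityˡ (seq (im z) n))) ,
                (λ z → pointwise {z + 0#} {z} (λ n → ℚ.+-identityʳ (seq (re z) n)) (λ n → ℚ.+-identityʳ (seq (im z) n))) }
          ; inverse =
              (λ z → pointwise { - z + z} {0#} (λ n → ℚ.+-inverseˡ (seq (re z) n)) (λ n → ℚ.+-inverseˡ (seq (im z) n))) ,
              (λ z → pointwise {z + - z} {0#} (λ n → ℚ.+-inverseʳ (seq (re z) n)) (λ n → ℚ.+-inverseʳ (seq (im z) n)))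
          ; ⁻¹-cong = λ {z} {w} → -‿cong {z} {w} }
        ; comm = λ z w → pointwise {z + w} {w + z}
            (λ n → ℚ.+-comm (seq (re z) n) (seq (re w) n)) (λ n → ℚ.+-comm (seq (im z) n) (seq (im w) n)) }
      ; *-cong = λ {z} {w} {u} {v} → *-cong {z} {w} {u} {v}
      ; *-assoc = λ z w u → pointwise {(z * w) * u} {z * (w * u)}
          (λ n → solve 6 (λ a b c d e f →
             (a :* c :+ :- (b :* d)) :* e :+ :- ((a :* d :+ b :* c) :* f)
               := a :* (c :* e :+ :- (d :* f)) :+ :- (b :* (c :* f :+ d :* e))) ≡.refl
             (seq (re z) n) (seq (im z) n) (seq (re w) n) (seq (im w) n) (seq (re u) n) (seq (im u) n))
          (λ n → solve 6 (λ a b c d e f →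
             (a :* c :+ :- (b :* d)) :* f :+ (a :* d :+ b :* c) :* e
               := a :* (c :* f :+ d :* e) :+ b :* (c :* e :+ :- (d :* f))) ≡.refl
             (seq (re z) n) (seq (im z) n) (seq (re w) n) (seq (im w) n) (seq (re u) n) (seq (im u) n))
      ; *-identity = *-identityˡ , λ z → ≈-trans {z * 1#} {1# * z} {z} (*-comm z 1#) (*-identityˡ z)
      ; distrib = *-distribˡ-+ , λ z w u →
          ≈-trans {(w + u) * z} {z * (w + u)} {w * z + u * z} (*-comm (w + u) z)
            (≈-trans {z * (w + u)} {z * w + z * u} {w * z + u * z} (*-distribˡ-+ z w u)
              (+-cong {z * w} {w * z} {z * u} {u * z} (*-comm z w) (*-comm z u))) }
    ; *-comm = *-comm } }
  where
  *-comm : ∀ z w → z * w ≈ w * z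
  *-comm z w = pointwise {z * w} {w * z}
    (λ n → solve 4 (λ a b c d → a :* c :+ :- (b :* d) := c :* a :+ :- (d :* b)) ≡.refl
      (seq (re z) n) (seq (im z) n) (seq (re w) n) (seq (im w) n))
    (λ n → solve 4 (λ a b c d → a :* d :+ b :* c := c :* b :+ d :* a) ≡.refl
      (seq (re z) n) (seq (im z) n) (seq (re w) n) (seq (im w) n))
  *-identityˡ : ∀ z → 1# * z ≈ z
  *-identityˡ z = pointwise {1# * z} {z}
    (λ n → solve 2 (λ a b → con 1ℚ :* a :+ :- (con 0ℚ :* b) := a) ≡.refl (seq (re z) n) (seq (im z) n))
    (λ n → solve 2 (λ a b → con 1ℚ :* b :+ con 0ℚ :* a := b) ≡.refl (seq (re z) n) (seq (im z) n))
  *-distribˡ-+ : ∀ z w u → z * (w + u) ≈ z * w + z * u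
  *-distribˡ-+ z w u = pointwise {z * (w + u)} {z * w + z * u}
    (λ n → solve 6 (λ a b c d e f →
       a :* (c :+ e) :+ :- (b :* (d :+ f)) := (a :* c :+ :- (b :* d)) :+ (a :* e :+ :- (b :* f))) ≡.refl
       (seq (re z) n) (seq (im z) n) (seq (re w) n) (seq (im w) n) (seq (re u) n) (seq (im u) n))
    (λ n → solve 6 (λ a b c d e f →
       a :* (d :+ f) :+ b :* (c :+ e) := (a :* d :+ b :* c) :+ (a :* f :+ b :* e)) ≡.refl
       (seq (re z) n) (seq (im z) n) (seq (re w) n) (seq (im w) n) (seq (re u) n) (seq (im u) n))

-- Completeness for geometrically convergent sequences.

infixl 20 _﹫_
_﹫_ : ℂ → ℕ → ℚ × ℚ
z ﹫ n = seq (re z) n , seq (im z) n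

-- Compares rational approximations taken at different indices, which `∣_∣≤_` cannot do.
record Near (B : ℚ) (x y : ℚ × ℚ) : Set where
  constructor near
  field
    difference : ⟪ proj₁ x ℚ.+ ℚ.- proj₁ y , proj₂ x ℚ.+ ℚ.- proj₂ y ⟫∈ B
open Near

near-join : ∀ {x y z B C} → Near B x y → Near C y z → Near (B ℚ.+ C) x z
near-join {x} {y} {z} (near d) (near e) = near (disc-≡
  (eq (proj₁ x) (proj₁ y) (proj₁ z)) (eq (proj₂ x) (proj₂ y) (proj₂ z)) (disc-+ d e))
  where
  eq : ∀ a b c → (a ℚ.+ ℚ.- b) ℚ.+ (b ℚ.+ ℚ.- c) ≡ a ℚ.+ ℚ.- c
  eq = solve 3 (λ a b c → (a :+ :- b) :+ (b :+ :- c) := a :+ :- c) ≡.refl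

near-flip : ∀ {x y B} → Near B x y → Near B y x
near-flip {x} {y} (near d) = near (disc-≡ (eq (proj₁ x) (proj₁ y)) (eq (proj₂ x) (proj₂ y)) (disc-neg d))
  where
  eq : ∀ a b → ℚ.- (a ℚ.+ ℚ.- b) ≡ b ℚ.+ ℚ.- a
  eq = solve 2 (λ a b → :- (a :+ :- b) := b :+ :- a) ≡.refl

near-weaken : ∀ {x y B C} → B ℚ.≤ C → Near B x y → Near C x y
near-weaken B≤C (near d) = near (disc-weaken B≤C d)

cauchy-near : ∀ z ε → 0ℚ ℚ.< ε → ∃[ N ] (∀ m n → N ℕ.≤ m → N ℕ.≤ n → Near ε (z ﹫ m) (z ﹫ n))
cauchy-near z ε 0<ε =
  let M , re< = cauchy (re z) _ (0<½* 0<ε)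
      N , im< = cauchy (im z) _ (0<½* 0<ε)
  in M ℕ.⊔ N , λ m n l l′ → near (disc-radius (½*-double ε) (disc-abs
       (ℚ.<⇒≤ (re< m n (ℕ.m⊔n≤o⇒m≤o M N l) (ℕ.m⊔n≤o⇒m≤o M N l′)))
       (ℚ.<⇒≤ (im< m n (ℕ.m⊔n≤o⇒n≤o M N l) (ℕ.m⊔n≤o⇒n≤o M N l′)))))

module GeometricLimit {r} (0<r : 0ℚ ℚ.< r) (r<1 : r ℚ.< 1ℚ) (D : ℚ) (f : ℕ → ℂ)
  (close : ∀ n k → ∣ f (n ℕ.+ k) + - f n ∣≤ D ℚ.* r ^ℚ n) where

  open Powers 0<r r<1

  -- A diagonal construction: the k-th approximation of the limit is read off from f k at an index
  -- beyond which f k moves by at most rᵏ.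
  index : ℕ → ℕ
  index k = proj₁ (cauchy-near (f k) (r ^ℚ k) (^ℚ-pos 0<r k))

  reL imL : ℕ → ℚ
  reL k = seq (re (f k)) (index k)
  imL k = seq (im (f k)) (index k)

  L﹫_ : ℕ → ℚ × ℚ
  L﹫ k = reL k , imL k

  -- Three comparisons are joined through a late index m: f k from its chosen index to m, f k with f
  -- n at m, and f n from m to k. They cost at most δ, Drⁿ + δ and δ, where δ = ε/4.
  L-near : ∀ n ε → 0ℚ ℚ.< ε → Eventually (λ k →
    Near (D ℚ.* r ^ℚ n ℚ.+ ε) (L﹫ k) (f n ﹫ k))
  L-near n ε 0<ε =
    let δ = ½ ℚ.* (½ ℚ.* ε)
        0<δ : 0ℚ ℚ.< δ
        0<δ = 0<½* (0<½* 0<ε)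
        N₁ , small = powers-vanish δ 0<δ
        N₂ , fn = cauchy-near (f n) δ 0<δ
        N = n ℕ.⊔ (N₁ ℕ.⊔ N₂)
    in N , λ k N≤k →
      let n≤k  = ℕ.m⊔n≤o⇒m≤o n (N₁ ℕ.⊔ N₂) N≤k
          N₁≤k = ℕ.m⊔n≤o⇒m≤o N₁ N₂ (ℕ.m⊔n≤o⇒n≤o n (N₁ ℕ.⊔ N₂) N≤k)
          N₂≤k = ℕ.m⊔n≤o⇒n≤o N₁ N₂ (ℕ.m⊔n≤o⇒n≤o n (N₁ ℕ.⊔ N₂) N≤k)
          M , fk-fn = ∣_∣≤_.within (≡.subst (λ j → ∣ f j + - f n ∣≤ D ℚ.* r ^ℚ n) (ℕ.m+[n∸m]≡n n≤k) (close n (k ℕ.∸ n))) δ 0<δ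
          m = M ℕ.⊔ (index k ℕ.⊔ N₂)
          M≤m  = ℕ.m≤m⊔n M (index k ℕ.⊔ N₂)
          i≤m  = ℕ.≤-trans (ℕ.m≤m⊔n (index k) N₂) (ℕ.m≤n⊔m M (index k ℕ.⊔ N₂))
          N₂≤m = ℕ.≤-trans (ℕ.m≤n⊔m (index k) N₂) (ℕ.m≤n⊔m M (index k ℕ.⊔ N₂))
      in near-weaken
           (ℚ.≤-trans
             (ℚ.+-monoˡ-≤ δ (ℚ.+-monoˡ-≤ (D ℚ.* r ^ℚ n ℚ.+ δ) (small k N₁≤k)))
             (≤-by δ (ℚ.<⇒≤ 0<δ)
               (solve 2 (λ x e → ((con ½ :* (con ½ :* e)) :+ (x :+ (con ½ :* (con ½ :* e)))) :+ (con ½ :* (con ½ :* e))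
                                   :+ (con ½ :* (con ½ :* e)) := x :+ e) ≡.refl (D ℚ.* r ^ℚ n) ε)))
           (near-join
             (near-join (proj₂ (cauchy-near (f k) (r ^ℚ k) (^ℚ-pos 0<r k)) (index k) m ℕ.≤-refl i≤m) (near (fk-fn m M≤m)))
             (fn m k N₂≤m N₂≤k))

  0≤D : 0ℚ ℚ.≤ D
  0≤D = ≡.subst (0ℚ ℚ.≤_) (ℚ.*-identityʳ D) (∣_∣≤_.radius≥0 (close 0 0))

  L-cauchy : ∀ ε → 0ℚ ℚ.< ε → ∃[ N ] (∀ k l → N ℕ.≤ k → N ℕ.≤ l →
    Near (½ ℚ.* ε) (L﹫ k) (L﹫ l))
  L-cauchy ε 0<ε =
    -- Each use of `L-near` costs 2η and the comparison within f n costs η; the total 5η is below 8η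
    -- = ε/2.
    let η = ½ ℚ.* (½ ℚ.* (½ ℚ.* (½ ℚ.* ε)))
        0<η : 0ℚ ℚ.< η
        0<η = 0<½* (0<½* (0<½* (0<½* 0<ε)))
        η′ , 0<η′ , eq = split (D ℚ.+ 1ℚ) η (ℚ.+-mono-≤-< 0≤D (ℚ.positive⁻¹ 1ℚ)) 0<η
        n , small = powers-vanish η′ 0<η′
        Drⁿ≤η : D ℚ.* r ^ℚ n ℚ.≤ η
        Drⁿ≤η = ℚ.≤-trans (*-mono-≤ (^ℚ-nonNeg 0≤r n) (≤-by {D} 1ℚ 0≤1 ≡.refl) (small n ℕ.≤-refl) (0≤+ 0≤D 0≤1))
          (ℚ.≤-reflexive eq)
        N₁ , L-fn = L-near n η 0<η
        N₂ , fn   = cauchy-near (f n) η 0<η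
    in N₁ ℕ.⊔ N₂ , λ k l N≤k N≤l → near-weaken
      (ℚ.≤-trans
        (ℚ.+-mono-≤ (ℚ.+-monoˡ-≤ η (ℚ.+-monoˡ-≤ η Drⁿ≤η)) (ℚ.+-monoˡ-≤ η Drⁿ≤η))
        (≤-by (η ℚ.+ (η ℚ.+ η)) (0≤+ (ℚ.<⇒≤ 0<η) (0≤+ (ℚ.<⇒≤ 0<η) (ℚ.<⇒≤ 0<η)))
          (solve 1 (λ e → let h = con ½ :* (con ½ :* (con ½ :* (con ½ :* e))) in
             ((h :+ h) :+ h) :+ (h :+ h) :+ (h :+ (h :+ h)) := con ½ :* e) ≡.refl ε)))
      (near-join
        (near-join (L-fn k (ℕ.m⊔n≤o⇒m≤o N₁ N₂ N≤k))
          (fn k l (ℕ.m⊔n≤o⇒n≤o N₁ N₂ N≤k) (ℕ.m⊔n≤o⇒n≤o N₁ N₂ N≤l)))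
        (near-flip (L-fn l (ℕ.m⊔n≤o⇒m≤o N₁ N₂ N≤l))))

  limit : ℂ
  limit = mkℝ reL (λ ε 0<ε → let N , c = L-cauchy ε 0<ε in
            N , λ k l N≤k N≤l → ℚ.≤-<-trans (disc-abs₁ (difference (c k l N≤k N≤l))) (½*-< 0<ε))
       +i mkℝ imL (λ ε 0<ε → let N , c = L-cauchy ε 0<ε in
            N , λ k l N≤k N≤l → ℚ.≤-<-trans (disc-abs₁ (disc-swap (difference (c k l N≤k N≤l)))) (½*-< 0<ε))

  limit-close : ∀ n → ∣ limit + - f n ∣≤ D ℚ.* r ^ℚ n
  limit-close n = bounded-by (0≤* 0≤D (^ℚ-nonNeg 0≤r n)) (λ ε 0<ε → ev-map (λ _ → difference) (L-near n ε 0<ε))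

ℂ-normed : CompleteNormedRing
ℂ-normed = record
  { commutativeRing = ℂ-commutativeRing
  ; ∣_∣≤_ = ∣_∣≤_
  ; norm-radius≥0 = ∣_∣≤_.radius≥0
  ; norm-cong = λ {z} {w} → norm-cong {z} {w}
  ; norm-weaken = norm-weaken
  ; norm-+ = norm-+
  ; norm-* = norm-*
  ; norm-neg = norm-neg
  ; norm-0 = norm-0
  ; norm-1 = norm-1
  ; norm-finite = norm-finite
  ; norm-separated = norm-separated
  ; complete = λ 0<r r<1 D f close → let open GeometricLimit 0<r r<1 D f close in limit , limit-close
  }

-- Inverses and strict inequalities.

-- The reciprocal is built from the sequence shifted by N, so the error is u(xₙ - x_(N+n)) with u =
-- 1/x_(N+n): a bounded factor times a Cauchy difference.
recip-inverse : ∀ x 0<x → x *ᵣ recip x 0<x ≈ᵣ 1ᵣ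
recip-inverse x 0<x@(η , 0<η , N , 0+η≤x) ε 0<ε =
  let B , 0<B , M , u≤B = eventually-bounded _ (cauchy (recip x 0<x))
      δ , 0<δ , Bδ≡ε    = split B ε 0<B 0<ε
      L , close         = cauchy x δ 0<δ
  in M ℕ.⊔ L , λ n l →
    let M≤n = ℕ.m⊔n≤o⇒m≤o M L l
        L≤n = ℕ.m⊔n≤o⇒n≤o M L l
        u = seq (recip x 0<x) n
        y = seq x (N ℕ.+ n)
    in ≡.subst₂ ℚ._<_
      (≡.cong ℚ.∣_∣ (≡.trans
        (solve 3 (λ u x y → u :* (x :- y) := x :* u :- y :* u) ≡.refl u (seq x n) y)
        (≡.cong (λ z → seq x n ℚ.* u ℚ.- z) (inverse n))))
      Bδ≡ε
      (*-bound {u} {seq x n ℚ.- y} (u≤B n M≤n) (close n (N ℕ.+ n) L≤n (ℕ.m≤n⇒m≤o+n N L≤n)) 0<B)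
  where
  inverse : ∀ n → seq x (N ℕ.+ n) ℚ.* seq (recip x 0<x) n ≡ 1ℚ
  inverse n = ℚ.*-inverseʳ (seq x (N ℕ.+ n)) ⦃ ℚ.>-nonZero (ℚ.<-≤-trans 0<η
    (≡.subst (ℚ._≤ seq x (N ℕ.+ n)) (ℚ.+-identityˡ η) (0+η≤x (N ℕ.+ n) (ℕ.m≤m+n N n)))) ⦄

inv-inverse : ∀ z z≉0 → z * inv z z≉0 ≈ 1#
inv-inverse z z≉0 = ≈-trans {z * inv z z≉0} {(∣ z ∣² *ᵣ recip ∣ z ∣² z≉0) +i 0ᵣ} {1#}
  (pointwise {z * inv z z≉0} {(∣ z ∣² *ᵣ recip ∣ z ∣² z≉0) +i 0ᵣ}
    (λ n → solve 3 (λ a b u → a :* (a :* u) :+ :- (b :* (:- b :* u)) := (a :* a :+ b :* b) :* u) ≡.refl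
      (seq (re z) n) (seq (im z) n) (seq (recip ∣ z ∣² z≉0) n))
    (λ n → solve 3 (λ a b u → a :* (:- b :* u) :+ b :* (a :* u) := con 0ℚ) ≡.refl
      (seq (re z) n) (seq (im z) n) (seq (recip ∣ z ∣² z≉0) n)))
  (recip-inverse ∣ z ∣² z≉0 , proj₂ (≈-refl {1#}))

module _ (z : ℂ) where

  norm² : ℕ → ℚ
  norm² n = seq ∣ z ∣² n

  norm²≥0 : ∀ n → 0ℚ ℚ.≤ norm² n
  norm²≥0 n = 0≤+ (square-nonNeg (seq (re z) n)) (square-nonNeg (seq (im z) n))

norm²-* : ∀ z w n → norm² (z * w) n ≡ norm² z n ℚ.* norm² w n
norm²-* z w n = solve 4 (λ a b c d →
  (a :* c :+ :- (b :* d)) :* (a :* c :+ :- (b :* d)) :+ (a :* d :+ b :* c) :* (a :* d :+ b :* c)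
    := (a :* a :+ b :* b) :* (c :* c :+ d :* d)) ≡.refl
  (seq (re z) n) (seq (im z) n) (seq (re w) n) (seq (im w) n)

-- Eventually the real part of zw is at least ½ and |w| ≤ B + 1, so |z|² is at least ¼/(B + 1)², the
-- required positive rational.
invertible⇒nonZero : ∀ z w → z * w ≈ 1# → NonZero z
invertible⇒nonZero z w (re≈1 , _) =
  let B , bounded-by 0≤B w≤B = norm-finite w
      C = (B ℚ.+ 1ℚ) ℚ.* (B ℚ.+ 1ℚ)
      0<B+1 = ℚ.+-mono-≤-< 0≤B (ℚ.positive⁻¹ 1ℚ)
      ε , 0<ε , Cε≡¼ = split C (½ ℚ.* ½) (0<* 0<B+1 0<B+1) (ℚ.positive⁻¹ (½ ℚ.* ½))
      N , lower = ev-zip (λ n c d → lower-bound n {B} {ε} 0<B+1 Cε≡¼ c d) (re≈1 ½ (ℚ.positive⁻¹ ½)) (w≤B 1ℚ (ℚ.positive⁻¹ 1ℚ))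
  in ε , 0<ε , N , λ n N≤n → ≡.subst (ℚ._≤ norm² z n) (≡.sym (ℚ.+-identityˡ ε)) (lower n N≤n)
  where
  lower-bound : ∀ n {B ε} → 0ℚ ℚ.< B ℚ.+ 1ℚ → (B ℚ.+ 1ℚ) ℚ.* (B ℚ.+ 1ℚ) ℚ.* ε ≡ ½ ℚ.* ½ →
    ℚ.∣ seq (re (z * w)) n ℚ.- 1ℚ ∣ ℚ.< ½ → w ∈[ n ] B ℚ.+ 1ℚ → ε ℚ.≤ norm² z n
  lower-bound n {B} {ε} 0<B+1 Cε≡¼ x≈1 (disc _ w≤) = ℚ.*-cancelˡ-≤-pos C ⦃ ℚ.positive (0<* 0<B+1 0<B+1) ⦄ (begin
    C ℚ.* ε                        ≡⟨ Cε≡¼ ⟩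
    ½ ℚ.* ½                        ≤⟨ square-mono (ℚ.<⇒≤ (ℚ.positive⁻¹ ½)) ½≤x ⟩
    x ℚ.* x                        ≤⟨ ≤-by (y ℚ.* y) (square-nonNeg y) ≡.refl ⟩
    norm² (z * w) n                ≡⟨ ≡.trans (norm²-* z w n) (ℚ.*-comm (norm² z n) (norm² w n)) ⟩
    norm² w n ℚ.* norm² z n        ≤⟨ *-mono-≤ (norm²≥0 z n) w≤ ℚ.≤-refl (ℚ.<⇒≤ (0<* 0<B+1 0<B+1)) ⟩
    C ℚ.* norm² z n                ∎)
    where
    open ℚ.≤-Reasoning
    C = (B ℚ.+ 1ℚ) ℚ.* (B ℚ.+ 1ℚ)
    x = seq (re (z * w)) n
    y = seq (im (z * w)) n
    ½≤x : ½ ℚ.≤ x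
    ½≤x = begin
      ½                              ≡⟨⟩
      1ℚ ℚ.- ½                       ≤⟨ ℚ.+-monoʳ-≤ 1ℚ (ℚ.neg-antimono-≤ (ℚ.<⇒≤ x≈1)) ⟩
      1ℚ ℚ.- ℚ.∣ x ℚ.- 1ℚ ∣          ≡⟨ ≡.cong (λ y → 1ℚ ℚ.- y) (≡.trans (≡.sym (ℚ.∣-p∣≡∣p∣ (x ℚ.- 1ℚ)))
                                          (≡.cong ℚ.∣_∣ (solve 1 (λ x → :- (x :- con 1ℚ) := con 1ℚ :- x) ≡.refl x))) ⟩
      1ℚ ℚ.- ℚ.∣ 1ℚ ℚ.- x ∣          ≤⟨ ℚ.+-monoʳ-≤ 1ℚ (ℚ.neg-antimono-≤ (p≤∣p∣ (1ℚ ℚ.- x))) ⟩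
      1ℚ ℚ.- (1ℚ ℚ.- x)              ≡⟨ solve 1 (λ x → con 1ℚ :- (con 1ℚ :- x) := x) ≡.refl x ⟩
      x                              ∎
      where
      p≤∣p∣ : ∀ p → p ℚ.≤ ℚ.∣ p ∣
      p≤∣p∣ p = square-cancel (ℚ.0≤∣p∣ p) (ℚ.≤-reflexive (≡.sym (abs-square p)))

norm⇒<ᵣ : ∀ {z ε} → 0ℚ ℚ.< ε → ∣ z ∣≤ ½ ℚ.* ε → ∣ z ∣² <ᵣ fromℚ (ε ℚ.* ε)
norm⇒<ᵣ {z} {ε} 0<ε (bounded-by _ b) =
  -- With δ = ε/4 one has (ε/2 + δ)² + δ² = 5ε²/8, which leaves room for the strict inequality.
  let δ = ½ ℚ.* (½ ℚ.* ε)
      0<δ : 0ℚ ℚ.< δ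
      0<δ = 0<½* (0<½* 0<ε)
      N , within = b δ 0<δ
  in δ ℚ.* δ , 0<* 0<δ 0<δ , N , λ n N≤n → ℚ.≤-trans
    (ℚ.+-monoˡ-≤ (δ ℚ.* δ) (⟪_,_⟫∈_.disc-within (within n N≤n)))
    (≤-by (δ ℚ.* (ε ℚ.+ ½ ℚ.* ε))
      (0≤* (ℚ.<⇒≤ 0<δ) (0≤+ (ℚ.<⇒≤ 0<ε) (ℚ.<⇒≤ (0<½* 0<ε))))
      (solve 1 (λ e → let h = con ½ :* e ; d = con ½ :* h in
        (h :+ d) :* (h :+ d) :+ d :* d :+ d :* (e :+ h)
          := e :* e) ≡.refl ε))

module _ {ρ} (0<ρ : 0ℚ ℚ.< ρ) (ρ<1 : ρ ℚ.< 1ℚ) where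

  open Analysis ℂ-normed 0<ρ ρ<1 using (_⇝_; big-O)
  open Powers 0<ρ ρ<1

  ⇝⇒⟶ : ∀ f L → f ⇝ L → f ⟶ L
  ⇝⇒⟶ f L (big-O C 0≤C b) ε 0<ε =
    let δ , 0<δ , eq = split (C ℚ.+ 1ℚ) (½ ℚ.* ε) (ℚ.+-mono-≤-< 0≤C (ℚ.positive⁻¹ 1ℚ)) (0<½* 0<ε)
        N , small = powers-vanish δ 0<δ
    in N , λ n N≤n → norm⇒<ᵣ {f n - L} 0<ε (norm-pointwise
      (λ k → flip (seq (re L) k) (seq (re (f n)) k)) (λ k → flip (seq (im L) k) (seq (im (f n)) k))
      (norm-neg (norm-weaken (ℚ.≤-trans
        (*-mono-≤ (^ℚ-nonNeg 0≤r n) (≤-by {C} 1ℚ 0≤1 ≡.refl) (small n N≤n) (0≤+ 0≤C 0≤1))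
        (ℚ.≤-reflexive eq)) (b n))))
    where
    flip : ∀ a b → ℚ.- (a ℚ.+ ℚ.- b) ≡ b ℚ.+ ℚ.- a
    flip = solve 2 (λ a b → :- (a :+ :- b) := b :+ :- a) ≡.refl

-- A common ratio ρ extracted from the hypotheses.

module Shrink {θ} (0<θ : 0ℚ ℚ.< θ) (θ≤1 : θ ℚ.≤ 1ℚ) where

  -- A rational number below 1 that dominates the square root of 1 - θ, because (1 - θ/2)² = 1 - θ +
  -- θ²/4.
  radius : ℚ
  radius = 1ℚ ℚ.- ½ ℚ.* θ

  0≤1-θ : 0ℚ ℚ.≤ 1ℚ ℚ.- θ
  0≤1-θ = ≤⇒0≤- θ≤1

  ½≤radius : ½ ℚ.≤ radius
  ½≤radius = ≤-by (½ ℚ.* (1ℚ ℚ.- θ)) (0≤* (ℚ.<⇒≤ (ℚ.positive⁻¹ ½)) 0≤1-θ)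
    (solve 1 (λ e → con ½ :+ con ½ :* (con 1ℚ :- e) := con 1ℚ :- con ½ :* e) ≡.refl θ)

  0<radius : 0ℚ ℚ.< radius
  0<radius = ℚ.<-≤-trans (ℚ.positive⁻¹ ½) ½≤radius

  radius<1 : radius ℚ.< 1ℚ
  radius<1 = ≡.subst (radius ℚ.<_) (ℚ.+-identityʳ 1ℚ) (ℚ.+-monoʳ-< 1ℚ (ℚ.neg-antimono-< (0<½* 0<θ)))

  1-θ≤radius² : 1ℚ ℚ.- θ ℚ.≤ radius ℚ.* radius
  1-θ≤radius² = ≤-by (½ ℚ.* θ ℚ.* (½ ℚ.* θ)) (square-nonNeg (½ ℚ.* θ))
    (solve 1 (λ e → con 1ℚ :- e :+ con ½ :* e :* (con ½ :* e) := (con 1ℚ :- con ½ :* e) :* (con 1ℚ :- con ½ :* e)) ≡.refl θ)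

  norm²-≤ : ∀ {z} → Eventually (λ n → norm² z n ℚ.≤ 1ℚ ℚ.- θ) → ∣ z ∣≤ radius
  norm²-≤ {z} ev = bounded-by (ℚ.<⇒≤ 0<radius) λ ε 0<ε →
    ev-map (λ n z≤ → disc-weaken {seq (re z) n} (≤-by ε (ℚ.<⇒≤ 0<ε) ≡.refl)
      (disc (ℚ.<⇒≤ 0<radius) (ℚ.≤-trans z≤ 1-θ≤radius²))) ev

  -- Uses |z²| = |z|². The slack survives the root because 2 · `radius` = 2 - θ ≥ 1 gives `radius`²
  -- + ε ≤ (`radius` + ε)².
  norm-root : ∀ {z} → ∣ z * z ∣≤ 1ℚ ℚ.- θ → ∣ z ∣≤ radius
  norm-root {z} (bounded-by _ b) = bounded-by (ℚ.<⇒≤ 0<radius) λ ε 0<ε →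
    let 0≤ε = ℚ.<⇒≤ 0<ε in
    ev-map (λ n zz≤ → disc (0≤+ (ℚ.<⇒≤ 0<radius) 0≤ε) (ℚ.≤-trans
      (square-cancel (⟪_,_⟫∈_.disc-radius≥0 zz≤)
        (≡.subst (ℚ._≤ (1ℚ ℚ.- θ ℚ.+ ε) ℚ.* (1ℚ ℚ.- θ ℚ.+ ε)) (norm²-* z z n) (⟪_,_⟫∈_.disc-within zz≤)))
      (ℚ.≤-trans (ℚ.+-monoˡ-≤ ε 1-θ≤radius²)
        (≤-by (ε ℚ.* (1ℚ ℚ.- θ ℚ.+ ε)) (0≤* 0≤ε (0≤+ 0≤1-θ 0≤ε))
          (solve 2 (λ e d → let r = con 1ℚ :- con ½ :* e in
             r :* r :+ d :+ d :* (con 1ℚ :- e :+ d) := (r :+ d) :* (r :+ d)) ≡.refl θ ε)))))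
      (b ε 0<ε)

  -- Since |w⁻¹z|² ≤ (1 - θ)|w⁻¹|²|w|² = (1 - θ)|ww⁻¹|², the bound comes from ww⁻¹ = 1, with no
  -- separate estimate of w⁻¹.
  norm-quotient : ∀ {z w} (w≉0 : NonZero w) → Eventually (λ n → norm² z n ℚ.≤ (1ℚ ℚ.- θ) ℚ.* norm² w n) →
    ∣ inv w w≉0 * z ∣≤ radius
  norm-quotient {z} {w} w≉0 z≤ = bounded-by (ℚ.<⇒≤ 0<radius) λ ε 0<ε →
    ev-zip (quotient-bound (ℚ.<⇒≤ 0<ε)) z≤ (∣_∣≤_.within ∣w′w∣≤1 ε 0<ε)
    where
    w′ = inv w w≉0
    ∣w′w∣≤1 : ∣ w * w′ ∣≤ 1ℚ
    ∣w′w∣≤1 = norm-cong {1#} {w * w′} (≈-sym {w * w′} {1#} (inv-inverse w w≉0)) norm-1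
    quotient-bound : ∀ {ε} → 0ℚ ℚ.≤ ε → ∀ n → norm² z n ℚ.≤ (1ℚ ℚ.- θ) ℚ.* norm² w n →
      (w * w′) ∈[ n ] 1ℚ ℚ.+ ε → (w′ * z) ∈[ n ] radius ℚ.+ ε
    quotient-bound {ε} 0≤ε n z≤ (disc _ ww′≤) = disc (0≤+ 0≤radius 0≤ε) (begin
      norm² (w′ * z) n                                   ≡⟨ norm²-* w′ z n ⟩
      u ℚ.* norm² z n                                    ≤⟨ *-monoʳ u (norm²≥0 w′ n) z≤ ⟩
      u ℚ.* ((1ℚ ℚ.- θ) ℚ.* norm² w n)                   ≡⟨ solve 3 (λ u e x → u :* (e :* x) := e :* (x :* u)) ≡.refl u (1ℚ ℚ.- θ) (norm² w n) ⟩
      (1ℚ ℚ.- θ) ℚ.* (norm² w n ℚ.* u)                   ≡⟨ ≡.cong ((1ℚ ℚ.- θ) ℚ.*_) (norm²-* w w′ n) ⟨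
      (1ℚ ℚ.- θ) ℚ.* norm² (w * w′) n                    ≤⟨ *-mono-≤ (norm²≥0 (w * w′) n) 1-θ≤radius² ww′≤ (square-nonNeg radius) ⟩
      radius ℚ.* radius ℚ.* ((1ℚ ℚ.+ ε) ℚ.* (1ℚ ℚ.+ ε))  ≡⟨ solve 2 (λ r e → r :* r :* ((con 1ℚ :+ e) :* (con 1ℚ :+ e)) := (r :+ r :* e) :* (r :+ r :* e)) ≡.refl radius ε ⟩
      (radius ℚ.+ radius ℚ.* ε) ℚ.* (radius ℚ.+ radius ℚ.* ε)
                                                         ≤⟨ square-mono (0≤+ 0≤radius (0≤* 0≤radius 0≤ε)) (ℚ.+-monoʳ-≤ radius
                                                              (ℚ.≤-trans (*-mono-≤ 0≤ε (ℚ.<⇒≤ radius<1) ℚ.≤-refl 0≤1) (ℚ.≤-reflexive (ℚ.*-identityˡ ε)))) ⟩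
      (radius ℚ.+ ε) ℚ.* (radius ℚ.+ ε)                  ∎)
      where
      open ℚ.≤-Reasoning
      u = norm² w′ n
      0≤radius = ℚ.<⇒≤ 0<radius

⊔-< : ∀ {p q r} → p ℚ.< r → q ℚ.< r → p ℚ.⊔ q ℚ.< r
⊔-< {p} {q} {r} p<r q<r with ℚ.⊔-sel p q
... | inj₁ eq = ≡.subst (ℚ._< r) (≡.sym eq) p<r
... | inj₂ eq = ≡.subst (ℚ._< r) (≡.sym eq) q<r

i²≈-1 : i * i ≈ - 1#
i²≈-1 = pointwise {i * i} { - 1#} (λ _ → ≡.refl) (λ _ → ≡.refl)

common-radius : ∀ q t ζ → t ^ 2 ≈ q → ∣ q ∣<∣ 1# ∣ → (q<ζ : ∣ q ∣<∣ ζ ∣) → ∣ ζ ∣<∣ 1# ∣ →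
  ∃[ ρ ] (0ℚ ℚ.< ρ × ρ ℚ.< 1ℚ × ∣ t ∣≤ ρ × ∣ ζ ∣≤ ρ × ∣ inv ζ (larger-nonZero {q} {ζ} q<ζ) * q ∣≤ ρ)
common-radius q t ζ t²≈q (ε₁ , 0<ε₁ , N₁ , q≤1) q<ζ@(ε₂ , 0<ε₂ , N₂ , q≤ζ) (ε₃ , 0<ε₃ , N₃ , ζ≤1) =
  ρ , 0<ρ , ρ<1 , ∣t∣≤ , ∣ζ∣≤ , ∣η∣≤
  where
  ζ≉0 : NonZero ζ
  ζ≉0 = larger-nonZero {q} {ζ} q<ζ
  below-1 : ∀ {x ε} → 0ℚ ℚ.≤ x → x ℚ.+ ε ℚ.≤ 1ℚ → ε ℚ.≤ 1ℚ
  below-1 {x} {ε} 0≤x x+ε≤1 = ℚ.≤-trans (≡.subst (ℚ._≤ x ℚ.+ ε) (ℚ.+-identityˡ ε) (ℚ.+-monoˡ-≤ ε 0≤x)) x+ε≤1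
  move : ∀ {x ε y} → x ℚ.+ ε ℚ.≤ y → x ℚ.≤ y ℚ.- ε
  move {x} {ε} {y} h = ≡.subst (ℚ._≤ y ℚ.- ε) (solve 2 (λ x e → x :+ e :- e := x) ≡.refl x ε) (ℚ.+-monoˡ-≤ (ℚ.- ε) h)
  ζ²≤1 : ∀ n → N₃ ℕ.≤ n → norm² ζ n ℚ.≤ 1ℚ
  ζ²≤1 n l = ℚ.≤-trans (≤-by ε₃ (ℚ.<⇒≤ 0<ε₃) ≡.refl) (ζ≤1 n l)
  ε₂≤1 : ε₂ ℚ.≤ 1ℚ
  ε₂≤1 = below-1 (norm²≥0 q n) (ℚ.≤-trans (q≤ζ n (ℕ.m≤m⊔n N₂ N₃)) (ζ²≤1 n (ℕ.m≤n⊔m N₂ N₃)))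
    where n = N₂ ℕ.⊔ N₃
  ½ε₁≤1 : ½ ℚ.* ε₁ ℚ.≤ 1ℚ
  ½ε₁≤1 = ℚ.≤-trans (ℚ.<⇒≤ (½*-< 0<ε₁)) (below-1 (norm²≥0 q N₁) (q≤1 N₁ ℕ.≤-refl))
  -- The hypothesis concerns |q|², so |t| is two roots away: `S₁` yields |q| ≤ 1 - ε₁/2, which is
  -- the assumption of `S₁′` with θ = ε₁/2.
  module S₁ = Shrink 0<ε₁ (below-1 (norm²≥0 q N₁) (q≤1 N₁ ℕ.≤-refl))
  module S₁′ = Shrink (0<½* 0<ε₁) ½ε₁≤1
  module S₂ = Shrink 0<ε₂ ε₂≤1
  module S₃ = Shrink 0<ε₃ (below-1 (norm²≥0 ζ N₃) (ζ≤1 N₃ ℕ.≤-refl))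
  ρ : ℚ
  ρ = S₁′.radius ℚ.⊔ (S₂.radius ℚ.⊔ S₃.radius)
  0<ρ : 0ℚ ℚ.< ρ
  0<ρ = ℚ.<-≤-trans S₁′.0<radius (ℚ.p≤p⊔q S₁′.radius (S₂.radius ℚ.⊔ S₃.radius))
  ρ<1 : ρ ℚ.< 1ℚ
  ρ<1 = ⊔-< S₁′.radius<1 (⊔-< S₂.radius<1 S₃.radius<1)
  ∣ζ∣≤ : ∣ ζ ∣≤ ρ
  ∣ζ∣≤ = norm-weaken (ℚ.≤-trans (ℚ.p≤q⊔p S₂.radius S₃.radius) (ℚ.p≤q⊔p S₁′.radius (S₂.radius ℚ.⊔ S₃.radius)))
    (S₃.norm²-≤ {ζ} (N₃ , λ n l → move (ζ≤1 n l)))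
  ∣q∣≤ : ∣ q ∣≤ S₁.radius
  ∣q∣≤ = S₁.norm²-≤ {q} (N₁ , λ n l → move (q≤1 n l))
  ∣t∣≤ : ∣ t ∣≤ ρ
  ∣t∣≤ = norm-weaken (ℚ.p≤p⊔q S₁′.radius (S₂.radius ℚ.⊔ S₃.radius))
    (S₁′.norm-root {t} (norm-cong {q} {t * t}
      (≈-sym {t * t} {q} (≈-trans {t * t} {t ^ 2} {q} (t*t≈t² ) t²≈q)) ∣q∣≤))
    where
    t*t≈t² : t * t ≈ t ^ 2
    t*t≈t² = *-cong {t} {t} {t} {t * 1#} (≈-refl {t}) (≈-sym {t * 1#} {t} (pointwise {t * 1#} {t}
      (λ n → solve 2 (λ a b → a :* con 1ℚ :+ :- (b :* con 0ℚ) := a) ≡.refl (seq (re t) n) (seq (im t) n))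
      (λ n → solve 2 (λ a b → a :* con 0ℚ :+ b :* con 1ℚ := b) ≡.refl (seq (re t) n) (seq (im t) n))))
  ∣η∣≤ : ∣ inv ζ ζ≉0 * q ∣≤ ρ
  ∣η∣≤ = norm-weaken (ℚ.≤-trans (ℚ.p≤p⊔q S₂.radius S₃.radius) (ℚ.p≤q⊔p S₁′.radius (S₂.radius ℚ.⊔ S₃.radius)))
    (S₂.norm-quotient {q} {ζ} ζ≉0 (ev-zip
      -- The additive gap becomes a multiplicative one: |q|² ≤ |ζ|² - ε₂ ≤ (1 - ε₂)|ζ|², because
      -- |ζ|² ≤ 1.
      (λ n x<y y≤1 → ℚ.≤-trans (move x<y) (≤-by (ε₂ ℚ.* (1ℚ ℚ.- norm² ζ n)) (0≤* (ℚ.<⇒≤ 0<ε₂) (≤⇒0≤- y≤1))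
        (solve 2 (λ y e → y :- e :+ e :* (con 1ℚ :- y) := (con 1ℚ :- e) :* y) ≡.refl (norm² ζ n) ε₂)))
      (N₂ , q≤ζ) (N₃ , ζ²≤1)))

-- Specialisation of the abstract identity to ℂ.

module _ {ρ} (0<ρ : 0ℚ ℚ.< ρ) (ρ<1 : ρ ℚ.< 1ℚ) (q t ζ : ℂ) (ζ≉0 : NonZero ζ) (t²≈q : t ^ 2 ≈ q)
  (∣t∣≤ : ∣ t ∣≤ ρ) (∣ζ∣≤ : ∣ ζ ∣≤ ρ) (∣η∣≤ : ∣ inv ζ ζ≉0 * q ∣≤ ρ) where

  private
    open Analysis ℂ-normed 0<ρ ρ<1 using (_⇝_; ⇝-cong; sumTo)
    module R = CommutativeRing ℂ-commutativeRing
    module T = Sides ℂ-normed 0<ρ ρ<1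

  ζη≈q : ζ * (inv ζ ζ≉0 * q) ≈ q
  ζη≈q = ≈-trans {ζ * (inv ζ ζ≉0 * q)} {(ζ * inv ζ ζ≉0) * q} {q}
    (≈-sym {(ζ * inv ζ ζ≉0) * q} {ζ * (inv ζ ζ≉0 * q)} (R.*-assoc ζ (inv ζ ζ≉0) q))
    (≈-trans {(ζ * inv ζ ζ≉0) * q} {1# * q} {q}
      (*-cong {ζ * inv ζ ζ≉0} {1#} {q} {q} (inv-inverse ζ ζ≉0) (≈-refl {q})) (R.*-identityˡ q))

  /-inverse : ∀ z w w≉0 {x} → w * x ≈ 1# → z / w [ w≉0 ] ≈ z * x
  /-inverse z w w≉0 {x} wx≈1 = T./-cong-inverse z w {inv w w≉0} {x} (inv-inverse w w≉0) wx≈1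

  ⇝⇒HasSum : ∀ f s → sumTo f ⇝ s → HasSum f s
  ⇝⇒HasSum f s f⇝s = ⇝⇒⟶ 0<ρ ρ<1 (λ n → sum {n} (f ∘ toℕ)) s
    (⇝-cong {sumTo f} {λ n → sum {n} (f ∘ toℕ)} {s} {s}
      (λ n → ≈-sym {sum {n} (f ∘ toℕ)} {sumTo f n} (T.sum≈sumTo n f)) (≈-refl {s}) f⇝s)

  private
    module V = T.Values NonZero invertible⇒nonZero _/_[_] /-inverse
      ⟨_﹔_⟩_ (λ x p n → T.product≈prodTo n (λ k → 1# - x * p ^ k))
      _⟶_ (⇝⇒⟶ 0<ρ ρ<1)
      HasSum ⇝⇒HasSum
      {q} {t} {ζ} {inv ζ ζ≉0 * q} {i} t²≈q ζη≈q i²≈-1 ∣t∣≤ ∣ζ∣≤ ∣η∣≤ norm-i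
      (numerator ζ ζ≉0 q t) (denominator t)
      (λ j n → ≈-refl {numerator ζ ζ≉0 q t j n}) (λ j n → ≈-refl {denominator t j n})
    module N = Notation _≈_ _*_ -_ 1# _^_ NonZero _/_[_] ⟨_﹔_⟩_ _⟶_ HasSum ζ (inv ζ ζ≉0 * q) q
      (numerator ζ ζ≉0 q t) (denominator t)

  left⇒P̄ω : ∀ {v} → N.LeftSide v → P̄ω ζ ζ≉0 q v
  left⇒P̄ω l = [q]∞ , [ζ]∞ , [η]∞ , [-q]∞ , q-limit , ζ-limit , η-limit , -q-limit ,
    prefactor≉0 , [q]₂ₙ≉0 , series , series-sum , value
    where open N.LeftSide l

  right⇒DoubleSeries : ∀ {v} → N.RightSide v → DoubleSeries ζ ζ≉0 q t v
  right⇒DoubleSeries r = [q]∞ , [ζ]∞ , [η]∞ , q-limit , ζ-limit , η-limit ,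
    prefactor≉0 , denominator≉0 , inner , series , inner-sum , series-sum , value
    where open N.RightSide r

  equal-sides : ∃[ v ] (P̄ω ζ ζ≉0 q v × DoubleSeries ζ ζ≉0 q t v)
  equal-sides = let v , l , r = V.two-sides in v , left⇒P̄ω l , right⇒DoubleSeries r

theorem3p1 :
    (q t ζ : ℂ) → t ^ 2 ≈ q →
    ∣ 0# ∣<∣ q ∣ → ∣ q ∣<∣ 1# ∣ →
    (q<ζ : ∣ q ∣<∣ ζ ∣) → ∣ ζ ∣<∣ 1# ∣ →
    ∃[ v ] (P̄ω ζ (larger-nonZero {q} {ζ} q<ζ) q v
          × DoubleSeries ζ (larger-nonZero {q} {ζ} q<ζ) q t v)
theorem3p1 q t ζ t²≈q _ q<1 q<ζ ζ<1 =
  let ρ , 0<ρ , ρ<1 , ∣t∣≤ , ∣ζ∣≤ , ∣η∣≤ = common-radius q t ζ t²≈q q<1 q<ζ ζ<1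
  in equal-sides 0<ρ ρ<1 q t ζ (larger-nonZero {q} {ζ} q<ζ) t²≈q ∣t∣≤ ∣ζ∣≤ ∣η∣≤
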